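{- For every $\eta>0$ there exists $C>0$ such that for every non-constant $f\colon\{0,1\}^n\to\{0,1\}$, \[ \sum_{S\subseteq[n]}\widehat f(S)^2\,\mathbf{1}\Big[|\widehat f(S)|\leq 2^{ -C\cdot\tilde I[f]\log(1+\tilde I[f])}\Big]\leq \eta\cdot\mathrm{var}(f). \]
   Context: $\{0,1\}^n$ carries the uniform measure; $\chi_S(x)=(-1)^{\sum_{i\in S}x_i}$, $\widehat f(S)=\mathbb{E}_x[f(x)\chi_S(x)]$. The total influence is $I[f]=\sum_S|S|\widehat f(S)^2$, $\mathrm{var}(f)=\mathbb{E}[f^2]-\mathbb{E}[f]^2$, $\tilde I[f]=I[f]/\mathrm{var}(f)$. $\log$ is the natural logarithm. -}

module Defs where

open import Data.Bool using (Bool; true; false; _∧_; if_then_else_)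
open import Data.Nat as ℕ using (ℕ; zero; suc)
open import Data.Integer as ℤ using (ℤ; +_)
open import Data.Rational using (ℚ; 0ℚ; 1ℚ; _+_; _*_; _-_; -_; _≤_; ∣_∣; _÷_; ↥_; ↧ₙ_; _/_)
open import Data.Rational.Properties using (_≤?_; _≟_)
open import Data.Vec using (Vec; []; _∷_; zipWith)
open import Data.List using (List; []; _∷_; map; _++_; foldr)
open import Relation.Nullary using (does; yes; no)
open import Data.Product using (∃; _×_)
open import Relation.Binary.PropositionalEquality using (_≢_)

-- Points of {0,1}^n (and subsets S ⊆ [n], as indicator vectors).
allVecs : (n : ℕ) → List (Vec Bool n)
allVecs zero = [] ∷ []
allVecs (suc n) = map (false ∷_) (allVecs n) ++ map (true ∷_) (allVecs n)

sumℚ : List ℚ → ℚ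
sumℚ = foldr _+_ 0ℚ

powℚ : ℚ → ℕ → ℚ
powℚ a zero = 1ℚ
powℚ a (suc k) = a * powℚ a k

inv2pow : ℕ → ℚ
inv2pow n = powℚ (+ 1 / 2) n

𝔼 : {n : ℕ} → (Vec Bool n → ℚ) → ℚ
𝔼 {n} g = inv2pow n * sumℚ (map g (allVecs n))

card : {n : ℕ} → Vec Bool n → ℕ
card [] = 0
card (true ∷ v) = suc (card v)
card (false ∷ v) = card v

isEven : ℕ → Bool
isEven zero = true
isEven (suc zero) = false
isEven (suc (suc k)) = isEven k

χ : {n : ℕ} → Vec Bool n → Vec Bool n → ℚ
χ S x = if isEven (card (zipWith _∧_ S x)) then 1ℚ else - 1ℚ

bval : Bool → ℚ
bval true = 1ℚ
bval false = 0ℚ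

fval : {n : ℕ} → (Vec Bool n → Bool) → Vec Bool n → ℚ
fval f x = bval (f x)

fhat : {n : ℕ} → (Vec Bool n → Bool) → Vec Bool n → ℚ
fhat f S = 𝔼 (λ x → fval f x * χ S x)

var : {n : ℕ} → (Vec Bool n → Bool) → ℚ
var f = 𝔼 (λ x → fval f x * fval f x) - 𝔼 (fval f) * 𝔼 (fval f)

Inf : {n : ℕ} → (Vec Bool n → Bool) → ℚ
Inf {n} f = sumℚ (map (λ S → (+ card S / 1) * (fhat f S * fhat f S)) (allVecs n))

-- total division (only ever used with a nonzero divisor below)
divℚ : ℚ → ℚ → ℚ
divℚ p q with q ≟ 0ℚ
... | yes _ = 0ℚ
... | no q≢0 = p ÷ q
  where instance _ = Data.Rational.≢-nonZero q≢0

Ĩ : {n : ℕ} → (Vec Bool n → Bool) → ℚ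
Ĩ f = divℚ (Inf f) (var f)

NonConstant : {n : ℕ} → (Vec Bool n → Bool) → Set
NonConstant f = ∃ λ x → ∃ λ y → f x ≢ f y

-- BelowPow a u r  :⇔  |a| ≤ u^{-r}   for rational r = p/q ≥ 0 (q > 0), u ≥ 1,
-- written out as  |a|^q · u^p ≤ 1.
BelowPow : ℚ → ℚ → ℚ → Set
BelowPow a u r = powℚ ∣ a ∣ (↧ₙ r) * powℚ u (ℤ.∣ ↥ r ∣) ≤ 1ℚ

belowPow? : ℚ → ℚ → ℚ → Bool
belowPow? a u r = does (powℚ ∣ a ∣ (↧ₙ r) * powℚ u (ℤ.∣ ↥ r ∣) ≤? 1ℚ)

-- Σ_S f̂(S)^2 · 1[ |f̂(S)| ≤ (1+Ĩ)^{-D·Ĩ} ]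
-- Note (1+Ĩ)^{-D Ĩ} = 2^{-C Ĩ log(1+Ĩ)} with D = C · log 2 (natural log).
smallMass : {n : ℕ} → ℚ → (Vec Bool n → Bool) → ℚ
smallMass {n} D f =
  sumℚ (map (λ S → if belowPow? (fhat f S) (1ℚ + Ĩ f) (D * Ĩ f)
                    then fhat f S * fhat f S else 0ℚ)
            (allVecs n))

{-# OPTIONS --safe #-}

-- For a set A of coordinates, restrict f at random outside A and call a Fourier coefficient of the
-- restriction negligible if its square is below a threshold 1/r.  If A is the disjoint union of B and C,
-- then the coefficients on A are the Fourier coefficients, in the coordinates of C, of the coefficients
-- on B.  A coefficient on B that is not negligible is large wherever it does not vanish, so by
-- hypercontractivity it has little low-degree weight on C unless its norm is large; as the squared norms
-- add up to at most 1, few frequencies on B survive, and likewise few on C.  Hence negligibility on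
-- B and C gives negligibility on A, where log r increases by O(|U| + log L) for the frequency U and the
-- error by O(influence of A / L).  On a single part of a random partition into about d parts, where a set
-- U of size at most d has few elements, the same argument applied to the single coordinates gives
-- log r = O(|U|² + |U| log L), since a discrete derivative of f only takes the values 0 and ±1/2.
-- Halving [n] at random log d times and merging back yields log r = O(d log d) when L is polynomial in d.
-- Levels above d = O(Ĩ/η) carry little weight because of the total influence.
module Submission where

open import Defs
open import Data.Bool using (Bool; true; false; _∧_; not; if_then_else_)
open import Data.Empty using (⊥-elim)
open import Data.Fin using (Fin; zero; suc)
open import Data.Integer as ℤ using (+_)
import Data.Integer.Properties as ℤₚ
open import Data.List using ([]; _∷_; map; _++_)
open import Data.List.Properties using (map-++; map-∘)
open import Data.Nat as ℕ using (ℕ; zero; suc)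
import Data.Nat.Properties as ℕₚ
open import Data.Nat.Tactic.RingSolver using (solve-∀)
open import Data.Product using (∃; _×_; _,_; proj₁; proj₂)
open import Data.Rational
open import Data.Rational.Properties
open import Data.Rational.Solver using (module +-*-Solver)
import Data.Rational.Unnormalised as ℚᵘ
import Data.Rational.Unnormalised.Properties as ℚᵘₚ
open import Data.Sum using (_⊎_; inj₁; inj₂)
open import Data.Vec using (Vec; []; _∷_; zipWith; replicate; lookup) renaming (map to vmap)
open import Function using (_∘_; case_of_)
open import Relation.Binary.PropositionalEquality
open import Relation.Nullary
open import Relation.Nullary.Decidable using (dec-false)
open +-*-Solver hiding (var)

-- Unfolding the merges on a tree of depth `ℓ` bounds the threshold at `U` by `(L^5)^(2^ℓ) * 9^(ℓ
-- |U|) * (36 L^3)^|U| * 9^c`, where `c` counts the ordered pairs of distinct elements of `U` that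
-- end in a common part. The first factor does not depend on `U`: each merge costs a power of `L`,
-- so only `O(d)` parts are affordable and collisions inside parts cannot be excluded. Without any
-- splitting, on the other hand, `c` is quadratic in `|U|`. With `2^ℓ` between `d` and `2d` the
-- expected `c` is at most `d` for every `|U| ≤ d`, and all four factors become `u^O(d)` with
-- `u = 1 + Ĩ`. The good masks depend on `U`, so no single partition is chosen: the bound for a
-- fixed tree is averaged over the masks. The errors double at each level and reach `O(2^ℓ) = O(d)`
-- times the influence over `L`; `L` of order `d²` leaves `Inf / d`, which is at most `var / N` for
-- `d = N a`, `a ≥ Ĩ`. The empty frequency escapes this argument and is treated through
-- `var = p - p²`, `p` being the mean. Norms stay squared and exponents integral, so all quantities
-- are rational.

private variable
  n ℓ : ℕ

-- Rational inequalities and product functionals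

x≤y⇒0≤y-x : ∀ {x y} → x ≤ y → 0ℚ ≤ y - x
x≤y⇒0≤y-x {x} {y} x≤y = subst (_≤ y - x) (+-inverseʳ x) (+-monoˡ-≤ (- x) x≤y)

≤-by : ∀ {x y} d → 0ℚ ≤ d → y ≡ x + d → x ≤ y
≤-by {x} {y} d 0≤d y≡x+d = subst₂ _≤_ (+-identityʳ x) (sym y≡x+d) (+-monoʳ-≤ x 0≤d)

0≤+ : ∀ {x y} → 0ℚ ≤ x → 0ℚ ≤ y → 0ℚ ≤ x + y
0≤+ = +-mono-≤ {0ℚ} {_} {0ℚ}

*-monoˡ-≤ : ∀ r {x y} → 0ℚ ≤ r → x ≤ y → r * x ≤ r * y
*-monoˡ-≤ r 0≤r = *-monoˡ-≤-nonNeg r {{nonNegative 0≤r}}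

*-monoʳ-≤ : ∀ r {x y} → 0ℚ ≤ r → x ≤ y → x * r ≤ y * r
*-monoʳ-≤ r 0≤r = *-monoʳ-≤-nonNeg r {{nonNegative 0≤r}}

0≤* : ∀ {x y} → 0ℚ ≤ x → 0ℚ ≤ y → 0ℚ ≤ x * y
0≤* {x} {y} 0≤x 0≤y = subst (_≤ x * y) (*-zeroʳ x) (*-monoˡ-≤ x 0≤x 0≤y)

0<* : ∀ {x y} → 0ℚ < x → 0ℚ < y → 0ℚ < x * y
0<* {x} {y} 0<x 0<y = subst (_< x * y) (*-zeroʳ x) (*-monoʳ-<-pos x {{positive 0<x}} 0<y)

*-mono-≤ : ∀ {x y u v} → 0ℚ ≤ x → 0ℚ ≤ v → x ≤ y → u ≤ v → x * u ≤ y * v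
*-mono-≤ {x} {y} {u} {v} 0≤x 0≤v x≤y u≤v = ≤-trans (*-monoˡ-≤ x 0≤x u≤v) (*-monoʳ-≤ v 0≤v x≤y)

0≤x² : ∀ x → 0ℚ ≤ x * x
0≤x² x with ≤-total 0ℚ x
... | inj₁ 0≤x = 0≤* 0≤x 0≤x
... | inj₂ x≤0 = subst (0ℚ ≤_) (solve 1 (λ a → (:- a) :* (:- a) := a :* a) refl x)
                   (0≤* (neg-antimono-≤ x≤0) (neg-antimono-≤ x≤0))

*-cancelˡ-≤ : ∀ r {x y} → 0ℚ < r → r * x ≤ r * y → x ≤ y
*-cancelˡ-≤ r 0<r = *-cancelˡ-≤-pos r {{positive 0<r}}

0≤1 : 0ℚ ≤ 1ℚ
0≤1 = *≤* (ℤ.+≤+ ℕ.z≤n)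

0<1 : 0ℚ < 1ℚ
0<1 = *<* (ℤ.+<+ (ℕ.s≤s ℕ.z≤n))

0≤½ : 0ℚ ≤ ½
0≤½ = *≤* (ℤ.+≤+ ℕ.z≤n)

x²≤y²⇒x≤y : ∀ {x y} → 0ℚ ≤ y → x * x ≤ y * y → x ≤ y
x²≤y²⇒x≤y {x} {y} 0≤y x²≤y² with x ≤? y
... | yes x≤y = x≤y
... | no x≰y = ⊥-elim (<-irrefl refl (≤-<-trans x²≤y² y²<x²))
  where
  y<x = ≰⇒> x≰y
  0<x = ≤-<-trans 0≤y y<x
  y²<x² : y * y < x * x
  y²<x² = ≤-<-trans (*-monoˡ-≤ y 0≤y (<⇒≤ y<x)) (*-monoˡ-<-pos x {{positive 0<x}} y<x)

x²≤yz⇒2x≤y+z : ∀ {x y z} → 0ℚ ≤ y → 0ℚ ≤ z → x * x ≤ y * z → x + x ≤ y + z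
x²≤yz⇒2x≤y+z {x} {y} {z} 0≤y 0≤z x²≤yz = x²≤y²⇒x≤y (0≤+ 0≤y 0≤z)
  (≤-by ((+ 4 / 1) * (y * z - x * x) + (y - z) * (y - z))
    (0≤+ (0≤* {+ 4 / 1} (*≤* (ℤ.+≤+ ℕ.z≤n)) (x≤y⇒0≤y-x x²≤yz)) (0≤x² (y - z)))
    (solve 3 (λ x y z → (y :+ z) :* (y :+ z) :=
       (x :+ x) :* (x :+ x) :+ (con (+ 4 / 1) :* (y :* z :- x :* x) :+ (y :- z) :* (y :- z))) refl x y z))

-- The inductive step of Cauchy-Schwarz without roots: the mixed term `2 x₀ x₁` is absorbed by the
-- arithmetic-geometric mean inequality for `y₀ z₁` and `y₁ z₀`.
CS-step : ∀ {x₀ x₁ y₀ y₁ z₀ z₁} → 0ℚ ≤ y₀ → 0ℚ ≤ y₁ → 0ℚ ≤ z₀ → 0ℚ ≤ z₁ →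
  x₀ * x₀ ≤ y₀ * z₀ → x₁ * x₁ ≤ y₁ * z₁ →
  (x₀ + x₁) * (x₀ + x₁) ≤ (y₀ + y₁) * (z₀ + z₁)
CS-step {x₀} {x₁} {y₀} {y₁} {z₀} {z₁} 0≤y₀ 0≤y₁ 0≤z₀ 0≤z₁ h₀ h₁ =
  ≤-by ((y₀ * z₀ - x₀ * x₀) + (y₁ * z₁ - x₁ * x₁) + ((y₀ * z₁ + y₁ * z₀) - (x₀ * x₁ + x₀ * x₁)))
    (0≤+ (0≤+ (x≤y⇒0≤y-x h₀) (x≤y⇒0≤y-x h₁)) (x≤y⇒0≤y-x cross))
    (solve 6 (λ x₀ x₁ y₀ y₁ z₀ z₁ → (y₀ :+ y₁) :* (z₀ :+ z₁) :=
      (x₀ :+ x₁) :* (x₀ :+ x₁) :+ ((y₀ :* z₀ :- x₀ :* x₀) :+ (y₁ :* z₁ :- x₁ :* x₁) :+ ((y₀ :* z₁ :+ y₁ :* z₀) :- (x₀ :* x₁ :+ x₀ :* x₁)))) refl x₀ x₁ y₀ y₁ z₀ z₁)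
  where
  cross : x₀ * x₁ + x₀ * x₁ ≤ y₀ * z₁ + y₁ * z₀
  cross = x²≤yz⇒2x≤y+z {x₀ * x₁} (0≤* 0≤y₀ 0≤z₁) (0≤* 0≤y₁ 0≤z₀)
    (subst₂ _≤_ (solve 2 (λ a b → (a :* a) :* (b :* b) := (a :* b) :* (a :* b)) refl x₀ x₁)
      (solve 4 (λ a b c d → (a :* b) :* (c :* d) := (a :* d) :* (c :* b)) refl y₀ z₀ y₁ z₁)
      (*-mono-≤ (0≤x² x₀) (0≤* 0≤y₁ 0≤z₁) h₀ h₁))

V : ℕ → Set
V n = Vec Bool n

infix 9 _⁰ _¹

_⁰ _¹ : ∀ {n} → (V (suc n) → ℚ) → V n → ℚ
(φ ⁰) v = φ (false ∷ v)
(φ ¹) v = φ (true ∷ v)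

-- Every sum below is one functional `W`: `sc 1ℚ` sums over a coordinate, `sc ½` averages over it,
-- `fx b` freezes it. Sums over frequencies, averages over points and mixtures of the two thus share
-- one set of lemmas.
data Mode : Set where
  fx : Bool → Mode
  sc : ℚ → Mode


W : Vec Mode n → (V n → ℚ) → ℚ
W [] φ = φ []
W (fx b ∷ m) φ = W m (λ v → φ (b ∷ v))
W (sc p ∷ m) φ = p * (W m (φ ⁰) + W m (φ ¹))

-- The points that `W m` sees. Hypotheses of `W-mono` and `W-CS` are required only there, which is
-- how facts valid on a single fibre enter.
data _⊨_ : Vec Mode n → V n → Set where
  []  : [] ⊨ []
  fx∷ : ∀ {b} {m : Vec Mode n} {v} → m ⊨ v → (fx b ∷ m) ⊨ (b ∷ v)
  sc∷ : ∀ {p b} {m : Vec Mode n} {v} → m ⊨ v → (sc p ∷ m) ⊨ (b ∷ v)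

data NN : Vec Mode n → Set where
  []  : NN []
  fx∷ : ∀ {b} {m : Vec Mode n} → NN m → NN (fx b ∷ m)
  sc∷ : ∀ {p} {m : Vec Mode n} → 0ℚ ≤ p → NN m → NN (sc p ∷ m)

W-mono : ∀ {m : Vec Mode n} {φ ψ} → NN m → (∀ v → m ⊨ v → φ v ≤ ψ v) → W m φ ≤ W m ψ
W-mono [] h = h [] []
W-mono (fx∷ N) h = W-mono N (λ v x → h _ (fx∷ x))
W-mono (sc∷ 0≤p N) h = *-monoˡ-≤ _ 0≤p (+-mono-≤ (W-mono N (λ v x → h _ (sc∷ x))) (W-mono N (λ v x → h _ (sc∷ x))))

W-cong : ∀ (m : Vec Mode n) {φ ψ} → (∀ v → m ⊨ v → φ v ≡ ψ v) → W m φ ≡ W m ψ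
W-cong [] h = h [] []
W-cong (fx b ∷ m) h = W-cong m (λ v x → h _ (fx∷ x))
W-cong (sc p ∷ m) h = cong (p *_) (cong₂ _+_ (W-cong m (λ v x → h _ (sc∷ x))) (W-cong m (λ v x → h _ (sc∷ x))))

W-+ : ∀ (m : Vec Mode n) φ ψ → W m (λ v → φ v + ψ v) ≡ W m φ + W m ψ
W-+ [] φ ψ = refl
W-+ (fx b ∷ m) φ ψ = W-+ m (φ ∘ (b ∷_)) (ψ ∘ (b ∷_))
W-+ (sc p ∷ m) φ ψ = trans (cong (p *_) (cong₂ _+_ (W-+ m (φ ⁰) (ψ ⁰)) (W-+ m (φ ¹) (ψ ¹))))
  (solve 5 (λ p a b c d → p :* ((a :+ b) :+ (c :+ d)) := p :* (a :+ c) :+ p :* (b :+ d)) refl p (W m (φ ⁰)) (W m (ψ ⁰)) (W m (φ ¹)) (W m (ψ ¹)))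

W-* : ∀ (m : Vec Mode n) c φ → W m (λ v → c * φ v) ≡ c * W m φ
W-* [] c φ = refl
W-* (fx b ∷ m) c φ = W-* m c (φ ∘ (b ∷_))
W-* (sc p ∷ m) c φ = trans (cong (p *_) (cong₂ _+_ (W-* m c (φ ⁰)) (W-* m c (φ ¹))))
  (solve 4 (λ p c a b → p :* (c :* a :+ c :* b) := c :* (p :* (a :+ b))) refl p c (W m (φ ⁰)) (W m (φ ¹)))

W-0 : ∀ (m : Vec Mode n) → W m (λ _ → 0ℚ) ≡ 0ℚ
W-0 m = trans (W-* m 0ℚ (λ _ → 0ℚ)) (*-zeroˡ (W m (λ _ → 0ℚ)))

W-0≤ : ∀ {m : Vec Mode n} {φ} → NN m → (∀ v → m ⊨ v → 0ℚ ≤ φ v) → 0ℚ ≤ W m φ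
W-0≤ {m = m} {φ} N h = subst (_≤ W m φ) (W-0 m) (W-mono N h)

W-CS : ∀ {m : Vec Mode n} {x y z} → NN m →
  (∀ v → m ⊨ v → 0ℚ ≤ y v) → (∀ v → m ⊨ v → 0ℚ ≤ z v) → (∀ v → m ⊨ v → x v * x v ≤ y v * z v) →
  W m x * W m x ≤ W m y * W m z
W-CS [] hy hz h = h [] []
W-CS (fx∷ N) hy hz h = W-CS N (λ v e → hy _ (fx∷ e)) (λ v e → hz _ (fx∷ e)) (λ v e → h _ (fx∷ e))
W-CS {x = x} {y} {z} (sc∷ {p = p} {m = m} 0≤p N) hy hz h = subst₂ _≤_
  (solve 2 (λ p a → p :* p :* (a :* a) := (p :* a) :* (p :* a)) refl p (W m (x ⁰) + W m (x ¹)))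
  (solve 3 (λ p a b → p :* p :* (a :* b) := (p :* a) :* (p :* b)) refl p (W m (y ⁰) + W m (y ¹)) (W m (z ⁰) + W m (z ¹)))
  (*-monoˡ-≤ (p * p) (0≤x² p)
    (CS-step {W m (x ⁰)} {W m (x ¹)} (W-0≤ N (λ v e → hy _ (sc∷ e))) (W-0≤ N (λ v e → hy _ (sc∷ e)))
             (W-0≤ N (λ v e → hz _ (sc∷ e))) (W-0≤ N (λ v e → hz _ (sc∷ e)))
             (W-CS {x = x ⁰} N (λ v e → hy _ (sc∷ e)) (λ v e → hz _ (sc∷ e)) (λ v e → h _ (sc∷ e)))
             (W-CS {x = x ¹} N (λ v e → hy _ (sc∷ e)) (λ v e → hz _ (sc∷ e)) (λ v e → h _ (sc∷ e)))))

-- Partial Fourier transforms and hypercontractivity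

infixr 8 _∩_

_∩_ : V n → V n → V n
_∩_ = zipWith _∧_

data Off : V n → V n → V n → Set where
  []   : Off [] [] []
  same : ∀ {b} {B w v : V n} → Off B w v → Off (false ∷ B) (b ∷ w) (b ∷ v)
  free : ∀ {b b′} {B w v : V n} → Off B w v → Off (true ∷ B) (b ∷ w) (b′ ∷ v)

fib : ℚ → V n → V n → Vec Mode n
fib p [] [] = []
fib p (true ∷ B) (_ ∷ w) = sc p ∷ fib p B w
fib p (false ∷ B) (b ∷ w) = fx b ∷ fib p B w

fib-NN : ∀ {p} → 0ℚ ≤ p → (B w : V n) → NN (fib p B w)
fib-NN 0≤p [] [] = []
fib-NN 0≤p (true ∷ B) (_ ∷ w) = sc∷ 0≤p (fib-NN 0≤p B w)
fib-NN 0≤p (false ∷ B) (b ∷ w) = fx∷ (fib-NN 0≤p B w)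

fib-Off : ∀ {p} (B w : V n) {v} → fib p B w ⊨ v → Off B w v
fib-Off [] [] [] = []
fib-Off (true ∷ B) (_ ∷ w) (sc∷ x) = free (fib-Off B w x)
fib-Off (false ∷ B) (b ∷ w) (fx∷ x) = same (fib-Off B w x)

fib-irr : ∀ {p} {B w v : V n} → Off B w v → fib p B w ≡ fib p B v
fib-irr [] = refl
fib-irr (same x) = cong (fx _ ∷_) (fib-irr x)
fib-irr (free x) = cong (sc _ ∷_) (fib-irr x)

Off-refl : (B w : V n) → Off B w w
Off-refl [] [] = []
Off-refl (true ∷ B) (_ ∷ w) = free (Off-refl B w)
Off-refl (false ∷ B) (b ∷ w) = same (Off-refl B w)

sumOn avg : V n → (V n → ℚ) → V n → ℚ
sumOn B φ w = W (fib 1ℚ B w) φ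
avg B φ w = W (fib ½ B w) φ

W-lin : ∀ (m : Vec Mode n) p φ ψ → p * (W m φ + W m ψ) ≡ W m (λ v → p * (φ v + ψ v))
W-lin m p φ ψ = trans (cong (p *_) (sym (W-+ m φ ψ))) (sym (W-* m p (λ v → φ v + ψ v)))

sg : Bool → ℚ
sg false = 1ℚ
sg true = - 1ℚ

-- T ½ B is the Fourier transform in the coordinates of B alone (on B the argument and the value are
-- indexed by points and by frequencies, respectively), and T 1ℚ B is its inverse.
T : ℚ → V n → (V n → ℚ) → V n → ℚ
T p [] g [] = g []
T p (true ∷ B) g (b ∷ w) = p * (T p B (g ⁰) w + sg b * T p B (g ¹) w)
T p (false ∷ B) g (b ∷ w) = T p B (g ∘ (b ∷_)) w

T-cong : ∀ p (B : V n) {g h} w → (∀ v → Off B w v → g v ≡ h v) → T p B g w ≡ T p B h w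
T-cong p [] [] e = e [] []
T-cong p (true ∷ B) (b ∷ w) e = cong₂ (λ x y → p * (x + sg b * y))
  (T-cong p B w (λ v o → e _ (free o))) (T-cong p B w (λ v o → e _ (free o)))
T-cong p (false ∷ B) (b ∷ w) e = T-cong p B w (λ v o → e _ (same o))

T-+ : ∀ p (B : V n) g h w → T p B (λ v → g v + h v) w ≡ T p B g w + T p B h w
T-+ p [] g h [] = refl
T-+ p (true ∷ B) g h (b ∷ w) = trans
  (cong₂ (λ x y → p * (x + sg b * y)) (T-+ p B (g ⁰) (h ⁰) w) (T-+ p B (g ¹) (h ¹) w))
  (solve 6 (λ p s x y x' y' → p :* ((x :+ y) :+ s :* (x' :+ y')) := p :* (x :+ s :* x') :+ p :* (y :+ s :* y')) refl
    p (sg b) (T p B (g ⁰) w) (T p B (h ⁰) w) (T p B (g ¹) w) (T p B (h ¹) w))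
T-+ p (false ∷ B) g h (b ∷ w) = T-+ p B (g ∘ (b ∷_)) (h ∘ (b ∷_)) w

T-* : ∀ p (B : V n) c g w → T p B (λ v → c * g v) w ≡ c * T p B g w
T-* p [] c g [] = refl
T-* p (true ∷ B) c g (b ∷ w) = trans
  (cong₂ (λ x y → p * (x + sg b * y)) (T-* p B c (g ⁰) w) (T-* p B c (g ¹) w))
  (solve 5 (λ p s c x y → p :* (c :* x :+ s :* (c :* y)) := c :* (p :* (x :+ s :* y))) refl
    p (sg b) c (T p B (g ⁰) w) (T p B (g ¹) w))
T-* p (false ∷ B) c g (b ∷ w) = T-* p B c (g ∘ (b ∷_)) w

W-inv : ∀ p (B : V n) (a g : V n → ℚ) w → (∀ v → Off B w v → a v ≡ a w) →
  W (fib p B w) (λ v → a v * g v) ≡ a w * W (fib p B w) g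
W-inv p B a g w e = trans (W-cong (fib p B w) (λ v o → cong (_* g v) (e v (fib-Off B w o)))) (W-* (fib p B w) (a w) g)

-- In one coordinate this is the parallelogram law; frequencies are counted, points are averaged.
parseval : (B : V n) (h : V n → ℚ) (w : V n) →
  sumOn B (λ v → T ½ B h v * T ½ B h v) w ≡ avg B (λ v → h v * h v) w
parseval [] h [] = refl
parseval (true ∷ B) h (b ∷ w) = begin
  1ℚ * (W m (λ v → (½ * (x v + 1ℚ * y v)) * (½ * (x v + 1ℚ * y v))) + W m (λ v → (½ * (x v + - 1ℚ * y v)) * (½ * (x v + - 1ℚ * y v))))
    ≡⟨ W-lin m 1ℚ (λ v → (½ * (x v + 1ℚ * y v)) * (½ * (x v + 1ℚ * y v))) (λ v → (½ * (x v + - 1ℚ * y v)) * (½ * (x v + - 1ℚ * y v))) ⟩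
  W m (λ v → 1ℚ * ((½ * (x v + 1ℚ * y v)) * (½ * (x v + 1ℚ * y v)) + (½ * (x v + - 1ℚ * y v)) * (½ * (x v + - 1ℚ * y v))))
    ≡⟨ W-cong m (λ v _ → solve 2 (λ x y → con 1ℚ :* ((con ½ :* (x :+ con 1ℚ :* y)) :* (con ½ :* (x :+ con 1ℚ :* y)) :+ (con ½ :* (x :+ con (- 1ℚ) :* y)) :* (con ½ :* (x :+ con (- 1ℚ) :* y))) := con ½ :* (x :* x :+ y :* y)) refl (x v) (y v)) ⟩
  W m (λ v → ½ * (x v * x v + y v * y v))
    ≡⟨ W-lin m ½ (λ v → x v * x v) (λ v → y v * y v) ⟨
  ½ * (W m (λ v → x v * x v) + W m (λ v → y v * y v))
    ≡⟨ cong₂ (λ p q → ½ * (p + q)) (parseval B (h ⁰) w) (parseval B (h ¹) w) ⟩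
  ½ * (avg B (λ v → (h ⁰) v * (h ⁰) v) w + avg B (λ v → (h ¹) v * (h ¹) v) w) ∎
  where
  open ≡-Reasoning
  m = fib 1ℚ B w
  x = T ½ B (h ⁰)
  y = T ½ B (h ¹)
parseval (false ∷ B) h (b ∷ w) = parseval B (h ∘ (b ∷_)) w

-- Used with `c` a truncation of the transform of `h`: the weight of `h` on selected frequencies
-- becomes the inner product of `h` with its part on them.
adjoint : (B : V n) (c h : V n → ℚ) (w : V n) →
  sumOn B (λ v → c v * T ½ B h v) w ≡ avg B (λ v → h v * T 1ℚ B c v) w
adjoint [] c h [] = *-comm (c []) (h [])
adjoint (true ∷ B) c h (b ∷ w) = begin
  1ℚ * (W m (λ v → c₀ v * (½ * (x v + 1ℚ * y v))) + W m (λ v → c₁ v * (½ * (x v + - 1ℚ * y v))))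
    ≡⟨ W-lin m 1ℚ (λ v → c₀ v * (½ * (x v + 1ℚ * y v))) (λ v → c₁ v * (½ * (x v + - 1ℚ * y v))) ⟩
  W m (λ v → 1ℚ * (c₀ v * (½ * (x v + 1ℚ * y v)) + c₁ v * (½ * (x v + - 1ℚ * y v))))
    ≡⟨ W-cong m (λ v _ → solve 4 (λ a b x y → con 1ℚ :* (a :* (con ½ :* (x :+ con 1ℚ :* y)) :+ b :* (con ½ :* (x :+ con (- 1ℚ) :* y)))
          := con ½ :* ((a :* x :+ b :* x) :+ (a :* y :+ con (- 1ℚ) :* (b :* y)))) refl (c₀ v) (c₁ v) (x v) (y v)) ⟩
  W m (λ v → ½ * ((c₀ v * x v + c₁ v * x v) + (c₀ v * y v + - 1ℚ * (c₁ v * y v))))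
    ≡⟨ W-lin m ½ (λ v → c₀ v * x v + c₁ v * x v) (λ v → c₀ v * y v + - 1ℚ * (c₁ v * y v)) ⟨
  ½ * (W m (λ v → c₀ v * x v + c₁ v * x v) + W m (λ v → c₀ v * y v + - 1ℚ * (c₁ v * y v)))
    ≡⟨ cong₂ (λ p q → ½ * (p + q)) (W-+ m (λ v → c₀ v * x v) (λ v → c₁ v * x v))
        (trans (W-+ m (λ v → c₀ v * y v) (λ v → - 1ℚ * (c₁ v * y v))) (cong (λ q → W m (λ v → c₀ v * y v) + q) (W-* m (- 1ℚ) (λ v → c₁ v * y v)))) ⟩
  ½ * ((W m (λ v → c₀ v * x v) + W m (λ v → c₁ v * x v)) + (W m (λ v → c₀ v * y v) + - 1ℚ * W m (λ v → c₁ v * y v)))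
    ≡⟨ cong₂ (λ p q → ½ * (p + q)) (cong₂ _+_ (adjoint B c₀ h₀ w) (adjoint B c₁ h₀ w))
          (cong₂ (λ p q → p + - 1ℚ * q) (adjoint B c₀ h₁ w) (adjoint B c₁ h₁ w)) ⟩
  ½ * ((W k (λ v → h₀ v * s v) + W k (λ v → h₀ v * t v)) + (W k (λ v → h₁ v * s v) + - 1ℚ * W k (λ v → h₁ v * t v)))
    ≡⟨ cong₂ (λ p q → ½ * (p + q)) (W-+ k (λ v → h₀ v * s v) (λ v → h₀ v * t v))
        (trans (W-+ k (λ v → h₁ v * s v) (λ v → - 1ℚ * (h₁ v * t v))) (cong (λ q → W k (λ v → h₁ v * s v) + q) (W-* k (- 1ℚ) (λ v → h₁ v * t v)))) ⟨
  ½ * (W k (λ v → h₀ v * s v + h₀ v * t v) + W k (λ v → h₁ v * s v + - 1ℚ * (h₁ v * t v)))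
    ≡⟨ cong₂ (λ p q → ½ * (p + q))
        (W-cong k (λ v _ → solve 3 (λ h s t → h :* s :+ h :* t := h :* (con 1ℚ :* (s :+ con 1ℚ :* t))) refl (h₀ v) (s v) (t v)))
        (W-cong k (λ v _ → solve 3 (λ h s t → h :* s :+ con (- 1ℚ) :* (h :* t) := h :* (con 1ℚ :* (s :+ con (- 1ℚ) :* t))) refl (h₁ v) (s v) (t v))) ⟩
  ½ * (W k (λ v → h₀ v * (1ℚ * (s v + 1ℚ * t v))) + W k (λ v → h₁ v * (1ℚ * (s v + - 1ℚ * t v)))) ∎
  where
  open ≡-Reasoning
  m = fib 1ℚ B w
  k = fib ½ B w
  x = T ½ B (h ⁰)
  y = T ½ B (h ¹)
  c₀ = c ⁰
  c₁ = c ¹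
  h₀ = h ⁰
  h₁ = h ¹
  s = T 1ℚ B c₀
  t = T 1ℚ B c₁
adjoint (false ∷ B) c h (b ∷ w) = adjoint B (c ∘ (b ∷_)) (h ∘ (b ∷_)) w

3ℚ 6ℚ 9ℚ : ℚ
3ℚ = + 3 / 1
6ℚ = + 6 / 1
9ℚ = + 9 / 1

0≤pow : ∀ {a} → 0ℚ ≤ a → ∀ k → 0ℚ ≤ powℚ a k
0≤pow 0≤a zero = 0≤1
0≤pow 0≤a (suc k) = 0≤* 0≤a (0≤pow 0≤a k)

0≤3 : 0ℚ ≤ 3ℚ
0≤3 = *≤* (ℤ.+≤+ ℕ.z≤n)

1≤* : ∀ {x y} → 1ℚ ≤ x → 1ℚ ≤ y → 1ℚ ≤ x * y
1≤* {x} {y} 1≤x 1≤y = *-mono-≤ {1ℚ} {x} {1ℚ} 0≤1 (≤-trans 0≤1 1≤y) 1≤x 1≤y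

1≤pow : ∀ {a} → 1ℚ ≤ a → ∀ k → 1ℚ ≤ powℚ a k
1≤pow 1≤a zero = ≤-refl
1≤pow {a} 1≤a (suc k) = *-mono-≤ {1ℚ} {a} {1ℚ} 0≤1 (≤-trans 0≤1 (1≤pow 1≤a k)) 1≤a (1≤pow 1≤a k)

pow-monoʳ : ∀ {a} → 1ℚ ≤ a → ∀ {j k} → j ℕ.≤ k → powℚ a j ≤ powℚ a k
pow-monoʳ 1≤a {k = k} ℕ.z≤n = 1≤pow 1≤a k
pow-monoʳ {a} 1≤a (ℕ.s≤s j≤k) = *-monoˡ-≤ a (≤-trans 0≤1 1≤a) (pow-monoʳ 1≤a j≤k)

1≤9 : 1ℚ ≤ 9ℚ
1≤9 = *≤* (ℤ.+≤+ (ℕ.s≤s ℕ.z≤n))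

energy : V n → (V n → ℚ) → V n → ℚ
energy B c w = sumOn B (λ v → powℚ 3ℚ (card (B ∩ v)) * (c v * c v)) w

0≤energy : (B : V n) (c : V n → ℚ) (w : V n) → 0ℚ ≤ energy B c w
0≤energy B c w = W-0≤ (fib-NN 0≤1 B w) (λ v _ → 0≤* (0≤pow 0≤3 (card (B ∩ v))) (0≤x² (c v)))

-- Bonami's inequality ‖g‖₄² ≤ Σ_U 3^|U| ĝ(U)², squared.
bonami : (B : V n) (c : V n → ℚ) (w : V n) →
  avg B (λ v → (T 1ℚ B c v * T 1ℚ B c v) * (T 1ℚ B c v * T 1ℚ B c v)) w ≤ energy B c w * energy B c w
bonami [] c [] = ≤-reflexive (solve 1 (λ c → (c :* c) :* (c :* c) := con 1ℚ :* (c :* c) :* (con 1ℚ :* (c :* c))) refl (c []))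
bonami (true ∷ B) c (b ∷ w) = begin
  avg (true ∷ B) (λ v → (T 1ℚ (true ∷ B) c v * T 1ℚ (true ∷ B) c v) * (T 1ℚ (true ∷ B) c v * T 1ℚ (true ∷ B) c v)) (b ∷ w)
    ≡⟨ W-lin k ½ (λ v → ((1ℚ * (s v + 1ℚ * t v)) * (1ℚ * (s v + 1ℚ * t v))) * ((1ℚ * (s v + 1ℚ * t v)) * (1ℚ * (s v + 1ℚ * t v))))
                 (λ v → ((1ℚ * (s v + - 1ℚ * t v)) * (1ℚ * (s v + - 1ℚ * t v))) * ((1ℚ * (s v + - 1ℚ * t v)) * (1ℚ * (s v + - 1ℚ * t v)))) ⟩
  _ ≡⟨ W-cong k (λ v _ → solve 2 (λ s t →
         con ½ :* (((con 1ℚ :* (s :+ con 1ℚ :* t)) :* (con 1ℚ :* (s :+ con 1ℚ :* t))) :* ((con 1ℚ :* (s :+ con 1ℚ :* t)) :* (con 1ℚ :* (s :+ con 1ℚ :* t)))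
            :+ ((con 1ℚ :* (s :+ con (- 1ℚ) :* t)) :* (con 1ℚ :* (s :+ con (- 1ℚ) :* t))) :* ((con 1ℚ :* (s :+ con (- 1ℚ) :* t)) :* (con 1ℚ :* (s :+ con (- 1ℚ) :* t))))
         := ((s :* s) :* (s :* s) :+ (t :* t) :* (t :* t)) :+ con 6ℚ :* ((s :* s) :* (t :* t))) refl (s v) (t v)) ⟩
  W k (λ v → (s⁴ v + t⁴ v) + 6ℚ * s²t² v)
    ≡⟨ trans (W-+ k (λ v → s⁴ v + t⁴ v) (λ v → 6ℚ * s²t² v)) (cong₂ _+_ (W-+ k s⁴ t⁴) (W-* k 6ℚ s²t²)) ⟩
  (W k s⁴ + W k t⁴) + 6ℚ * W k s²t²
    ≤⟨ +-mono-≤ (+-mono-≤ (bonami B (c ⁰) w) (bonami B (c ¹) w)) (*-monoˡ-≤ 6ℚ (*≤* (ℤ.+≤+ ℕ.z≤n)) mid) ⟩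
  (P * P + Q * Q) + 6ℚ * (P * Q)
    -- Averaging `(s + t)⁴` and `(s - t)⁴` leaves the cross term `6 s² t²`, which the weight 3 on
    -- `Q` matches exactly; the square `9 Q²` then exceeds the required `Q²`.
    ≤⟨ ≤-by ((+ 8 / 1) * (Q * Q)) (0≤* {+ 8 / 1} (*≤* (ℤ.+≤+ ℕ.z≤n)) (0≤x² Q))
       (solve 2 (λ p q → (p :+ con 3ℚ :* q) :* (p :+ con 3ℚ :* q) := (p :* p :+ q :* q) :+ con 6ℚ :* (p :* q) :+ con (+ 8 / 1) :* (q :* q)) refl P Q) ⟩
  (P + 3ℚ * Q) * (P + 3ℚ * Q) ≡⟨ cong (λ e → e * e) step ⟨
  energy (true ∷ B) c (b ∷ w) * energy (true ∷ B) c (b ∷ w) ∎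
  where
  open ≤-Reasoning
  k = fib ½ B w
  s = T 1ℚ B (c ⁰)
  t = T 1ℚ B (c ¹)
  s⁴ = λ v → (s v * s v) * (s v * s v)
  t⁴ = λ v → (t v * t v) * (t v * t v)
  s²t² = λ v → (s v * s v) * (t v * t v)
  P = energy B (c ⁰) w
  Q = energy B (c ¹) w
  0≤P = 0≤energy B (c ⁰) w
  0≤Q = 0≤energy B (c ¹) w
  mid : W k s²t² ≤ P * Q
  mid = x²≤y²⇒x≤y (0≤* 0≤P 0≤Q) (≤-trans
    (W-CS {x = s²t²} {s⁴} {t⁴} (fib-NN 0≤½ B w) (λ v _ → 0≤x² (s v * s v)) (λ v _ → 0≤x² (t v * t v))
      (λ v _ → ≤-reflexive (solve 2 (λ s t → ((s :* s) :* (t :* t)) :* ((s :* s) :* (t :* t)) := ((s :* s) :* (s :* s)) :* ((t :* t) :* (t :* t))) refl (s v) (t v))))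
    (subst (W k s⁴ * W k t⁴ ≤_) (solve 2 (λ p q → (p :* p) :* (q :* q) := (p :* q) :* (p :* q)) refl P Q)
      (*-mono-≤ (W-0≤ (fib-NN 0≤½ B w) (λ v _ → 0≤x² (s v * s v))) (0≤x² Q) (bonami B (c ⁰) w) (bonami B (c ¹) w))))
  step : energy (true ∷ B) c (b ∷ w) ≡ P + 3ℚ * Q
  step = trans (*-identityˡ _) (cong (λ q → P + q)
    (trans (W-cong (fib 1ℚ B w) (λ v _ → *-assoc 3ℚ (powℚ 3ℚ (card (B ∩ v))) ((c ¹) v * (c ¹) v)))
           (W-* (fib 1ℚ B w) 3ℚ (λ v → powℚ 3ℚ (card (B ∩ v)) * ((c ¹) v * (c ¹) v)))))
bonami (false ∷ B) c (b ∷ w) = bonami B (c ∘ (b ∷_)) w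

0≤bval : ∀ b → 0ℚ ≤ bval b
0≤bval true = 0≤1
0≤bval false = ≤-refl

bval-idem : ∀ b → bval b * bval b ≡ bval b
bval-idem true = refl
bval-idem false = refl

pow-9 : ∀ k → powℚ 3ℚ k * powℚ 3ℚ k ≡ powℚ 9ℚ k
pow-9 zero = refl
pow-9 (suc k) = trans (solve 2 (λ a p → (a :* p) :* (a :* p) := (a :* a) :* (p :* p)) refl 3ℚ (powℚ 3ℚ k))
  (cong (9ℚ *_) (pow-9 k))

-- s is the indicator of the support of h.  If g is the part of h on the frequencies ℓ, then
-- ‖g‖₂² = ⟨h , g⟩ ≤ ‖h‖₂ ‖s g‖₂ and ‖s g‖₂² ≤ ‖s‖₂ ‖g‖₄², where ‖s‖₂² ≤ ρ ‖h‖₂² because h² ≥ 1/ρ on its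
-- support, and ‖g‖₄ is controlled by Bonami's inequality.
level : (B w : V n) (h s : V n → ℚ) (ℓ : V n → Bool) (L N ρ : ℚ) → 0ℚ ≤ L → 0ℚ ≤ ρ →
  (∀ v → Off B w v → 0ℚ ≤ s v) →
  (∀ v → Off B w v → s v * s v ≤ s v) →
  (∀ v → Off B w v → h v * h v ≤ (h v * h v) * s v) →
  (∀ v → Off B w v → s v ≤ ρ * (h v * h v)) →
  avg B (λ v → h v * h v) w ≤ N →
  (∀ v → Off B w v → ℓ v ≡ true → powℚ 9ℚ (card (B ∩ v)) * (L * L * N * ρ) ≤ 1ℚ) →
  L * sumOn B (λ v → bval (ℓ v) * (T ½ B h v * T ½ B h v)) w ≤ avg B (λ v → h v * h v) w
level B w h s ℓ L N ρ 0≤L 0≤ρ 0≤s s²≤s h²≤h²s s≤ρh² H≤N low = conclude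
  where
  c g : V _ → ℚ
  c v = bval (ℓ v) * T ½ B h v
  g = T 1ℚ B c
  k = fib ½ B w
  m = fib 1ℚ B w
  off : ∀ {v} → k ⊨ v → Off B w v
  off = fib-Off B w
  NNk = fib-NN 0≤½ B w
  NNm = fib-NN 0≤1 B w
  q H X Sg K Z M : ℚ
  q = sumOn B (λ v → bval (ℓ v) * (T ½ B h v * T ½ B h v)) w
  H = avg B (λ v → h v * h v) w
  X = avg B (λ v → s v * (g v * g v)) w
  Sg = avg B s w
  K = energy B c w
  Z = sumOn B (λ v → powℚ 9ℚ (card (B ∩ v)) * (c v * c v)) w
  M = L * L * N * ρ
  0≤H : 0ℚ ≤ H
  0≤H = W-0≤ NNk (λ v _ → 0≤x² (h v))
  0≤X : 0ℚ ≤ X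
  0≤X = W-0≤ NNk (λ v o → 0≤* (0≤s v (off o)) (0≤x² (g v)))
  0≤q : 0ℚ ≤ q
  0≤q = W-0≤ NNm (λ v _ → 0≤* (0≤bval (ℓ v)) (0≤x² (T ½ B h v)))
  0≤M : 0ℚ ≤ M
  0≤M = 0≤* (0≤* (0≤x² L) (≤-trans 0≤H H≤N)) 0≤ρ
  q≡ : q ≡ avg B (λ v → h v * g v) w
  q≡ = trans (W-cong m (λ v _ → sym (*-assoc (bval (ℓ v)) (T ½ B h v) (T ½ B h v)))) (adjoint B c h w)
  q≡c² : sumOn B (λ v → c v * c v) w ≡ q
  q≡c² = W-cong m (λ v _ → trans
    (solve 2 (λ b t → (b :* t) :* (b :* t) := (b :* b) :* (t :* t)) refl (bval (ℓ v)) (T ½ B h v))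
    (cong (_* (T ½ B h v * T ½ B h v)) (bval-idem (ℓ v))))
  q²≤HX : q * q ≤ H * X
  q²≤HX = subst (λ x → x * x ≤ H * X) (sym q≡)
    (W-CS {x = λ v → h v * g v} {λ v → h v * h v} {λ v → s v * (g v * g v)} NNk
      (λ v _ → 0≤x² (h v)) (λ v o → 0≤* (0≤s v (off o)) (0≤x² (g v)))
      (λ v o → subst₂ _≤_ (solve 2 (λ h g → (h :* h) :* (g :* g) := (h :* g) :* (h :* g)) refl (h v) (g v))
                 (*-assoc (h v * h v) (s v) (g v * g v)) (*-monoʳ-≤ (g v * g v) (0≤x² (g v)) (h²≤h²s v (off o)))))
  X²≤ : X * X ≤ Sg * (K * K)
  X²≤ = ≤-trans
    (W-CS {x = λ v → s v * (g v * g v)} {s} {λ v → (g v * g v) * (g v * g v)} NNk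
      (λ v o → 0≤s v (off o)) (λ v _ → 0≤x² (g v * g v))
      (λ v o → subst (_≤ s v * ((g v * g v) * (g v * g v)))
         (solve 2 (λ s g → (s :* s) :* (g :* g) := (s :* g) :* (s :* g)) refl (s v) (g v * g v))
         (*-monoʳ-≤ ((g v * g v) * (g v * g v)) (0≤x² (g v * g v)) (s²≤s v (off o)))))
    (*-monoˡ-≤ Sg (W-0≤ NNk (λ v o → 0≤s v (off o))) (bonami B c w))
  Sg≤ρH : Sg ≤ ρ * H
  Sg≤ρH = subst (Sg ≤_) (W-* k ρ (λ v → h v * h v)) (W-mono NNk (λ v o → s≤ρh² v (off o)))
  -- Cauchy-Schwarz turns the weights `3^|U|` of Bonami's inequality into `9^|U|`, the weights in
  -- the hypothesis on `ℓ`.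
  K²≤qZ : K * K ≤ q * Z
  K²≤qZ = subst (λ x → K * K ≤ x * Z) q≡c²
    (W-CS {x = λ v → powℚ 3ℚ (card (B ∩ v)) * (c v * c v)} {λ v → c v * c v} {λ v → powℚ 9ℚ (card (B ∩ v)) * (c v * c v)} NNm
      (λ v _ → 0≤x² (c v)) (λ v _ → 0≤* (0≤pow (*≤* (ℤ.+≤+ ℕ.z≤n)) (card (B ∩ v))) (0≤x² (c v)))
      (λ v _ → ≤-reflexive (trans
         (solve 2 (λ p c → (p :* c) :* (p :* c) := c :* ((p :* p) :* c)) refl (powℚ 3ℚ (card (B ∩ v))) (c v * c v))
         (cong (λ x → (c v * c v) * (x * (c v * c v))) (pow-9 (card (B ∩ v)))))))
  MZ≤q : M * Z ≤ q
  MZ≤q = subst₂ _≤_ (W-* m M (λ v → powℚ 9ℚ (card (B ∩ v)) * (c v * c v))) q≡c²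
    (W-mono NNm (λ v o → pt v (fib-Off B w o)))
    where
    pt : ∀ v → Off B w v → M * (powℚ 9ℚ (card (B ∩ v)) * (c v * c v)) ≤ c v * c v
    pt v o with ℓ v in eq
    ... | true = subst₂ _≤_
          (solve 3 (λ p m x → (p :* m) :* x := m :* (p :* x)) refl (powℚ 9ℚ (card (B ∩ v))) M ((1ℚ * T ½ B h v) * (1ℚ * T ½ B h v)))
          (*-identityˡ _)
          (*-monoʳ-≤ ((1ℚ * T ½ B h v) * (1ℚ * T ½ B h v)) (0≤x² (1ℚ * T ½ B h v)) (low v o eq))
    ... | false = ≤-reflexive (solve 3 (λ m p t → m :* (p :* ((con 0ℚ :* t) :* (con 0ℚ :* t))) := (con 0ℚ :* t) :* (con 0ℚ :* t)) refl
                     M (powℚ 9ℚ (card (B ∩ v))) (T ½ B h v))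
  MK²≤q² : M * (K * K) ≤ q * q
  MK²≤q² = ≤-trans (*-monoˡ-≤ M 0≤M K²≤qZ)
    (subst (_≤ q * q) (solve 3 (λ m q z → q :* (m :* z) := m :* (q :* z)) refl M q Z) (*-monoˡ-≤ q 0≤q MZ≤q))
  -- The chain needs fourth roots when stated for norms; squared twice it is polynomial. It yields
  -- `L q² ≤ H q`, so the case `q = 0` is separated before `q` is cancelled.
  main : (L * q * q) * (L * q * q) ≤ (H * q) * (H * q)
  main = begin
    (L * q * q) * (L * q * q) ≡⟨ solve 2 (λ l q → (l :* q :* q) :* (l :* q :* q) := (l :* l) :* ((q :* q) :* (q :* q))) refl L q ⟩
    (L * L) * ((q * q) * (q * q)) ≤⟨ *-monoˡ-≤ (L * L) (0≤x² L) (*-mono-≤ (0≤x² q) (0≤* 0≤H 0≤X) q²≤HX q²≤HX) ⟩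
    (L * L) * ((H * X) * (H * X)) ≡⟨ solve 3 (λ l h x → (l :* l) :* ((h :* x) :* (h :* x)) := (l :* l :* (h :* h)) :* (x :* x)) refl L H X ⟩
    (L * L * (H * H)) * (X * X) ≤⟨ *-monoˡ-≤ (L * L * (H * H)) (0≤* (0≤x² L) (0≤x² H)) (≤-trans X²≤ (*-monoʳ-≤ (K * K) (0≤x² K) Sg≤ρN)) ⟩
    (L * L * (H * H)) * ((ρ * N) * (K * K)) ≡⟨ solve 5 (λ l h r n k → (l :* l :* (h :* h)) :* ((r :* n) :* k) := (h :* h) :* ((l :* l :* n :* r) :* k)) refl L H ρ N (K * K) ⟩
    (H * H) * (M * (K * K)) ≤⟨ *-monoˡ-≤ (H * H) (0≤x² H) MK²≤q² ⟩
    (H * H) * (q * q) ≡⟨ solve 2 (λ h q → (h :* h) :* (q :* q) := (h :* q) :* (h :* q)) refl H q ⟩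
    (H * q) * (H * q) ∎
    where
    open ≤-Reasoning
    Sg≤ρN = ≤-trans Sg≤ρH (*-monoˡ-≤ ρ 0≤ρ H≤N)
  conclude : L * q ≤ H
  conclude with 0ℚ <? q
  ... | yes 0<q = *-cancelˡ-≤ q 0<q (subst₂ _≤_ (*-comm (L * q) q) (*-comm H q) (x²≤y²⇒x≤y (0≤* 0≤H 0≤q) main))
  ... | no 0≮q = subst (_≤ H) (sym (trans (cong (L *_) (≤-antisym (≮⇒≥ 0≮q) 0≤q)) (*-zeroʳ L))) 0≤H

-- Disjoint unions of coordinate sets

data Split : V n → V n → V n → Set where
  []  : Split [] [] []
  o∷_ : {A B C : V n} → Split A B C → Split (false ∷ A) (false ∷ B) (false ∷ C)
  l∷_ : {A B C : V n} → Split A B C → Split (true ∷ A) (true ∷ B) (false ∷ C)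
  r∷_ : {A B C : V n} → Split A B C → Split (true ∷ A) (false ∷ B) (true ∷ C)

Split-sym : {A B C : V n} → Split A B C → Split A C B
Split-sym [] = []
Split-sym (o∷ σ) = o∷ Split-sym σ
Split-sym (l∷ σ) = r∷ Split-sym σ
Split-sym (r∷ σ) = l∷ Split-sym σ

T-split : ∀ p {A B C : V n} → Split A B C → ∀ g w → T p A g w ≡ T p C (T p B g) w
T-split p [] g [] = refl
T-split p (o∷ σ) g (b ∷ w) = T-split p σ (g ∘ (b ∷_)) w
T-split p {true ∷ A} {true ∷ B} {false ∷ C} (l∷ σ) g (b ∷ w) = begin
  p * (T p A (g ⁰) w + sg b * T p A (g ¹) w) ≡⟨ cong₂ (λ x y → p * (x + sg b * y)) (T-split p σ (g ⁰) w) (T-split p σ (g ¹) w) ⟩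
  p * (T p C x w + sg b * T p C y w) ≡⟨ cong (λ z → p * (T p C x w + z)) (T-* p C (sg b) y w) ⟨
  p * (T p C x w + T p C (λ v → sg b * y v) w) ≡⟨ cong (p *_) (T-+ p C x (λ v → sg b * y v) w) ⟨
  p * T p C (λ v → x v + sg b * y v) w ≡⟨ T-* p C p (λ v → x v + sg b * y v) w ⟨
  T p C (λ v → p * (x v + sg b * y v)) w ∎
  where
  open ≡-Reasoning
  x = T p B (g ⁰)
  y = T p B (g ¹)
T-split p (r∷ σ) g (b ∷ w) = cong₂ (λ x y → p * (x + sg b * y)) (T-split p σ (g ⁰) w) (T-split p σ (g ¹) w)

sumOn-split : {A B C : V n} → Split A B C → ∀ φ w → sumOn A φ w ≡ sumOn B (sumOn C φ) w
sumOn-split [] φ [] = refl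
sumOn-split (o∷ σ) φ (b ∷ w) = sumOn-split σ (φ ∘ (b ∷_)) w
sumOn-split (l∷ σ) φ (b ∷ w) = cong₂ (λ x y → 1ℚ * (x + y)) (sumOn-split σ (φ ⁰) w) (sumOn-split σ (φ ¹) w)
sumOn-split {A = _ ∷ A} {_ ∷ B} {_ ∷ C} (r∷ σ) φ (b ∷ w) = trans
  (cong₂ (λ x y → 1ℚ * (x + y)) (sumOn-split σ (φ ⁰) w) (sumOn-split σ (φ ¹) w))
  (W-lin (fib 1ℚ B w) 1ℚ (sumOn C (φ ⁰)) (sumOn C (φ ¹)))

-- The measure belonging to T ½ A f: frequencies on A are counted, points off A are averaged.
modes : V n → Vec Mode n
modes [] = []
modes (a ∷ A) = sc (if a then 1ℚ else ½) ∷ modes A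

modes-NN : (A : V n) → NN (modes A)
modes-NN [] = []
modes-NN (true ∷ A) = sc∷ 0≤1 (modes-NN A)
modes-NN (false ∷ A) = sc∷ 0≤½ (modes-NN A)

S : V n → (V n → ℚ) → ℚ
S A = W (modes A)

-- `sumOn C φ` no longer depends on the coordinates in `C`, so the average over them contained in
-- `S B` does nothing.
S-sumOn : {A B C : V n} → Split A B C → ∀ φ → S A φ ≡ S B (sumOn C φ)
S-sumOn [] φ = refl
S-sumOn (o∷ σ) φ = cong₂ (λ x y → ½ * (x + y)) (S-sumOn σ (φ ⁰)) (S-sumOn σ (φ ¹))
S-sumOn (l∷ σ) φ = cong₂ (λ x y → 1ℚ * (x + y)) (S-sumOn σ (φ ⁰)) (S-sumOn σ (φ ¹))
S-sumOn {A = _ ∷ A} {_ ∷ B} {_ ∷ C} (r∷ σ) φ = begin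
  1ℚ * (S A (φ ⁰) + S A (φ ¹)) ≡⟨ cong₂ (λ x y → 1ℚ * (x + y)) (S-sumOn σ (φ ⁰)) (S-sumOn σ (φ ¹)) ⟩
  1ℚ * (S B x + S B y) ≡⟨ W-lin (modes B) 1ℚ x y ⟩
  z ≡⟨ solve 1 (λ z → z := con ½ :* (z :+ z)) refl z ⟩
  ½ * (z + z) ∎
  where
  open ≡-Reasoning
  x = sumOn C (φ ⁰)
  y = sumOn C (φ ¹)
  z = S B (λ v → 1ℚ * (x v + y v))

S-avg : {A B C : V n} → Split A B C → ∀ φ → S B (avg C φ) ≡ S B φ
S-avg [] φ = refl
S-avg (o∷ σ) φ = cong₂ (λ x y → ½ * (x + y)) (S-avg σ (φ ⁰)) (S-avg σ (φ ¹))
S-avg (l∷ σ) φ = cong₂ (λ x y → 1ℚ * (x + y)) (S-avg σ (φ ⁰)) (S-avg σ (φ ¹))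
S-avg {A = _ ∷ A} {_ ∷ B} {_ ∷ C} (r∷ σ) φ = begin
  ½ * (z + z) ≡⟨ solve 1 (λ z → con ½ :* (z :+ z) := z) refl z ⟩
  z ≡⟨ W-lin (modes B) ½ x y ⟨
  ½ * (S B x + S B y) ≡⟨ cong₂ (λ x y → ½ * (x + y)) (S-avg σ (φ ⁰)) (S-avg σ (φ ¹)) ⟩
  ½ * (S B (φ ⁰) + S B (φ ¹)) ∎
  where
  open ≡-Reasoning
  x = avg C (φ ⁰)
  y = avg C (φ ¹)
  z = S B (λ v → ½ * (x v + y v))

∩-Off : {A B C : V n} → Split A B C → ∀ {w v} → Off C w v → B ∩ v ≡ B ∩ w
∩-Off [] [] = refl
∩-Off (o∷ σ) (same o) = cong (false ∷_) (∩-Off σ o)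
∩-Off (l∷ σ) (same o) = cong (_ ∷_) (∩-Off σ o)
∩-Off (r∷ σ) (free o) = cong (false ∷_) (∩-Off σ o)

Off-sub : {A B C : V n} → Split A B C → ∀ {w v} → Off C w v → Off A w v
Off-sub [] [] = []
Off-sub (o∷ σ) (same o) = same (Off-sub σ o)
Off-sub (l∷ σ) (same o) = free (Off-sub σ o)
Off-sub (r∷ σ) (free o) = free (Off-sub σ o)

-- The coordinates in `C` are counted by `S A` and averaged by `S B`; Parseval on each fibre
-- exchanges the two, the weight being constant on the fibres of `C`.
S-parseval : {A B C : V n} → Split A B C → (a : V n → ℚ) (G : V n → ℚ) →
  S A (λ w → a (B ∩ w) * (T ½ C G w * T ½ C G w)) ≡ S B (λ w → a (B ∩ w) * (G w * G w))
S-parseval {A = A} {B} {C} σ a G = begin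
  S A (λ w → a (B ∩ w) * (T ½ C G w * T ½ C G w)) ≡⟨ S-sumOn σ (λ w → a (B ∩ w) * (T ½ C G w * T ½ C G w)) ⟩
  S B (sumOn C (λ w → a (B ∩ w) * (T ½ C G w * T ½ C G w))) ≡⟨ W-cong (modes B) (λ w _ → pt w) ⟩
  S B (avg C (λ w → a (B ∩ w) * (G w * G w))) ≡⟨ S-avg σ (λ w → a (B ∩ w) * (G w * G w)) ⟩
  S B (λ w → a (B ∩ w) * (G w * G w)) ∎
  where
  open ≡-Reasoning
  pt : ∀ w → sumOn C (λ w → a (B ∩ w) * (T ½ C G w * T ½ C G w)) w ≡ avg C (λ w → a (B ∩ w) * (G w * G w)) w
  pt w = begin
    _ ≡⟨ W-inv 1ℚ C (λ v → a (B ∩ v)) (λ v → T ½ C G v * T ½ C G v) w (λ v o → cong a (∩-Off σ o)) ⟩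
    a (B ∩ w) * sumOn C (λ v → T ½ C G v * T ½ C G v) w ≡⟨ cong (a (B ∩ w) *_) (parseval C G w) ⟩
    a (B ∩ w) * avg C (λ v → G v * G v) w ≡⟨ W-inv ½ C (λ v → a (B ∩ v)) (λ v → G v * G v) w (λ v o → cong a (∩-Off σ o)) ⟨
    _ ∎

-- Coefficients below a threshold

nz : V n → Bool
nz [] = false
nz (true ∷ _) = true
nz (false ∷ v) = nz v

lt1 le1 : ℚ → Bool
lt1 x = not (does (1ℚ ≤? x))
le1 x = does (x ≤? 1ℚ)

does-true : ∀ {P : Set} (d : Dec P) → does d ≡ true → P
does-true (yes p) _ = p

does-false : ∀ {P : Set} (d : Dec P) → does d ≡ false → ¬ P
does-false (no ¬p) _ = ¬p

not-inj : ∀ {a b} → not a ≡ not b → a ≡ b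
not-inj {true} {true} _ = refl
not-inj {false} {false} _ = refl

lt1-true : ∀ x → lt1 x ≡ true → x < 1ℚ
lt1-true x e = ≰⇒> (does-false (1ℚ ≤? x) (not-inj e))

lt1-false : ∀ x → lt1 x ≡ false → 1ℚ ≤ x
lt1-false x e = does-true (1ℚ ≤? x) (not-inj e)

le1-true : ∀ x → le1 x ≡ true → x ≤ 1ℚ
le1-true x = does-true (x ≤? 1ℚ)

le1-false : ∀ x → le1 x ≡ false → 1ℚ < x
le1-false x e = ≰⇒> (does-false (x ≤? 1ℚ) e)

∧-true : ∀ {a b} → a ∧ b ≡ true → a ≡ true × b ≡ true
∧-true {true} {true} _ = refl , refl

2ℚ : ℚ
2ℚ = + 2 / 1

0≤2 : 0ℚ ≤ 2ℚ
0≤2 = *≤* (ℤ.+≤+ ℕ.z≤n)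

isBad : V n → (V n → ℚ) → (V n → ℚ) → V n → Bool
isBad A r f w = nz (A ∩ w) ∧ lt1 (r (A ∩ w) * (T ½ A f w * T ½ A f w))

-- Weight of the nonempty coefficients on A (under a random restriction outside A) whose square is below 1/r.
badMass : V n → (V n → ℚ) → (V n → ℚ) → ℚ
badMass A r f = S A (λ w → bval (isBad A r f w) * (T ½ A f w * T ½ A f w))

-- The expected variance of the random restriction of `f` to `A`.
mass : V n → (V n → ℚ) → ℚ
mass A f = S A (λ w → bval (nz (A ∩ w)) * (T ½ A f w * T ½ A f w))

-- This is the last hypothesis of `level` for the coordinates of `C`, with `ρ = r (B ∩ w)`. When it
-- fails although the frequency on `B` is nonempty, `N w` exceeds `1 / (9^|C ∩ w| L² r)`, so the
-- coefficient on `B` has a large norm bound.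
isLow : V n → V n → ℚ → (V n → ℚ) → (V n → ℚ) → V n → Bool
isLow B C L N r w = nz (B ∩ w) ∧ le1 (powℚ 9ℚ (card (C ∩ w)) * (L * L * N w * r (B ∩ w)))

bval-sq : ∀ b x → (bval b * x) * (bval b * x) ≡ bval b * (x * x)
bval-sq b x = trans (solve 2 (λ b t → (b :* t) :* (b :* t) := (b :* b) :* (t :* t)) refl (bval b) x)
  (cong (_* (x * x)) (bval-idem b))

bval-≤ : ∀ b {x} → 0ℚ ≤ x → bval b * x ≤ x
bval-≤ true {x} 0≤x = ≤-reflexive (*-identityˡ x)
bval-≤ false {x} 0≤x = subst (_≤ x) (sym (*-zeroˡ x)) 0≤x

[x+y]²≤2x²+2y² : ∀ x y → (x + y) * (x + y) ≤ 2ℚ * (x * x) + 2ℚ * (y * y)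
[x+y]²≤2x²+2y² x y = ≤-by ((x - y) * (x - y)) (0≤x² (x - y))
  (solve 2 (λ x y → con 2ℚ :* (x :* x) :+ con 2ℚ :* (y :* y) := (x :+ y) :* (x :+ y) :+ (x :- y) :* (x :- y)) refl x y)

-- The coefficients `G` on `B` are cut into a non-negligible part `G′` and a negligible part `G″`.
-- After the transform on `C`, Parseval bounds the second by `badMass B r f`, and `level` bounds the
-- low frequencies of the first by `mass B f / L`. The factors 2 come from squaring the sum.
lowMass : {A B C : V n} → Split A B C → (f r N : V n → ℚ) (L : ℚ) → 0ℚ ≤ L → (∀ U → 0ℚ ≤ r U) →
  (∀ w → nz (B ∩ w) ≡ true → sumOn C (λ v → T ½ A f v * T ½ A f v) w ≤ N w) →
  (∀ w v → Off C w v → N v ≡ N w) →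
  L * S A (λ w → bval (isLow B C L N r w) * (T ½ A f w * T ½ A f w)) ≤ 2ℚ * (L * badMass B r f) + 2ℚ * mass B f
lowMass {n} {A} {B} {C} σ f r N L 0≤L 0≤r N≥ N-inv = begin
  L * S A (λ w → bval (low w) * (g w * g w)) ≤⟨ *-monoˡ-≤ L 0≤L (W-mono (modes-NN A) (λ w _ → pointwise w)) ⟩
  L * S A (λ w → 2ℚ * (bval (low w) * (x w * x w)) + 2ℚ * (y w * y w))
    ≡⟨ cong (L *_) (trans (W-+ (modes A) (λ w → 2ℚ * (bval (low w) * (x w * x w))) (λ w → 2ℚ * (y w * y w)))
        (cong₂ _+_ (W-* (modes A) 2ℚ (λ w → bval (low w) * (x w * x w))) (W-* (modes A) 2ℚ (λ w → y w * y w)))) ⟩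
  L * (2ℚ * X + 2ℚ * Y) ≡⟨ solve 3 (λ l x y → l :* (con 2ℚ :* x :+ con 2ℚ :* y) := con 2ℚ :* (l :* y) :+ con 2ℚ :* (l :* x)) refl L X Y ⟩
  2ℚ * (L * Y) + 2ℚ * (L * X) ≤⟨ +-mono-≤ (≤-reflexive (cong (λ z → 2ℚ * (L * z)) Y≡)) (*-monoˡ-≤ 2ℚ 0≤2 LX≤) ⟩
  2ℚ * (L * badMass B r f) + 2ℚ * mass B f ∎
  where
  open ≤-Reasoning
  G g : V n → ℚ
  G = T ½ B f
  g = T ½ A f
  low kp bd : V n → Bool
  low = isLow B C L N r
  bd = isBad B r f
  kp v = nz (B ∩ v) ∧ not (lt1 (r (B ∩ v) * (G v * G v)))
  G′ G″ x y : V n → ℚ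
  G′ v = bval (kp v) * G v
  G″ v = bval (bd v) * G v
  x = T ½ C G′
  y = T ½ C G″
  X Y : ℚ
  X = S A (λ w → bval (low w) * (x w * x w))
  Y = S A (λ w → y w * y w)
  nz-fib : ∀ {w v} → Off C w v → nz (B ∩ v) ≡ nz (B ∩ w)
  nz-fib o = cong nz (∩-Off σ o)
  g≡x+y : ∀ w → nz (B ∩ w) ≡ true → g w ≡ x w + y w
  g≡x+y w e = trans (T-split ½ σ f w) (trans (T-cong ½ C w pt) (T-+ ½ C G′ G″ w))
    where
    pt : ∀ v → Off C w v → G v ≡ G′ v + G″ v
    pt v o rewrite trans (nz-fib o) e with lt1 (r (B ∩ v) * (G v * G v))
    ... | true = solve 1 (λ g → g := con 0ℚ :* g :+ con 1ℚ :* g) refl (G v)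
    ... | false = solve 1 (λ g → g := con 1ℚ :* g :+ con 0ℚ :* g) refl (G v)
  0≤y² = λ w → 0≤* 0≤2 (0≤x² (y w))
  pointwise : ∀ w → bval (low w) * (g w * g w) ≤ 2ℚ * (bval (low w) * (x w * x w)) + 2ℚ * (y w * y w)
  pointwise w with low w in eq
  ... | false = subst₂ _≤_ (sym (*-zeroˡ (g w * g w)))
                  (solve 2 (λ x y → con 2ℚ :* y := con 2ℚ :* (con 0ℚ :* x) :+ con 2ℚ :* y) refl (x w * x w) (y w * y w)) (0≤y² w)
  ... | true = begin
    1ℚ * (g w * g w) ≡⟨ *-identityˡ (g w * g w) ⟩
    g w * g w ≡⟨ cong (λ z → z * z) (g≡x+y w (proj₁ (∧-true eq))) ⟩
    (x w + y w) * (x w + y w) ≤⟨ [x+y]²≤2x²+2y² (x w) (y w) ⟩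
    2ℚ * (x w * x w) + 2ℚ * (y w * y w) ≡⟨ cong (λ z → 2ℚ * z + 2ℚ * (y w * y w)) (*-identityˡ (x w * x w)) ⟨
    2ℚ * (1ℚ * (x w * x w)) + 2ℚ * (y w * y w) ∎
  Y≡ : Y ≡ badMass B r f
  Y≡ = trans (W-cong (modes A) (λ w _ → sym (*-identityˡ (y w * y w))))
    (trans (S-parseval σ (λ _ → 1ℚ) G″)
      (W-cong (modes B) (λ w _ → trans (*-identityˡ (G″ w * G″ w)) (bval-sq (bd w) (G w)))))
  G′²≤ : ∀ v → G′ v * G′ v ≤ G v * G v
  G′²≤ v = subst (_≤ G v * G v) (sym (bval-sq (kp v) (G v))) (bval-≤ (kp v) (0≤x² (G v)))
  fibre : ∀ w → L * sumOn C (λ v → bval (low v) * (x v * x v)) w ≤ avg C (λ v → G′ v * G′ v) w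
  fibre w with nz (B ∩ w) in eq
  ... | false = subst (_≤ avg C (λ v → G′ v * G′ v) w) (sym zero-sum) (W-0≤ (fib-NN 0≤½ C w) (λ v _ → 0≤x² (G′ v)))
    where
    vanish : ∀ v → Off C w v → bval (low v) * (x v * x v) ≡ 0ℚ
    vanish v o rewrite trans (nz-fib o) eq = *-zeroˡ (x v * x v)
    zero-sum : L * sumOn C (λ v → bval (low v) * (x v * x v)) w ≡ 0ℚ
    zero-sum = trans (cong (L *_) (trans (W-cong (fib 1ℚ C w) (λ v o → vanish v (fib-Off C w o))) (W-0 (fib 1ℚ C w)))) (*-zeroʳ L)
  -- On this fibre the frequency on `B` is fixed, so one `ρ` serves for all its points: `G′`
  -- vanishes or has square at least `1/ρ`, and `kp` plays the part of the support indicator.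
  ... | true = level C w G′ (bval ∘ kp) low L (N w) (r (B ∩ w)) 0≤L (0≤r (B ∩ w))
      (λ v _ → 0≤bval (kp v)) (λ v _ → ≤-reflexive (bval-idem (kp v))) (λ v _ → ≤-reflexive (supp v)) large norm≤ lowC
    where
    supp : ∀ v → G′ v * G′ v ≡ (G′ v * G′ v) * bval (kp v)
    supp v with kp v
    ... | true = sym (*-identityʳ _)
    ... | false = solve 1 (λ g → (con 0ℚ :* g) :* (con 0ℚ :* g) := ((con 0ℚ :* g) :* (con 0ℚ :* g)) :* con 0ℚ) refl (G v)
    large : ∀ v → Off C w v → bval (kp v) ≤ r (B ∩ w) * (G′ v * G′ v)
    large v o rewrite sym (∩-Off σ o) | eq with lt1 (r (B ∩ v) * (G v * G v)) in e
    ... | true = ≤-reflexive (solve 2 (λ r g → con 0ℚ := r :* ((con 0ℚ :* g) :* (con 0ℚ :* g))) refl (r (B ∩ v)) (G v))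
    ... | false = subst (1ℚ ≤_) (solve 2 (λ r g → r :* (g :* g) := r :* ((con 1ℚ :* g) :* (con 1ℚ :* g))) refl (r (B ∩ v)) (G v)) (lt1-false _ e)
    norm≤ : avg C (λ v → G′ v * G′ v) w ≤ N w
    norm≤ = begin
      avg C (λ v → G′ v * G′ v) w ≤⟨ W-mono (fib-NN 0≤½ C w) (λ v _ → G′²≤ v) ⟩
      avg C (λ v → G v * G v) w ≡⟨ parseval C G w ⟨
      sumOn C (λ v → T ½ C G v * T ½ C G v) w ≡⟨ W-cong (fib 1ℚ C w) (λ v _ → cong (λ z → z * z) (T-split ½ σ f v)) ⟨
      sumOn C (λ v → g v * g v) w ≤⟨ N≥ w eq ⟩
      N w ∎
    lowC : ∀ v → Off C w v → low v ≡ true → powℚ 9ℚ (card (C ∩ v)) * (L * L * N w * r (B ∩ w)) ≤ 1ℚ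
    lowC v o e = subst₂ (λ N U → powℚ 9ℚ (card (C ∩ v)) * (L * L * N * r U) ≤ 1ℚ) (N-inv w v o) (∩-Off σ o)
      (le1-true _ (proj₂ (∧-true e)))
  LX≤ : L * X ≤ mass B f
  LX≤ = begin
    L * X ≡⟨ cong (L *_) (S-sumOn σ (λ w → bval (low w) * (x w * x w))) ⟩
    L * S B (sumOn C (λ w → bval (low w) * (x w * x w))) ≡⟨ W-* (modes B) L (sumOn C (λ w → bval (low w) * (x w * x w))) ⟨
    S B (λ w → L * sumOn C (λ w → bval (low w) * (x w * x w)) w) ≤⟨ W-mono (modes-NN B) (λ w _ → fibre w) ⟩
    S B (avg C (λ v → G′ v * G′ v)) ≡⟨ S-avg σ (λ v → G′ v * G′ v) ⟩
    S B (λ v → G′ v * G′ v) ≤⟨ W-mono (modes-NN B) (λ v _ → pt v) ⟩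
    mass B f ∎
    where
    pt : ∀ v → G′ v * G′ v ≤ bval (nz (B ∩ v)) * (G v * G v)
    pt v with nz (B ∩ v)
    ... | true = subst (G″′ * G″′ ≤_) (sym (*-identityˡ (G v * G v)))
                   (subst (_≤ G v * G v) (sym (bval-sq b (G v))) (bval-≤ b (0≤x² (G v))))
      where
      b = not (lt1 (r (B ∩ v) * (G v * G v)))
      G″′ = bval b * G v
    ... | false = ≤-reflexive (solve 1 (λ g → (con 0ℚ :* g) :* (con 0ℚ :* g) := con 0ℚ :* (g :* g)) refl (G v))

-- Merging two disjoint coordinate sets

ι : ℕ → ℚ
ι k = + k / 1

toℚᵘ-ι : ∀ k → toℚᵘ (ι k) ℚᵘ.≃ ℚᵘ.mkℚᵘ (+ k) 0
toℚᵘ-ι k = toℚᵘ-fromℚᵘ (ℚᵘ.mkℚᵘ (+ k) 0)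

ι-+ : ∀ a b → ι (a ℕ.+ b) ≡ ι a + ι b
ι-+ a b = toℚᵘ-injective (ℚᵘₚ.≃-trans (toℚᵘ-ι (a ℕ.+ b)) (ℚᵘₚ.≃-sym
  (ℚᵘₚ.≃-trans (toℚᵘ-homo-+ (ι a) (ι b)) (ℚᵘₚ.≃-trans (ℚᵘₚ.+-cong (toℚᵘ-ι a) (toℚᵘ-ι b))
    (ℚᵘ.*≡* (cong₂ (λ x y → (x ℤ.+ y) ℤ.* (+ 1)) (ℤₚ.*-identityʳ (+ a)) (ℤₚ.*-identityʳ (+ b))))))))

ι-* : ∀ a b → ι (a ℕ.* b) ≡ ι a * ι b
ι-* a b = toℚᵘ-injective (ℚᵘₚ.≃-trans (toℚᵘ-ι (a ℕ.* b)) (ℚᵘₚ.≃-sym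
  (ℚᵘₚ.≃-trans (toℚᵘ-homo-* (ι a) (ι b)) (ℚᵘₚ.≃-trans (ℚᵘₚ.*-cong (toℚᵘ-ι a) (toℚᵘ-ι b))
    (ℚᵘ.*≡* (cong (ℤ._* (+ 1)) (sym (ℤₚ.pos-* a b))))))))

0≤ι : ∀ k → 0ℚ ≤ ι k
0≤ι k = nonNegative⁻¹ (ι k) {{normalize-nonNeg k 1}}

ι-mono : ∀ {a b} → a ℕ.≤ b → ι a ≤ ι b
ι-mono {a} {b} a≤b = ≤-by (ι (b ℕ.∸ a)) (0≤ι (b ℕ.∸ a))
  (trans (cong ι (sym (ℕₚ.m+[n∸m]≡n a≤b))) (ι-+ a (b ℕ.∸ a)))

full empty : (n : ℕ) → V n
full n = replicate n true
empty n = replicate n false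

∁ : V n → V n
∁ = vmap not

Split-∁ : (A : V n) → Split (full n) A (∁ A)
Split-∁ [] = []
Split-∁ (true ∷ A) = l∷ Split-∁ A
Split-∁ (false ∷ A) = r∷ Split-∁ A

-- The sum of the influences of the coordinates in `A`. It dominates `mass` and is additive over
-- disjoint unions, so the errors of all nodes on one level of the tree add up to a multiple of the
-- total influence.
infl : V n → (V n → ℚ) → ℚ
infl {n} A f = S (full n) (λ w → ι (card (A ∩ w)) * (T ½ (full n) f w * T ½ (full n) f w))

nz≤card : (U : V n) → bval (nz U) ≤ ι (card U)
nz≤card [] = ≤-refl
nz≤card (true ∷ U) = ι-mono {1} {suc (card U)} (ℕ.s≤s ℕ.z≤n)
nz≤card (false ∷ U) = nz≤card U

card-split : {A B C : V n} → Split A B C → ∀ w → card (A ∩ w) ≡ card (B ∩ w) ℕ.+ card (C ∩ w)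
card-split [] [] = refl
card-split (o∷ σ) (b ∷ w) = card-split σ w
card-split (l∷ σ) (true ∷ w) = cong suc (card-split σ w)
card-split (l∷ σ) (false ∷ w) = card-split σ w
card-split {A = _ ∷ A} {_ ∷ B} {_ ∷ C} (r∷ σ) (true ∷ w) =
  trans (cong suc (card-split σ w)) (sym (ℕₚ.+-suc (card (B ∩ w)) (card (C ∩ w))))
card-split (r∷ σ) (false ∷ w) = card-split σ w

infl-split : {A B C : V n} → Split A B C → ∀ f → infl A f ≡ infl B f + infl C f
infl-split {n} {A} {B} {C} σ f = trans
  (W-cong (modes (full n)) (λ w _ → trans (cong (_* (g w * g w)) (trans (cong ι (card-split σ w)) (ι-+ (card (B ∩ w)) (card (C ∩ w)))))
    (*-distribʳ-+ (g w * g w) (ι (card (B ∩ w))) (ι (card (C ∩ w))))))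
  (W-+ (modes (full n)) (λ w → ι (card (B ∩ w)) * (g w * g w)) (λ w → ι (card (C ∩ w)) * (g w * g w)))
  where g = T ½ (full n) f

mass≤infl : (A : V n) (f : V n → ℚ) → mass A f ≤ infl A f
mass≤infl {n} A f = begin
  mass A f ≡⟨ S-parseval (Split-∁ A) (bval ∘ nz) (T ½ A f) ⟨
  S (full n) (λ w → bval (nz (A ∩ w)) * (T ½ (∁ A) (T ½ A f) w * T ½ (∁ A) (T ½ A f) w))
    ≤⟨ W-mono (modes-NN (full n)) (λ w _ → subst (λ x → bval (nz (A ∩ w)) * (x * x) ≤ ι (card (A ∩ w)) * (T ½ (full n) f w * T ½ (full n) f w)) (T-split ½ (Split-∁ A) f w)
         (*-monoʳ-≤ (T ½ (full n) f w * T ½ (full n) f w) (0≤x² (T ½ (full n) f w)) (nz≤card (A ∩ w)))) ⟩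
  infl A f ∎
  where open ≤-Reasoning

mass-split : {A B C : V n} → Split A B C → ∀ f →
  S A (λ w → bval (nz (B ∩ w)) * (T ½ A f w * T ½ A f w)) ≡ mass B f
mass-split {A = A} {B} {C} σ f = trans
  (W-cong (modes A) (λ w _ → cong (λ x → bval (nz (B ∩ w)) * (x * x)) (T-split ½ σ f w)))
  (S-parseval σ (bval ∘ nz) (T ½ B f))

S-out : {A B C : V n} → Split A B C → (a φ : V n → ℚ) → (∀ w v → Off C w v → a v ≡ a w) →
  S A (λ w → a w * φ w) ≡ S B (λ w → a w * sumOn C φ w)
S-out {B = B} {C} σ a φ inv = trans (S-sumOn σ (λ w → a w * φ w))
  (W-cong (modes B) (λ w _ → W-inv 1ℚ C a φ w (inv w)))

sumOn-inv : (B : V n) (φ : V n → ℚ) → ∀ w v → Off B w v → sumOn B φ v ≡ sumOn B φ w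
sumOn-inv B φ w v o = cong (λ m → W m φ) (sym (fib-irr o))

avg-1 : (B w : V n) → avg B (λ _ → 1ℚ) w ≡ 1ℚ
avg-1 [] [] = refl
avg-1 (true ∷ B) (_ ∷ w) = cong₂ (λ x y → ½ * (x + y)) (avg-1 B w) (avg-1 B w)
avg-1 (false ∷ B) (_ ∷ w) = avg-1 B w

isZero-sum : (B w : V n) → sumOn B (λ v → bval (not (nz (B ∩ v)))) w ≡ 1ℚ
isZero-sum [] [] = refl
isZero-sum (true ∷ B) (_ ∷ w) = cong₂ (λ x y → 1ℚ * (x + y)) (isZero-sum B w) (W-0 (fib 1ℚ B w))
isZero-sum (false ∷ B) (_ ∷ w) = isZero-sum B w

nz-split : {A B C : V n} → Split A B C → ∀ w → nz (A ∩ w) ≡ true → nz (B ∩ w) ≡ false → nz (C ∩ w) ≡ true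
nz-split [] [] ()
nz-split (o∷ σ) (_ ∷ w) = nz-split σ w
nz-split (l∷ σ) (false ∷ w) = nz-split σ w
nz-split (r∷ σ) (true ∷ w) _ _ = refl
nz-split (r∷ σ) (false ∷ w) = nz-split σ w

module Merge {A B C : V n} (σ : Split A B C) (f : V n → ℚ) (f²≤1 : ∀ x → f x * f x ≤ 1ℚ) where

  private
    g NB NC : V n → ℚ
    g = T ½ A f
    -- By Parseval on `C`, `NB w` is the squared norm, over the points of `C`, of the coefficient on
    -- `B` at the frequency `B ∩ w`.
    NB = sumOn C (λ v → g v * g v)
    NC = sumOn B (λ v → g v * g v)

    σ′ = Split-sym σ

    0≤NB : ∀ w → 0ℚ ≤ NB w
    0≤NB w = W-0≤ (fib-NN 0≤1 C w) (λ v _ → 0≤x² (g v))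

    0≤NC : ∀ w → 0ℚ ≤ NC w
    0≤NC w = W-0≤ (fib-NN 0≤1 B w) (λ v _ → 0≤x² (g v))

  total≤1 : ∀ w → sumOn A (λ v → g v * g v) w ≤ 1ℚ
  total≤1 w = subst₂ _≤_ (sym (parseval A f w)) (avg-1 A w) (W-mono (fib-NN 0≤½ A w) (λ v _ → f²≤1 v))

  private
    ΣNC≤1 : ∀ w → sumOn C NC w ≤ 1ℚ
    ΣNC≤1 w = subst (_≤ 1ℚ) (sumOn-split σ′ (λ v → g v * g v) w) (total≤1 w)

    aB aC zB zC : V n → ℚ
    aB w = bval (nz (B ∩ w)) * NB w
    aC w = bval (nz (C ∩ w)) * NC w
    zB w = bval (not (nz (B ∩ w)))
    zC w = bval (not (nz (C ∩ w)))

    aB-inv : ∀ w v → Off C w v → aB v ≡ aB w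
    aB-inv w v o = cong₂ _*_ (cong (bval ∘ nz) (∩-Off σ o)) (sumOn-inv C _ w v o)

    aC-inv : ∀ w v → Off B w v → aC v ≡ aC w
    aC-inv w v o = cong₂ _*_ (cong (bval ∘ nz) (∩-Off σ′ o)) (sumOn-inv B _ w v o)

    S-aB : S B aB ≡ mass B f
    S-aB = trans (sym (S-out σ (λ w → bval (nz (B ∩ w))) (λ v → g v * g v) (λ w v o → cong (bval ∘ nz) (∩-Off σ o)))) (mass-split σ f)

    S-aC : S C aC ≡ mass C f
    S-aC = trans (sym (S-out σ′ (λ w → bval (nz (C ∩ w))) (λ v → g v * g v) (λ w v o → cong (bval ∘ nz) (∩-Off σ′ o)))) (mass-split σ′ f)

    -- For a given frequency on `B`, `NC` sums to at most 1 over the frequencies on `C` and `zC`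
    -- selects the empty one, so `NB` is counted at most twice.
    termB : S A (λ w → aB w * (NC w + zC w)) ≤ mass B f * 2ℚ
    termB = begin
      S A (λ w → aB w * (NC w + zC w)) ≡⟨ S-out σ aB (λ w → NC w + zC w) aB-inv ⟩
      S B (λ w → aB w * sumOn C (λ w → NC w + zC w) w)
        ≤⟨ W-mono (modes-NN B) (λ w _ → *-monoˡ-≤ (aB w) (0≤* (0≤bval (nz (B ∩ w))) (0≤NB w))
             (subst (_≤ 2ℚ) (sym (W-+ (fib 1ℚ C w) NC zC)) (+-mono-≤ (ΣNC≤1 w) (≤-reflexive (isZero-sum C w))))) ⟩
      S B (λ w → aB w * 2ℚ) ≡⟨ W-cong (modes B) (λ w _ → *-comm (aB w) 2ℚ) ⟩
      S B (λ w → 2ℚ * aB w) ≡⟨ W-* (modes B) 2ℚ aB ⟩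
      2ℚ * S B aB ≡⟨ trans (*-comm 2ℚ (S B aB)) (cong (_* 2ℚ) S-aB) ⟩
      mass B f * 2ℚ ∎
      where open ≤-Reasoning

    termC : S A (λ w → aC w * zB w) ≡ mass C f
    termC = trans (S-out σ′ aC zB aC-inv)
      (trans (W-cong (modes C) (λ w _ → trans (cong (aC w *_) (isZero-sum B w)) (*-identityʳ (aC w)))) S-aC)

  module _ (rA rB rC : V n → ℚ) (L : ℚ) (1≤L : 1ℚ ≤ L) (1≤rB : ∀ U → 1ℚ ≤ rB U) (1≤rC : ∀ U → 1ℚ ≤ rC U) where

    private
      0≤L = ≤-trans 0≤1 1≤L
      0<L = <-≤-trans 0<1 1≤L

      XB XC : V n → ℚ
      XB w = powℚ 9ℚ (card (C ∩ w)) * (L * L * rB (B ∩ w))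
      XC w = powℚ 9ℚ (card (B ∩ w)) * (L * L * rC (C ∩ w))

      1≤L² : 1ℚ ≤ L * L
      1≤L² = *-mono-≤ {1ℚ} {L} {1ℚ} 0≤1 0≤L 1≤L 1≤L

      1≤XB : ∀ w → 1ℚ ≤ XB w
      1≤XB w = 1≤* (1≤pow 1≤9 (card (C ∩ w))) (1≤* 1≤L² (1≤rB (B ∩ w)))

      1≤XC : ∀ w → 1ℚ ≤ XC w
      1≤XC w = 1≤* (1≤pow 1≤9 (card (B ∩ w))) (1≤* 1≤L² (1≤rC (C ∩ w)))

      lowB lowC : V n → Bool
      lowB = isLow B C L NB rB
      lowC = isLow C B L NC rC

      one : ∀ {g² L X Y N r} → 0ℚ ≤ g² → 0ℚ ≤ L → 1ℚ ≤ X → 1ℚ ≤ Y → r ≡ L * X * Y →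
        r * g² < 1ℚ → 1ℚ < X * N → L * g² ≤ N
      one {g²} {L} {X} {Y} {N} 0≤g² 0≤L 1≤X 1≤Y refl bad high = *-cancelˡ-≤ X (<-≤-trans 0<1 1≤X) (begin
        X * (L * g²) ≡⟨ *-identityʳ (X * (L * g²)) ⟨
        (X * (L * g²)) * 1ℚ ≤⟨ *-monoˡ-≤ (X * (L * g²)) (0≤* (≤-trans 0≤1 1≤X) (0≤* 0≤L 0≤g²)) 1≤Y ⟩
        (X * (L * g²)) * Y ≡⟨ solve 4 (λ x l g y → (x :* (l :* g)) :* y := l :* x :* y :* g) refl X L g² Y ⟩
        L * X * Y * g² ≤⟨ <⇒≤ bad ⟩
        1ℚ ≤⟨ <⇒≤ high ⟩
        X * N ∎)
        where open ≤-Reasoning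

      both : ∀ {g² L X Y N M r} → 1ℚ ≤ X → 1ℚ ≤ Y → r ≡ L * X * Y →
        r * g² < 1ℚ → 1ℚ < X * N → 1ℚ < Y * M → L * g² ≤ N * M
      both {g²} {L} {X} {Y} {N} {M} 1≤X 1≤Y refl bad hN hM = *-cancelˡ-≤ (X * Y) (0<* (<-≤-trans 0<1 1≤X) (<-≤-trans 0<1 1≤Y)) (begin
        (X * Y) * (L * g²) ≡⟨ solve 4 (λ x l g y → (x :* y) :* (l :* g) := l :* x :* y :* g) refl X L g² Y ⟩
        L * X * Y * g² ≤⟨ <⇒≤ bad ⟩
        1ℚ * 1ℚ ≤⟨ *-mono-≤ 0≤1 (≤-trans 0≤1 (<⇒≤ hM)) (<⇒≤ hN) (<⇒≤ hM) ⟩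
        (X * N) * (Y * M) ≡⟨ solve 4 (λ x n y m → (x :* n) :* (y :* m) := (x :* y) :* (n :* m)) refl X N Y M ⟩
        (X * Y) * (N * M) ∎)
        where open ≤-Reasoning

      highB : ∀ w → nz (B ∩ w) ≡ true → lowB w ≡ false → 1ℚ < XB w * NB w
      highB w e l rewrite e = subst (1ℚ <_)
        (solve 4 (λ p l n r → p :* (l :* l :* n :* r) := p :* (l :* l :* r) :* n) refl (powℚ 9ℚ (card (C ∩ w))) L (NB w) (rB (B ∩ w)))
        (le1-false _ l)

      highC : ∀ w → nz (C ∩ w) ≡ true → lowC w ≡ false → 1ℚ < XC w * NC w
      highC w e l rewrite e = subst (1ℚ <_)
        (solve 4 (λ p l n r → p :* (l :* l :* n :* r) := p :* (l :* l :* r) :* n) refl (powℚ 9ℚ (card (B ∩ w))) L (NC w) (rC (C ∩ w)))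
        (le1-false _ l)

    -- Here `rA = L * XB * XC`. A bad frequency that is low on neither side has `XB * NB > 1` if it
    -- meets `B`, and `XC * NC > 1` if it meets `C`. Dividing, its square is at most `NB * NC / L`,
    -- the factor of an empty side being absent; these bounds are summable by `termB` and `termC`.
    -- Low frequencies are left to `lowMass`, applied to each side.
    badMass-merge : (∀ w → rA (A ∩ w) ≡ L * (powℚ 9ℚ (card (C ∩ w)) * (L * L * rB (B ∩ w))) * (powℚ 9ℚ (card (B ∩ w)) * (L * L * rC (C ∩ w)))) →
      L * badMass A rA f ≤ 2ℚ * (L * badMass B rB f) + 2ℚ * (L * badMass C rC f) + (+ 4 / 1) * infl A f
    badMass-merge rA≡ = begin
      L * badMass A rA f ≡⟨ W-* (modes A) L (λ w → bval (bad w) * g² w) ⟨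
      S A (λ w → L * (bval (bad w) * g² w)) ≤⟨ W-mono (modes-NN A) (λ w _ → pointwise w) ⟩
      S A (λ w → (L * (bval (lowB w) * g² w) + L * (bval (lowC w) * g² w)) + (aB w * (NC w + zC w) + aC w * zB w))
        ≡⟨ trans (W-+ (modes A) (λ w → L * (bval (lowB w) * g² w) + L * (bval (lowC w) * g² w)) (λ w → aB w * (NC w + zC w) + aC w * zB w))
            (cong₂ _+_ (trans (W-+ (modes A) (λ w → L * (bval (lowB w) * g² w)) (λ w → L * (bval (lowC w) * g² w)))
                         (cong₂ _+_ (W-* (modes A) L (λ w → bval (lowB w) * g² w)) (W-* (modes A) L (λ w → bval (lowC w) * g² w))))
                       (W-+ (modes A) (λ w → aB w * (NC w + zC w)) (λ w → aC w * zB w))) ⟩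
      (L * S A (λ w → bval (lowB w) * g² w) + L * S A (λ w → bval (lowC w) * g² w)) + (S A (λ w → aB w * (NC w + zC w)) + S A (λ w → aC w * zB w))
        ≤⟨ +-mono-≤ (+-mono-≤ (lowMass σ f rB NB L 0≤L (λ U → ≤-trans 0≤1 (1≤rB U)) (λ w _ → ≤-refl) (sumOn-inv C _))
                              (lowMass σ′ f rC NC L 0≤L (λ U → ≤-trans 0≤1 (1≤rC U)) (λ w _ → ≤-refl) (sumOn-inv B _)))
                    (+-mono-≤ termB (≤-reflexive termC)) ⟩
      ((2ℚ * EB + 2ℚ * mB) + (2ℚ * EC + 2ℚ * mC)) + (mB * 2ℚ + mC)
        -- `mass B f` occurs 2 + 2 times and `mass C f` occurs 2 + 1 times, whence the 4.
        ≤⟨ ≤-by ((+ 4 / 1) * ((infl B f - mB) + (infl C f - mC)) + mC)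
             (0≤+ (0≤* {+ 4 / 1} (*≤* (ℤ.+≤+ ℕ.z≤n)) (0≤+ (x≤y⇒0≤y-x (mass≤infl B f)) (x≤y⇒0≤y-x (mass≤infl C f)))) 0≤mC)
             (solve 6 (λ eb ec mb mc ib ic → con 2ℚ :* eb :+ con 2ℚ :* ec :+ con (+ 4 / 1) :* (ib :+ ic)
                := (((con 2ℚ :* eb :+ con 2ℚ :* mb) :+ (con 2ℚ :* ec :+ con 2ℚ :* mc)) :+ (mb :* con 2ℚ :+ mc)) :+ (con (+ 4 / 1) :* ((ib :- mb) :+ (ic :- mc)) :+ mc)) refl
                EB EC mB mC (infl B f) (infl C f)) ⟩
      2ℚ * EB + 2ℚ * EC + (+ 4 / 1) * (infl B f + infl C f) ≡⟨ cong (λ x → 2ℚ * EB + 2ℚ * EC + (+ 4 / 1) * x) (infl-split σ f) ⟨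
      2ℚ * EB + 2ℚ * EC + (+ 4 / 1) * infl A f ∎
      where
      open ≤-Reasoning
      bad : V n → Bool
      bad = isBad A rA f
      g² : V n → ℚ
      g² w = g w * g w
      EB = L * badMass B rB f
      EC = L * badMass C rC f
      mB = mass B f
      mC = mass C f
      0≤mC : 0ℚ ≤ mC
      0≤mC = W-0≤ (modes-NN C) (λ w _ → 0≤* (0≤bval (nz (C ∩ w))) (0≤x² (T ½ C f w)))
      0≤Lg² : ∀ w b → 0ℚ ≤ L * (bval b * g² w)
      0≤Lg² w b = 0≤* 0≤L (0≤* (0≤bval b) (0≤x² (g w)))
      module _ (w : V n) where
        0≤rest : ∀ nb nc → 0ℚ ≤ (bval nb * NB w) * (NC w + bval (not nc)) + (bval nc * NC w) * bval (not nb)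
        0≤rest nb nc = 0≤+ (0≤* (0≤* (0≤bval nb) (0≤NB w)) (0≤+ (0≤NC w) (0≤bval (not nc))))
                           (0≤* (0≤* (0≤bval nc) (0≤NC w)) (0≤bval (not nb)))
        bad⇒ : bad w ≡ true → rA (A ∩ w) * g² w < 1ℚ
        bad⇒ e = lt1-true _ (proj₂ (∧-true {nz (A ∩ w)} e))
        cases : ∀ b lb lc nb nc → bad w ≡ b → lowB w ≡ lb → lowC w ≡ lc → nz (B ∩ w) ≡ nb → nz (C ∩ w) ≡ nc →
          L * (bval b * g² w) ≤ (L * (bval lb * g² w) + L * (bval lc * g² w)) +
            ((bval nb * NB w) * (NC w + bval (not nc)) + (bval nc * NC w) * bval (not nb))
        cases false lb lc nb nc _ _ _ _ _ = subst (_≤ R) (solve 2 (λ l g → con 0ℚ := l :* (con 0ℚ :* g)) refl L (g² w))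
            (0≤+ (0≤+ (0≤Lg² w lb) (0≤Lg² w lc)) (0≤rest nb nc))
          where R = (L * (bval lb * g² w) + L * (bval lc * g² w)) + ((bval nb * NB w) * (NC w + bval (not nc)) + (bval nc * NC w) * bval (not nb))
        cases true true lc nb nc _ _ _ _ _ = ≤-by (L * (bval lc * g² w) + R) (0≤+ (0≤Lg² w lc) (0≤rest nb nc))
            (+-assoc (L * (1ℚ * g² w)) (L * (bval lc * g² w)) R)
          where R = (bval nb * NB w) * (NC w + bval (not nc)) + (bval nc * NC w) * bval (not nb)
        cases true false true nb nc _ _ _ _ _ = ≤-by R (0≤rest nb nc)
            (cong (λ z → z + R) (solve 2 (λ l g → l :* (con 0ℚ :* g) :+ l :* (con 1ℚ :* g) := l :* (con 1ℚ :* g)) refl L (g² w)))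
          where R = (bval nb * NB w) * (NC w + bval (not nc)) + (bval nc * NC w) * bval (not nb)
        cases true false false true true eb elb elc enb enc = subst₂ _≤_
          (solve 2 (λ l g → l :* g := l :* (con 1ℚ :* g)) refl L (g² w))
          (solve 4 (λ l g nb nc → nb :* nc := (l :* (con 0ℚ :* g) :+ l :* (con 0ℚ :* g)) :+ ((con 1ℚ :* nb) :* (nc :+ con 0ℚ) :+ (con 1ℚ :* nc) :* con 0ℚ)) refl L (g² w) (NB w) (NC w))
          (both {L = L} (1≤XB w) (1≤XC w) (rA≡ w) (bad⇒ eb) (highB w enb elb) (highC w enc elc))
        cases true false false true false eb elb elc enb enc = subst (_≤ R) (solve 2 (λ l g → l :* g := l :* (con 1ℚ :* g)) refl L (g² w))
          (≤-trans (one {L = L} (0≤x² (g w)) 0≤L (1≤XB w) (1≤XC w) (rA≡ w) (bad⇒ eb) (highB w enb elb))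
            (≤-by (NB w * NC w) (0≤* (0≤NB w) (0≤NC w)) (solve 4 (λ l g nb nc → (l :* (con 0ℚ :* g) :+ l :* (con 0ℚ :* g)) :+ ((con 1ℚ :* nb) :* (nc :+ con 1ℚ) :+ (con 0ℚ :* nc) :* con 0ℚ) := nb :+ nb :* nc) refl L (g² w) (NB w) (NC w))))
          where R = (L * (0ℚ * g² w) + L * (0ℚ * g² w)) + ((1ℚ * NB w) * (NC w + 1ℚ) + (0ℚ * NC w) * 0ℚ)
        cases true false false false true eb elb elc enb enc = subst₂ _≤_
          (solve 2 (λ l g → l :* g := l :* (con 1ℚ :* g)) refl L (g² w))
          (solve 4 (λ l g nb nc → nc := (l :* (con 0ℚ :* g) :+ l :* (con 0ℚ :* g)) :+ ((con 0ℚ :* nb) :* (nc :+ con 0ℚ) :+ (con 1ℚ :* nc) :* con 1ℚ)) refl L (g² w) (NB w) (NC w))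
          (one {L = L} (0≤x² (g w)) 0≤L (1≤XC w) (1≤XB w)
            (trans (rA≡ w) (solve 3 (λ l x y → l :* x :* y := l :* y :* x) refl L (XB w) (XC w))) (bad⇒ eb) (highC w enc elc))
        -- A bad frequency is nonempty on `A`, hence on one of the two parts.
        cases true false false false false eb elb elc enb enc =
          ⊥-elim (case trans (sym (nz-split σ w (proj₁ (∧-true eb)) enb)) enc of λ ())
      pointwise : ∀ w → L * (bval (bad w) * g² w) ≤
        (L * (bval (lowB w) * g² w) + L * (bval (lowC w) * g² w)) + (aB w * (NC w + zC w) + aC w * zB w)
      pointwise w = cases w (bad w) (lowB w) (lowC w) (nz (B ∩ w)) (nz (C ∩ w)) refl refl refl refl refl

-- Coordinate sets that are not split further

4ℚ : ℚ
4ℚ = + 4 / 1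

0≤4 : 0ℚ ≤ 4ℚ
0≤4 = *≤* (ℤ.+≤+ ℕ.z≤n)

reciprocal : ∀ {L} → 0ℚ < L → ∃ λ ε → 0ℚ ≤ ε × L * ε ≡ 1ℚ
reciprocal {L} 0<L = (1/ L) , <⇒≤ (positive⁻¹ (1/ L) {{1/pos⇒pos L}}) , *-inverseʳ L
  where
  instance
    _ = positive 0<L
    _ = pos⇒nonZero L {{positive 0<L}}

-- One-hot vectors stand for singletons.
oh : Fin n → V n
oh {suc n} zero = true ∷ empty n
oh (suc i) = false ∷ oh i

del : Fin n → V n → V n
del zero (_ ∷ J) = false ∷ J
del (suc i) (a ∷ J) = a ∷ del i J

Split-empty : (J : V n) → Split J (empty n) J
Split-empty [] = []
Split-empty (true ∷ J) = r∷ Split-empty J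
Split-empty (false ∷ J) = o∷ Split-empty J

Split-oh : (i : Fin n) (J : V n) → lookup J i ≡ true → Split J (oh i) (del i J)
Split-oh zero (true ∷ J) e = l∷ Split-empty J
Split-oh (suc i) (true ∷ J) e = r∷ Split-oh i J e
Split-oh (suc i) (false ∷ J) e = o∷ Split-oh i J e

nz-empty : (w : V n) → nz (empty n ∩ w) ≡ false
nz-empty [] = refl
nz-empty (_ ∷ w) = nz-empty w

card-empty : (w : V n) → card (empty n ∩ w) ≡ 0
card-empty [] = refl
card-empty (_ ∷ w) = card-empty w

T-empty : ∀ p (g : V n → ℚ) w → T p (empty n) g w ≡ g w
T-empty p g [] = refl
T-empty p g (b ∷ w) = T-empty p (g ∘ (b ∷_)) w

lookup⇒nz : (i : Fin n) (w : V n) → lookup w i ≡ true → nz (oh i ∩ w) ≡ true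
lookup⇒nz zero (true ∷ w) e = refl
lookup⇒nz (suc i) (_ ∷ w) e = lookup⇒nz i w e

-- Sums and products over a coordinate set

∑ : V n → (Fin n → ℚ) → ℚ
∑ [] y = 0ℚ
∑ (true ∷ J) y = y zero + ∑ J (y ∘ suc)
∑ (false ∷ J) y = ∑ J (y ∘ suc)

∑-mono : (J : V n) {y z : Fin n → ℚ} → (∀ i → lookup J i ≡ true → y i ≤ z i) → ∑ J y ≤ ∑ J z
∑-mono [] h = ≤-refl
∑-mono (true ∷ J) h = +-mono-≤ (h zero refl) (∑-mono J (λ i → h (suc i)))
∑-mono (false ∷ J) h = ∑-mono J (λ i → h (suc i))

∑-cong : (J : V n) {y z : Fin n → ℚ} → (∀ i → lookup J i ≡ true → y i ≡ z i) → ∑ J y ≡ ∑ J z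
∑-cong [] h = refl
∑-cong (true ∷ J) h = cong₂ _+_ (h zero refl) (∑-cong J (λ i → h (suc i)))
∑-cong (false ∷ J) h = ∑-cong J (λ i → h (suc i))

∑-* : (J : V n) (c : ℚ) (y : Fin n → ℚ) → ∑ J (λ i → c * y i) ≡ c * ∑ J y
∑-* [] c y = sym (*-zeroʳ c)
∑-* (true ∷ J) c y = trans (cong (λ z → c * y zero + z) (∑-* J c (y ∘ suc))) (sym (*-distribˡ-+ c (y zero) (∑ J (y ∘ suc))))
∑-* (false ∷ J) c y = ∑-* J c (y ∘ suc)

0≤∑ : (J : V n) {y : Fin n → ℚ} → (∀ i → 0ℚ ≤ y i) → 0ℚ ≤ ∑ J y
0≤∑ [] h = ≤-refl
0≤∑ (true ∷ J) h = 0≤+ (h zero) (0≤∑ J (h ∘ suc))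
0≤∑ (false ∷ J) h = 0≤∑ J (h ∘ suc)

W-∑ : ∀ {m} (J : V n) (μ : Vec Mode m) (φ : Fin n → V m → ℚ) → W μ (λ v → ∑ J (λ i → φ i v)) ≡ ∑ J (λ i → W μ (φ i))
W-∑ [] μ φ = W-0 μ
W-∑ (true ∷ J) μ φ = trans (W-+ μ (φ zero) (λ v → ∑ J (λ i → φ (suc i) v))) (cong (λ z → W μ (φ zero) + z) (W-∑ J μ (φ ∘ suc)))
W-∑ (false ∷ J) μ φ = W-∑ J μ (φ ∘ suc)

∑-card : (J w : V n) → ∑ J (λ i → ι (card (oh i ∩ w))) ≡ ι (card (J ∩ w))
∑-card [] [] = refl
∑-card (true ∷ J) (true ∷ w) = trans (cong₂ (λ k z → ι (suc k) + z) (card-empty w) (∑-card J w)) (sym (ι-+ 1 (card (J ∩ w))))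
∑-card (true ∷ J) (false ∷ w) = trans (cong₂ (λ k z → ι k + z) (card-empty w) (∑-card J w)) (+-identityˡ _)
∑-card (false ∷ J) (_ ∷ w) = ∑-card J w

∑-infl : (J : V n) (f : V n → ℚ) → ∑ J (λ i → infl (oh i) f) ≡ infl J f
∑-infl {n} J f = trans (sym (W-∑ J (modes (full n)) (λ i w → ι (card (oh i ∩ w)) * g² w)))
  (W-cong (modes (full n)) (λ w _ → begin
    ∑ J (λ i → ι (card (oh i ∩ w)) * g² w) ≡⟨ ∑-cong J (λ i _ → *-comm (ι (card (oh i ∩ w))) (g² w)) ⟩
    ∑ J (λ i → g² w * ι (card (oh i ∩ w))) ≡⟨ ∑-* J (g² w) (λ i → ι (card (oh i ∩ w))) ⟩
    g² w * ∑ J (λ i → ι (card (oh i ∩ w))) ≡⟨ cong (g² w *_) (∑-card J w) ⟩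
    g² w * ι (card (J ∩ w)) ≡⟨ *-comm (g² w) (ι (card (J ∩ w))) ⟩
    ι (card (J ∩ w)) * g² w ∎))
  where
  open ≡-Reasoning
  g² : V n → ℚ
  g² w = T ½ (full n) f w * T ½ (full n) f w

prodOn : V n → (Fin n → ℚ) → V n → ℚ
prodOn [] z [] = 1ℚ
prodOn (a ∷ J) z (b ∷ w) = (if a ∧ b then z zero else 1ℚ) * prodOn J (z ∘ suc) w

-- The product of the `1 + z i` over `J`, that is, the sum over all subsets of `J` of the
-- corresponding products of the `z i`.
∏ : V n → (Fin n → ℚ) → ℚ
∏ [] z = 1ℚ
∏ (true ∷ J) z = (1ℚ + z zero) * ∏ J (z ∘ suc)
∏ (false ∷ J) z = ∏ J (z ∘ suc)

sum-prodOn : (J : V n) (z : Fin n → ℚ) (w : V n) → sumOn J (prodOn J z) w ≡ ∏ J z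
sum-prodOn [] z [] = refl
sum-prodOn (true ∷ J) z (_ ∷ w) = trans
  (cong₂ (λ x y → 1ℚ * (x + y)) (trans (W-* m 1ℚ p) (cong (1ℚ *_) (sum-prodOn J (z ∘ suc) w)))
                                (trans (W-* m (z zero) p) (cong (z zero *_) (sum-prodOn J (z ∘ suc) w))))
  (solve 2 (λ z p → con 1ℚ :* (con 1ℚ :* p :+ z :* p) := (con 1ℚ :+ z) :* p) refl (z zero) (∏ J (z ∘ suc)))
  where
  m = fib 1ℚ J w
  p = prodOn J (z ∘ suc)
sum-prodOn (false ∷ J) z (_ ∷ w) = trans (W-* (fib 1ℚ J w) 1ℚ (prodOn J (z ∘ suc))) (trans (*-identityˡ _) (sum-prodOn J (z ∘ suc) w))

sum-nz-prodOn : (J : V n) (z : Fin n → ℚ) (w : V n) → sumOn J (λ v → bval (nz (J ∩ v)) * prodOn J z v) w ≡ ∏ J z - 1ℚ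
sum-nz-prodOn [] z [] = refl
sum-nz-prodOn (true ∷ J) z (_ ∷ w) = trans
  (cong₂ (λ x y → 1ℚ * (x + y))
    (trans (W-cong m (λ v _ → cong (bval (nz (J ∩ v)) *_) (*-identityˡ (p v)))) (sum-nz-prodOn J (z ∘ suc) w))
    (trans (W-* m 1ℚ (λ v → z zero * p v)) (cong (1ℚ *_) (trans (W-* m (z zero) p) (cong (z zero *_) (sum-prodOn J (z ∘ suc) w))))))
  (solve 2 (λ z p → con 1ℚ :* ((p :- con 1ℚ) :+ con 1ℚ :* (z :* p)) := (con 1ℚ :+ z) :* p :- con 1ℚ) refl (z zero) (∏ J (z ∘ suc)))
  where
  m = fib 1ℚ J w
  p = prodOn J (z ∘ suc)
sum-nz-prodOn (false ∷ J) z (_ ∷ w) = trans (W-cong (fib 1ℚ J w) (λ v _ → cong (bval (nz (J ∩ v)) *_) (*-identityˡ (prodOn J (z ∘ suc) v)))) (sum-nz-prodOn J (z ∘ suc) w)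

0≤∏ : (J : V n) {z : Fin n → ℚ} → (∀ i → 0ℚ ≤ z i) → 0ℚ ≤ ∏ J z
0≤∏ [] h = 0≤1
0≤∏ (true ∷ J) h = 0≤* (0≤+ 0≤1 (h zero)) (0≤∏ J (h ∘ suc))
0≤∏ (false ∷ J) h = 0≤∏ J (h ∘ suc)

-- A rational substitute for bounding the product by an exponential: `(1 + x)(1 - x - s) ≤ 1 - s`
-- for nonnegative `x` and `s`.
∏[1-∑]≤1 : (J : V n) {z : Fin n → ℚ} → (∀ i → 0ℚ ≤ z i) → ∏ J z * (1ℚ - ∑ J z) ≤ 1ℚ
∏[1-∑]≤1 [] h = ≤-refl
∏[1-∑]≤1 (true ∷ J) {z} h = ≤-trans
  (≤-by (P * (x * (x + s))) (0≤* (0≤∏ J (h ∘ suc)) (0≤* (h zero) (0≤+ (h zero) (0≤∑ J (h ∘ suc)))))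
    (solve 3 (λ p x s → p :* (con 1ℚ :- s) := (con 1ℚ :+ x) :* p :* (con 1ℚ :- (x :+ s)) :+ p :* (x :* (x :+ s))) refl P x s))
  (∏[1-∑]≤1 J (h ∘ suc))
  where
  x = z zero
  P = ∏ J (z ∘ suc)
  s = ∑ J (z ∘ suc)
∏[1-∑]≤1 (false ∷ J) h = ∏[1-∑]≤1 J (h ∘ suc)

-- Combines the previous bound with `1 / (1 - s) ≤ 1 + 2 s` for `s ≤ ½`.
∏-1≤2∑ : (J : V n) {z : Fin n → ℚ} → (∀ i → 0ℚ ≤ z i) → ∑ J z ≤ ½ → ∏ J z - 1ℚ ≤ 2ℚ * ∑ J z
∏-1≤2∑ J {z} h s≤½ = subst (P - 1ℚ ≤_) (solve 1 (λ s → con 1ℚ :+ con 2ℚ :* s :- con 1ℚ := con 2ℚ :* s) refl s)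
  (+-monoˡ-≤ (- 1ℚ) P≤)
  where
  P = ∏ J z
  s = ∑ J z
  0<1-s : 0ℚ < 1ℚ - s
  0<1-s = <-≤-trans {0ℚ} {½} (*<* (ℤ.+<+ (ℕ.s≤s ℕ.z≤n)))
    (≤-by (½ - s) (x≤y⇒0≤y-x s≤½) (solve 1 (λ s → con 1ℚ :- s := con ½ :+ (con ½ :- s)) refl s))
  P≤ : P ≤ 1ℚ + 2ℚ * s
  P≤ = *-cancelˡ-≤ (1ℚ - s) 0<1-s (≤-trans (≤-reflexive (*-comm (1ℚ - s) P)) (≤-trans (∏[1-∑]≤1 J h)
    (≤-by (2ℚ * (s * (½ - s))) (0≤* 0≤2 (0≤* (0≤∑ J h) (x≤y⇒0≤y-x s≤½)))
      (solve 1 (λ s → (con 1ℚ :- s) :* (con 1ℚ :+ con 2ℚ :* s) := con 1ℚ :+ con 2ℚ :* (s :* (con ½ :- s))) refl s))))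

prodOn-scale : (J : V n) (c : ℚ) (z : Fin n → ℚ) (w : V n) → prodOn J (λ i → c * z i) w ≡ powℚ c (card (J ∩ w)) * prodOn J z w
prodOn-scale [] c z [] = refl
prodOn-scale (true ∷ J) c z (true ∷ w) = trans (cong (c * z zero *_) (prodOn-scale J c (z ∘ suc) w))
  (solve 4 (λ c z p q → c :* z :* (p :* q) := c :* p :* (z :* q)) refl c (z zero) (powℚ c (card (J ∩ w))) (prodOn J (z ∘ suc) w))
prodOn-scale (true ∷ J) c z (false ∷ w) = trans (cong (1ℚ *_) (prodOn-scale J c (z ∘ suc) w))
  (solve 2 (λ p q → con 1ℚ :* (p :* q) := p :* (con 1ℚ :* q)) refl (powℚ c (card (J ∩ w))) (prodOn J (z ∘ suc) w))
prodOn-scale (false ∷ J) c z (_ ∷ w) = trans (cong (1ℚ *_) (prodOn-scale J c (z ∘ suc) w))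
  (solve 2 (λ p q → con 1ℚ :* (p :* q) := p :* (con 1ℚ :* q)) refl (powℚ c (card (J ∩ w))) (prodOn J (z ∘ suc) w))

1≤prodOn : (J : V n) (z : Fin n → ℚ) (w : V n) → (∀ i → lookup J i ≡ true → lookup w i ≡ true → 1ℚ ≤ z i) → 1ℚ ≤ prodOn J z w
1≤prodOn [] z [] h = ≤-refl
1≤prodOn (true ∷ J) z (true ∷ w) h = *-mono-≤ {1ℚ} {z zero} {1ℚ} 0≤1 (≤-trans 0≤1 ih) (h zero refl refl) ih
  where ih = 1≤prodOn J (z ∘ suc) w (λ i → h (suc i))
1≤prodOn (true ∷ J) z (false ∷ w) h = subst (1ℚ ≤_) (sym (*-identityˡ _)) (1≤prodOn J (z ∘ suc) w (λ i → h (suc i)))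
1≤prodOn (false ∷ J) z (_ ∷ w) h = subst (1ℚ ≤_) (sym (*-identityˡ _)) (1≤prodOn J (z ∘ suc) w (λ i → h (suc i)))

0≤prodOn : (J : V n) (z : Fin n → ℚ) (w : V n) → (∀ i → 0ℚ ≤ z i) → 0ℚ ≤ prodOn J z w
0≤prodOn [] z [] h = 0≤1
0≤prodOn (true ∷ J) z (true ∷ w) h = 0≤* (h zero) (0≤prodOn J (z ∘ suc) w (h ∘ suc))
0≤prodOn (true ∷ J) z (false ∷ w) h = 0≤* 0≤1 (0≤prodOn J (z ∘ suc) w (h ∘ suc))
0≤prodOn (false ∷ J) z (_ ∷ w) h = 0≤* 0≤1 (0≤prodOn J (z ∘ suc) w (h ∘ suc))

none⊎some : (J : V n) (p : Fin n → Bool) → (∀ i → lookup J i ≡ true → p i ≡ false) ⊎ (1ℚ ≤ ∑ J (bval ∘ p))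
none⊎some [] p = inj₁ (λ ())
none⊎some (false ∷ J) p with none⊎some J (p ∘ suc)
... | inj₁ h = inj₁ (λ { zero () ; (suc i) → h i })
... | inj₂ h = inj₂ h
none⊎some (true ∷ J) p with p zero in e
... | true = inj₂ (≤-by (∑ J (bval ∘ p ∘ suc)) (0≤∑ J (λ i → 0≤bval (p (suc i)))) refl)
... | false with none⊎some J (p ∘ suc)
...   | inj₁ h = inj₁ (λ { zero _ → e ; (suc i) → h i })
...   | inj₂ h = inj₂ (subst (1ℚ ≤_) (sym (+-identityˡ _)) h)

Boolean : (V n → ℚ) → Set
Boolean f = ∀ x → f x ≡ 0ℚ ⊎ f x ≡ 1ℚ

Boolean⇒≤1 : {f : V n → ℚ} → Boolean f → ∀ x → f x * f x ≤ 1ℚ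
Boolean⇒≤1 {f = f} b x with f x | b x
... | _ | inj₁ refl = 0≤1
... | _ | inj₂ refl = ≤-refl

derivative : (i : Fin n) (f : V n → ℚ) → Boolean f → ∀ w → nz (oh i ∩ w) ≡ true →
  T ½ (oh i) f w * T ½ (oh i) f w ≡ 0ℚ ⊎ 4ℚ * (T ½ (oh i) f w * T ½ (oh i) f w) ≡ 1ℚ
derivative {suc n} zero f b (true ∷ w) e rewrite T-empty ½ (f ⁰) w | T-empty ½ (f ¹) w
  with f (false ∷ w) | f (true ∷ w) | b (false ∷ w) | b (true ∷ w)
... | _ | _ | inj₁ refl | inj₁ refl = inj₁ refl
... | _ | _ | inj₁ refl | inj₂ refl = inj₂ refl
... | _ | _ | inj₂ refl | inj₁ refl = inj₂ refl
... | _ | _ | inj₂ refl | inj₂ refl = inj₁ refl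
derivative {suc n} zero f b (false ∷ w) e = ⊥-elim (case trans (sym (nz-empty w)) e of λ ())
derivative (suc i) f b (x ∷ w) e = derivative i (f ∘ (x ∷_)) (b ∘ (x ∷_)) w e

-- The square of a derivative is 0 or 1/4; lying strictly below 1/4 it must be 0 and carries no
-- weight. So single coordinates start with the constant threshold 4 and no error.
badMass-oh : (i : Fin n) (f : V n → ℚ) → Boolean f → badMass (oh i) (λ _ → 4ℚ) f ≡ 0ℚ
badMass-oh i f b = trans (W-cong (modes (oh i)) (λ w _ → pt w)) (W-0 (modes (oh i)))
  where
  pt : ∀ w → bval (isBad (oh i) (λ _ → 4ℚ) f w) * (T ½ (oh i) f w * T ½ (oh i) f w) ≡ 0ℚ
  pt w with isBad (oh i) (λ _ → 4ℚ) f w in e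
  ... | false = *-zeroˡ (T ½ (oh i) f w * T ½ (oh i) f w)
  ... | true with derivative i f b w (proj₁ (∧-true e))
  ...   | inj₁ z = trans (*-identityˡ _) z
  ...   | inj₂ z = ⊥-elim (<-irrefl z (lt1-true _ (proj₂ (∧-true {nz (oh i ∩ w)} e))))

self≤sumOn : (B : V n) (φ : V n → ℚ) (w : V n) → (∀ v → 0ℚ ≤ φ v) → φ w ≤ sumOn B φ w
self≤sumOn [] φ [] h = ≤-refl
self≤sumOn (true ∷ B) φ (false ∷ w) h = ≤-trans (self≤sumOn B (φ ⁰) w (h ∘ (false ∷_)))
  (≤-by (sumOn B (φ ¹) w) (W-0≤ (fib-NN 0≤1 B w) (λ v _ → h _)) (*-identityˡ _))
self≤sumOn (true ∷ B) φ (true ∷ w) h = ≤-trans (self≤sumOn B (φ ¹) w (h ∘ (true ∷_)))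
  (≤-by (sumOn B (φ ⁰) w) (W-0≤ (fib-NN 0≤1 B w) (λ v _ → h _)) (trans (*-identityˡ _) (+-comm (sumOn B (φ ⁰) w) (sumOn B (φ ¹) w))))
self≤sumOn (false ∷ B) φ (b ∷ w) h = self≤sumOn B (φ ∘ (b ∷_)) w (h ∘ (b ∷_))

-- One factor per element of `U`: 4 is the threshold of a single coordinate, `L² 9^|U|` makes an
-- element low or its weight large, and the remaining `L` makes the sum over all `U` of the
-- resulting products small.
leafBound : ℚ → V n → ℚ
leafBound L U = powℚ (L * (4ℚ * (L * L) * powℚ 9ℚ (card U))) (card U)

module Leaf (J : V n) (f : V n → ℚ) (bool : Boolean f) (L : ℚ) (1≤L : 1ℚ ≤ L) where

  private
    0≤L = ≤-trans 0≤1 1≤L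
    0<L = <-≤-trans 0<1 1≤L

    ε : ℚ
    ε = proj₁ (reciprocal 0<L)

    0≤ε : 0ℚ ≤ ε
    0≤ε = proj₁ (proj₂ (reciprocal 0<L))

    Lε≡1 : L * ε ≡ 1ℚ
    Lε≡1 = proj₂ (proj₂ (reciprocal 0<L))

    g g² : V n → ℚ
    g = T ½ J f
    g² v = g v * g v

    0≤g² : ∀ v → 0ℚ ≤ g² v
    0≤g² v = 0≤x² (g v)

    hit : Fin n → V n → ℚ
    hit i v = bval (nz (oh i ∩ v)) * g² v

    0≤hit : ∀ i v → 0ℚ ≤ hit i v
    0≤hit i v = 0≤* (0≤bval (nz (oh i ∩ v))) (0≤g² v)

    -- The sum runs over all frequencies on `J`, with an indicator for those containing `i`, instead
    -- of over `del i J`: this makes `y i` constant on the fibres of `J`, a function of the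
    -- restriction alone.
    y : Fin n → V n → ℚ
    y i = sumOn J (hit i)

    0≤y : ∀ i w → 0ℚ ≤ y i w
    0≤y i w = W-0≤ (fib-NN 0≤1 J w) (λ v _ → 0≤hit i v)

    low : Fin n → V n → Bool
    low i = isLow (oh i) (del i J) L (y i) (λ _ → 4ℚ)

    y≥ : ∀ i → lookup J i ≡ true → ∀ w → nz (oh i ∩ w) ≡ true → sumOn (del i J) g² w ≤ y i w
    y≥ i i∈J w e = begin
      sumOn (del i J) g² w ≡⟨ W-cong (fib 1ℚ (del i J) w) (λ v o → sym (trans
          (cong (λ b → bval b * g² v) (trans (cong nz (∩-Off σ (fib-Off (del i J) w o))) e)) (*-identityˡ (g² v)))) ⟩
      sumOn (del i J) (hit i) w ≤⟨ self≤sumOn (oh i) (sumOn (del i J) (hit i)) w (λ v → W-0≤ (fib-NN 0≤1 (del i J) v) (λ u _ → 0≤hit i u)) ⟩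
      sumOn (oh i) (sumOn (del i J) (hit i)) w ≡⟨ sumOn-split σ (hit i) w ⟨
      y i w ∎
      where
      open ≤-Reasoning
      σ = Split-oh i J i∈J

    low≤ : ∀ i → lookup J i ≡ true → L * S J (λ w → bval (low i w) * g² w) ≤ 2ℚ * mass (oh i) f
    low≤ i i∈J = ≤-trans
      (lowMass σ f (λ _ → 4ℚ) (y i) L 0≤L (λ _ → 0≤4) (y≥ i i∈J) (λ w v o → sumOn-inv J (hit i) w v (Off-sub σ o)))
      (≤-reflexive (trans (cong (λ z → 2ℚ * (L * z) + 2ℚ * mass (oh i) f) (badMass-oh i f bool))
        (solve 2 (λ l m → con 2ℚ :* (l :* con 0ℚ) :+ con 2ℚ :* m := con 2ℚ :* m) refl L (mass (oh i) f))))
      where σ = Split-oh i J i∈J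

    S-y : ∀ i → lookup J i ≡ true → S (empty n) (y i) ≡ mass (oh i) f
    S-y i i∈J = trans (sym (S-sumOn (Split-empty J) (hit i))) (mass-split (Split-oh i J i∈J) f)

    bad : V n → Bool
    bad = isBad J (leafBound L) f

    lows : V n → ℚ
    lows v = ∑ J (λ i → bval (low i v)) * g² v

    0≤lows : ∀ v → 0ℚ ≤ lows v
    0≤lows v = 0≤* (0≤∑ J (λ i → 0≤bval (low i v))) (0≤g² v)

    module _ (w : V n) where

      z : Fin n → ℚ
      z i = ε * y i w

      0≤z : ∀ i → 0ℚ ≤ z i
      0≤z i = 0≤* 0≤ε (0≤y i w)

      -- As no element is low, each `i` in `U` satisfies `X * y i ≥ 1`, that is, `L * X * z i ≥ 1`
      -- since `z i = y i / L`. Multiplying over `U` and comparing with the badness of `U` cancels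
      -- the powers of `L * X`.
      high⇒small : ∀ v → Off J w v → bad v ≡ true → (∀ i → lookup J i ≡ true → low i v ≡ false) → g² v ≤ prodOn J z v
      high⇒small v o eb none = *-cancelˡ-≤ (powℚ (L * X) s) (<-≤-trans 0<1 (1≤pow 1≤LX s)) (begin
        powℚ (L * X) s * g² v ≤⟨ <⇒≤ (lt1-true _ (proj₂ (∧-true {nz (J ∩ v)} eb))) ⟩
        1ℚ ≤⟨ 1≤prodOn J (λ i → (L * X) * z i) v each ⟩
        prodOn J (λ i → (L * X) * z i) v ≡⟨ prodOn-scale J (L * X) z v ⟩
        powℚ (L * X) s * prodOn J z v ∎)
        where
        open ≤-Reasoning
        s = card (J ∩ v)
        X = 4ℚ * (L * L) * powℚ 9ℚ s
        1≤X : 1ℚ ≤ X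
        1≤X = *-mono-≤ {1ℚ} {4ℚ * (L * L)} {1ℚ} 0≤1 (≤-trans 0≤1 (1≤pow 1≤9 s))
          (*-mono-≤ {1ℚ} {4ℚ} {1ℚ} 0≤1 (0≤x² L) (*≤* (ℤ.+≤+ (ℕ.s≤s ℕ.z≤n))) (*-mono-≤ {1ℚ} {L} {1ℚ} 0≤1 0≤L 1≤L 1≤L)) (1≤pow 1≤9 s)
        1≤LX : 1ℚ ≤ L * X
        1≤LX = *-mono-≤ {1ℚ} {L} {1ℚ} 0≤1 (≤-trans 0≤1 1≤X) 1≤L 1≤X
        each : ∀ i → lookup J i ≡ true → lookup v i ≡ true → 1ℚ ≤ (L * X) * z i
        each i i∈J i∈v = begin
          1ℚ ≤⟨ <⇒≤ (le1-false _ (subst (λ b → b ∧ le1 (powℚ 9ℚ k * (L * L * y i v * 4ℚ)) ≡ false) (lookup⇒nz i v i∈v) (none i i∈J))) ⟩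
          powℚ 9ℚ k * (L * L * y i v * 4ℚ) ≤⟨ *-monoʳ-≤ (L * L * y i v * 4ℚ) (0≤* (0≤* (0≤x² L) (0≤y i v)) 0≤4) (pow-monoʳ 1≤9 k≤s) ⟩
          powℚ 9ℚ s * (L * L * y i v * 4ℚ) ≡⟨ cong (λ t → powℚ 9ℚ s * (L * L * t * 4ℚ)) (trans (sumOn-inv J (hit i) w v o) (sym (*-identityˡ (y i w)))) ⟩
          powℚ 9ℚ s * (L * L * (1ℚ * y i w) * 4ℚ) ≡⟨ cong (λ t → powℚ 9ℚ s * (L * L * (t * y i w) * 4ℚ)) Lε≡1 ⟨
          powℚ 9ℚ s * (L * L * ((L * ε) * y i w) * 4ℚ)
            ≡⟨ solve 4 (λ p l e y → p :* (l :* l :* ((l :* e) :* y) :* con 4ℚ) := (l :* (con 4ℚ :* (l :* l) :* p)) :* (e :* y)) refl (powℚ 9ℚ s) L ε (y i w) ⟩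
          (L * X) * z i ∎
          where
          k = card (del i J ∩ v)
          k≤s : k ℕ.≤ s
          k≤s = subst (k ℕ.≤_) (sym (card-split (Split-oh i J i∈J) v)) (ℕₚ.m≤n+m k (card (oh i ∩ v)))

      pointwise : ∀ v → Off J w v → bval (bad v) * g² v ≤ lows v + bval (nz (J ∩ v)) * prodOn J z v
      pointwise v o = go (bad v) refl (none⊎some J (λ i → low i v))
        where
        0≤P = 0≤prodOn J z v 0≤z
        go : ∀ b → bad v ≡ b → (∀ i → lookup J i ≡ true → low i v ≡ false) ⊎ (1ℚ ≤ ∑ J (λ i → bval (low i v))) →
          bval b * g² v ≤ lows v + bval (nz (J ∩ v)) * prodOn J z v
        go false e _ = subst (_≤ lows v + bval (nz (J ∩ v)) * prodOn J z v) (sym (*-zeroˡ (g² v)))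
          (0≤+ (0≤lows v) (0≤* (0≤bval (nz (J ∩ v))) 0≤P))
        go true e (inj₂ some) = ≤-trans (*-monoʳ-≤ (g² v) (0≤g² v) some)
          (≤-by (bval (nz (J ∩ v)) * prodOn J z v) (0≤* (0≤bval (nz (J ∩ v))) 0≤P) refl)
        go true e (inj₁ none) = begin
          1ℚ * g² v ≡⟨ *-identityˡ (g² v) ⟩
          g² v ≤⟨ high⇒small v o e none ⟩
          prodOn J z v ≤⟨ ≤-by (lows v) (0≤lows v) (+-comm (lows v) (prodOn J z v)) ⟩
          lows v + prodOn J z v ≡⟨ cong (λ t → lows v + t) (*-identityˡ (prodOn J z v)) ⟨
          lows v + 1ℚ * prodOn J z v ≡⟨ cong (λ b → lows v + bval b * prodOn J z v) (proj₁ (∧-true {nz (J ∩ v)} e)) ⟨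
          lows v + bval (nz (J ∩ v)) * prodOn J z v ∎
          where open ≤-Reasoning

      -- Frequencies with a low element are covered by `lows` (a union bound), the others by
      -- products of the `z i` over nonempty sets. These products sum to at most `2 ∑ z` if
      -- `∑ z ≤ ½`; otherwise `2 ∑ z` exceeds 1, which bounds the whole weight.
      fibre : sumOn J (λ v → bval (bad v) * g² v) w ≤ sumOn J lows w + 2ℚ * ∑ J z
      fibre with ∑ J z ≤? ½
      ... | yes s≤½ = begin
        sumOn J (λ v → bval (bad v) * g² v) w ≤⟨ W-mono (fib-NN 0≤1 J w) (λ v o → pointwise v (fib-Off J w o)) ⟩
        sumOn J (λ v → lows v + bval (nz (J ∩ v)) * prodOn J z v) w ≡⟨ W-+ (fib 1ℚ J w) lows (λ v → bval (nz (J ∩ v)) * prodOn J z v) ⟩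
        sumOn J lows w + sumOn J (λ v → bval (nz (J ∩ v)) * prodOn J z v) w ≡⟨ cong (λ t → sumOn J lows w + t) (sum-nz-prodOn J z w) ⟩
        sumOn J lows w + (∏ J z - 1ℚ) ≤⟨ +-monoʳ-≤ (sumOn J lows w) (∏-1≤2∑ J 0≤z s≤½) ⟩
        sumOn J lows w + 2ℚ * ∑ J z ∎
        where open ≤-Reasoning
      ... | no s≰½ = begin
        sumOn J (λ v → bval (bad v) * g² v) w ≤⟨ W-mono (fib-NN 0≤1 J w) (λ v _ → bval-≤ (bad v) (0≤g² v)) ⟩
        sumOn J g² w ≤⟨ Merge.total≤1 (Split-empty J) f (Boolean⇒≤1 bool) w ⟩
        2ℚ * ½ ≤⟨ *-monoˡ-≤ 2ℚ 0≤2 (<⇒≤ (≰⇒> s≰½)) ⟩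
        2ℚ * ∑ J z ≤⟨ ≤-by (sumOn J lows w) (W-0≤ (fib-NN 0≤1 J w) (λ v _ → 0≤lows v)) (+-comm (sumOn J lows w) (2ℚ * ∑ J z)) ⟩
        sumOn J lows w + 2ℚ * ∑ J z ∎
        where open ≤-Reasoning

    S-lows : L * S J lows ≤ 2ℚ * ∑ J (λ i → mass (oh i) f)
    S-lows = begin
      L * S J lows ≡⟨ cong (L *_) (trans (W-cong (modes J) (λ v _ → eq v)) (W-∑ J (modes J) (λ i v → bval (low i v) * g² v))) ⟩
      L * ∑ J (λ i → S J (λ v → bval (low i v) * g² v)) ≡⟨ ∑-* J L (λ i → S J (λ v → bval (low i v) * g² v)) ⟨
      ∑ J (λ i → L * S J (λ v → bval (low i v) * g² v)) ≤⟨ ∑-mono J low≤ ⟩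
      ∑ J (λ i → 2ℚ * mass (oh i) f) ≡⟨ ∑-* J 2ℚ (λ i → mass (oh i) f) ⟩
      2ℚ * ∑ J (λ i → mass (oh i) f) ∎
      where
      open ≤-Reasoning
      eq : ∀ v → lows v ≡ ∑ J (λ i → bval (low i v) * g² v)
      eq v = trans (*-comm (∑ J (λ i → bval (low i v))) (g² v)) (trans (sym (∑-* J (g² v) (λ i → bval (low i v))))
        (∑-cong J (λ i _ → *-comm (g² v) (bval (low i v)))))

    S-z : L * S (empty n) (λ w → ∑ J (z w)) ≡ ∑ J (λ i → mass (oh i) f)
    S-z = trans (sym (W-* (modes (empty n)) L (λ w → ∑ J (z w)))) (trans
      (W-cong (modes (empty n)) (λ w _ → trans (sym (∑-* J L (z w))) (∑-cong J (λ i _ →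
        trans (sym (*-assoc L ε (y i w))) (trans (cong (_* y i w) Lε≡1) (*-identityˡ (y i w)))))))
      (trans (W-∑ J (modes (empty n)) y) (∑-cong J S-y)))

  -- The low elements and the products each contribute `2 ∑ mass` over the singletons of `J`, and
  -- singleton influences add up to `infl J f`.
  badMass-leaf : L * badMass J (leafBound L) f ≤ 4ℚ * infl J f
  badMass-leaf = begin
    L * badMass J (leafBound L) f ≡⟨ cong (L *_) (S-sumOn (Split-empty J) (λ v → bval (bad v) * g² v)) ⟩
    L * S (empty n) (sumOn J (λ v → bval (bad v) * g² v)) ≤⟨ *-monoˡ-≤ L 0≤L (W-mono (modes-NN (empty n)) (λ w _ → fibre w)) ⟩
    L * S (empty n) (λ w → sumOn J lows w + 2ℚ * ∑ J (z w))
      ≡⟨ cong (L *_) (trans (W-+ (modes (empty n)) (sumOn J lows) (λ w → 2ℚ * ∑ J (z w)))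
           (cong₂ _+_ (sym (S-sumOn (Split-empty J) lows)) (W-* (modes (empty n)) 2ℚ (λ w → ∑ J (z w))))) ⟩
    L * (S J lows + 2ℚ * Z) ≡⟨ solve 3 (λ l s z → l :* (s :+ con 2ℚ :* z) := l :* s :+ con 2ℚ :* (l :* z)) refl L (S J lows) Z ⟩
    L * S J lows + 2ℚ * (L * Z) ≤⟨ +-mono-≤ S-lows (≤-reflexive (cong (2ℚ *_) S-z)) ⟩
    2ℚ * M + 2ℚ * M ≡⟨ solve 1 (λ m → con 2ℚ :* m :+ con 2ℚ :* m := con 4ℚ :* m) refl M ⟩
    4ℚ * M ≤⟨ *-monoˡ-≤ 4ℚ 0≤4 (∑-mono J (λ i _ → mass≤infl (oh i) f)) ⟩
    4ℚ * ∑ J (λ i → infl (oh i) f) ≡⟨ cong (4ℚ *_) (∑-infl J f) ⟩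
    4ℚ * infl J f ∎
    where
    open ≤-Reasoning
    Z = S (empty n) (λ w → ∑ J (z w))
    M = ∑ J (λ i → mass (oh i) f)

-- The tree of random splittings

∩-assoc : (A B C : V n) → (A ∩ B) ∩ C ≡ A ∩ (B ∩ C)
∩-assoc [] [] [] = refl
∩-assoc (true ∷ A) (_ ∷ B) (_ ∷ C) = cong (_ ∷_) (∩-assoc A B C)
∩-assoc (false ∷ A) (_ ∷ B) (_ ∷ C) = cong (_ ∷_) (∩-assoc A B C)

full-∩ : (A : V n) → full n ∩ A ≡ A
full-∩ [] = refl
full-∩ (_ ∷ A) = cong (_ ∷_) (full-∩ A)

Split-mask : (b A : V n) → Split A (b ∩ A) (∁ b ∩ A)
Split-mask [] [] = []
Split-mask (true ∷ b) (true ∷ A) = l∷ Split-mask b A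
Split-mask (true ∷ b) (false ∷ A) = o∷ Split-mask b A
Split-mask (false ∷ b) (true ∷ A) = r∷ Split-mask b A
Split-mask (false ∷ b) (false ∷ A) = o∷ Split-mask b A

card-mask : (b U : V n) → card U ≡ card (b ∩ U) ℕ.+ card (∁ b ∩ U)
card-mask {n} b U = trans (cong card (sym (full-∩ U))) (card-split (Split-∁ b) U)

-- The threshold obtained by merging along the binary tree that splits [n] successively by the masks bs.
treeBound : ℚ → Vec (V n) ℓ → V n → ℚ
treeBound L [] U = leafBound L U
treeBound L (b ∷ bs) U =
  L * (powℚ 9ℚ (card (∁ b ∩ U)) * (L * L * treeBound L bs (b ∩ U))) *
      (powℚ 9ℚ (card (b ∩ U)) * (L * L * treeBound L bs (∁ b ∩ U)))

1≤treeBound : ∀ {L} → 1ℚ ≤ L → (bs : Vec (V n) ℓ) (U : V n) → 1ℚ ≤ treeBound L bs U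
1≤treeBound 1≤L [] U = 1≤pow (1≤* 1≤L (1≤* (1≤* {4ℚ} (*≤* (ℤ.+≤+ (ℕ.s≤s ℕ.z≤n))) (1≤* 1≤L 1≤L)) (1≤pow 1≤9 (card U)))) (card U)
1≤treeBound 1≤L (b ∷ bs) U = 1≤* (1≤* 1≤L (1≤* (1≤pow 1≤9 (card (∁ b ∩ U))) (1≤* (1≤* 1≤L 1≤L) (1≤treeBound 1≤L bs (b ∩ U)))))
  (1≤* (1≤pow 1≤9 (card (b ∩ U))) (1≤* (1≤* 1≤L 1≤L) (1≤treeBound 1≤L bs (∁ b ∩ U))))

-- A merge doubles the errors of both parts and adds `4 * infl`; a leaf starts with 4.
lossFactor : ℕ → ℚ
lossFactor zero = 4ℚ
lossFactor (suc ℓ) = 2ℚ * lossFactor ℓ + 4ℚ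

lossFactor+4 : ∀ ℓ → lossFactor ℓ + 4ℚ ≡ (+ 8 / 1) * powℚ 2ℚ ℓ
lossFactor+4 zero = refl
lossFactor+4 (suc ℓ) = trans (solve 1 (λ c → con 2ℚ :* c :+ con 4ℚ :+ con 4ℚ := con 2ℚ :* (c :+ con 4ℚ)) refl (lossFactor ℓ))
  (trans (cong (2ℚ *_) (lossFactor+4 ℓ)) (solve 1 (λ p → con 2ℚ :* (con (+ 8 / 1) :* p) := con (+ 8 / 1) :* (con 2ℚ :* p)) refl (powℚ 2ℚ ℓ)))

-- All nodes of a level are split by the same mask of the full coordinate set. Hence both halves of
-- `A` use the same `treeBound L bs`, and the threshold depends only on `A ∩ w`, because cutting `A`
-- by `b` and then taking `w` is cutting `A ∩ w` by `b`.
badMass-tree : (f : V n → ℚ) → Boolean f → ∀ {L} → 1ℚ ≤ L → (bs : Vec (V n) ℓ) (A : V n) →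
  L * badMass A (treeBound L bs) f ≤ lossFactor ℓ * infl A f
badMass-tree f bool {L} 1≤L [] A = Leaf.badMass-leaf A f bool L 1≤L
badMass-tree {ℓ = suc ℓ} f bool {L} 1≤L (b ∷ bs) A = begin
  L * badMass A (treeBound L (b ∷ bs)) f
    ≤⟨ Merge.badMass-merge σ f (Boolean⇒≤1 bool) (treeBound L (b ∷ bs)) (treeBound L bs) (treeBound L bs) L 1≤L (1≤treeBound 1≤L bs) (1≤treeBound 1≤L bs) eq ⟩
  2ℚ * (L * badMass (b ∩ A) (treeBound L bs) f) + 2ℚ * (L * badMass (∁ b ∩ A) (treeBound L bs) f) + 4ℚ * infl A f
    ≤⟨ +-monoˡ-≤ (4ℚ * infl A f) (+-mono-≤ (*-monoˡ-≤ 2ℚ 0≤2 (badMass-tree f bool 1≤L bs (b ∩ A))) (*-monoˡ-≤ 2ℚ 0≤2 (badMass-tree f bool 1≤L bs (∁ b ∩ A)))) ⟩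
  2ℚ * (c * I₁) + 2ℚ * (c * I₂) + 4ℚ * infl A f ≡⟨ solve 4 (λ c x y i → con 2ℚ :* (c :* x) :+ con 2ℚ :* (c :* y) :+ con 4ℚ :* i := con 2ℚ :* c :* (x :+ y) :+ con 4ℚ :* i) refl c I₁ I₂ (infl A f) ⟩
  2ℚ * c * (I₁ + I₂) + 4ℚ * infl A f ≡⟨ cong (λ z → 2ℚ * c * z + 4ℚ * infl A f) (infl-split σ f) ⟨
  2ℚ * c * infl A f + 4ℚ * infl A f ≡⟨ *-distribʳ-+ (infl A f) (2ℚ * c) 4ℚ ⟨
  (2ℚ * c + 4ℚ) * infl A f ∎
  where
  open ≤-Reasoning
  σ = Split-mask b A
  c = lossFactor ℓ
  I₁ = infl (b ∩ A) f
  I₂ = infl (∁ b ∩ A) f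
  B≡ = λ w → sym (∩-assoc b A w)
  C≡ = λ w → sym (∩-assoc (∁ b) A w)
  eq : ∀ w → treeBound L (b ∷ bs) (A ∩ w) ≡
    L * (powℚ 9ℚ (card ((∁ b ∩ A) ∩ w)) * (L * L * treeBound L bs ((b ∩ A) ∩ w))) *
        (powℚ 9ℚ (card ((b ∩ A) ∩ w)) * (L * L * treeBound L bs ((∁ b ∩ A) ∩ w)))
  eq w = cong₂ (λ X Y → L * (powℚ 9ℚ (card Y) * (L * L * treeBound L bs X)) * (powℚ 9ℚ (card X) * (L * L * treeBound L bs Y))) (B≡ w) (C≡ w)

-- pairs s = s (s − 1)
pairs : ℕ → ℕ
pairs zero = 0
pairs (suc s) = pairs s ℕ.+ (s ℕ.+ s)

s+pairs≡s² : ∀ s → s ℕ.+ pairs s ≡ s ℕ.* s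
s+pairs≡s² zero = refl
s+pairs≡s² (suc s) = trans (lemma s (pairs s)) (trans (cong (λ z → suc (s ℕ.+ s ℕ.+ z)) (s+pairs≡s² s)) (lemma′ s))
  where
  lemma : ∀ s p → suc s ℕ.+ (p ℕ.+ (s ℕ.+ s)) ≡ suc (s ℕ.+ s ℕ.+ (s ℕ.+ p))
  lemma = solve-∀
  lemma′ : ∀ s → suc (s ℕ.+ s ℕ.+ s ℕ.* s) ≡ suc s ℕ.* suc s
  lemma′ = solve-∀

-- The number of ordered pairs of distinct elements of `U` that no mask separates.
collisions : Vec (V n) ℓ → V n → ℕ
collisions [] U = pairs (card U)
collisions (b ∷ bs) U = collisions bs (b ∩ U) ℕ.+ collisions bs (∁ b ∩ U)

S-1 : ∀ n → S (empty n) (λ _ → 1ℚ) ≡ 1ℚ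
S-1 zero = refl
S-1 (suc n) = cong₂ (λ x y → ½ * (x + y)) (S-1 n) (S-1 n)

S-const : ∀ n c → S (empty n) (λ _ → c) ≡ c
S-const n c = trans (W-cong (modes (empty n)) (λ _ _ → sym (*-identityʳ c)))
  (trans (W-* (modes (empty n)) c (λ _ → 1ℚ)) (trans (cong (c *_) (S-1 n)) (*-identityʳ c)))

-- A uniform mask keeps a given pair together with probability 1/2. In the induction, a new element
-- joins one of two sides with `a` and `c` elements and creates `2 a` or `2 c` pairs, on average
-- `a + c = |U|`.
pairs-mask : (U : V n) → S (empty n) (λ b → ι (pairs (card (b ∩ U))) + ι (pairs (card (∁ b ∩ U)))) ≡ ½ * ι (pairs (card U))
pairs-mask [] = refl
pairs-mask {suc n} (true ∷ U) = begin
  ½ * (S E (λ b → ι (pairs (a b)) + ι (pairs (c b) ℕ.+ (c b ℕ.+ c b))) + S E (λ b → ι (pairs (a b) ℕ.+ (a b ℕ.+ a b)) + ι (pairs (c b))))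
    ≡⟨ W-lin (modes E) ½ (λ b → ι (pairs (a b)) + ι (pairs (c b) ℕ.+ (c b ℕ.+ c b))) (λ b → ι (pairs (a b) ℕ.+ (a b ℕ.+ a b)) + ι (pairs (c b))) ⟩
  S E (λ b → ½ * ((ι (pairs (a b)) + ι (pairs (c b) ℕ.+ (c b ℕ.+ c b))) + (ι (pairs (a b) ℕ.+ (a b ℕ.+ a b)) + ι (pairs (c b)))))
    ≡⟨ W-cong (modes E) (λ b _ → pt b) ⟩
  S E (λ b → (ι (pairs (a b)) + ι (pairs (c b))) + ι s) ≡⟨ W-+ (modes E) (λ b → ι (pairs (a b)) + ι (pairs (c b))) (λ _ → ι s) ⟩
  S E (λ b → ι (pairs (a b)) + ι (pairs (c b))) + S E (λ _ → ι s) ≡⟨ cong₂ _+_ (pairs-mask U) (S-const n (ι s)) ⟩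
  ½ * ι (pairs s) + ι s ≡⟨ solve 2 (λ p s → con ½ :* p :+ s := con ½ :* (p :+ (s :+ s))) refl (ι (pairs s)) (ι s) ⟩
  ½ * (ι (pairs s) + (ι s + ι s)) ≡⟨ cong (½ *_) (trans (cong (λ z → ι (pairs s) + z) (sym (ι-+ s s))) (sym (ι-+ (pairs s) (s ℕ.+ s)))) ⟩
  ½ * ι (pairs s ℕ.+ (s ℕ.+ s)) ∎
  where
  open ≡-Reasoning
  E = empty n
  s = card U
  a c : V n → ℕ
  a b = card (b ∩ U)
  c b = card (∁ b ∩ U)
  ι-step : ∀ k → ι (pairs k ℕ.+ (k ℕ.+ k)) ≡ ι (pairs k) + (ι k + ι k)
  ι-step k = trans (ι-+ (pairs k) (k ℕ.+ k)) (cong (λ z → ι (pairs k) + z) (ι-+ k k))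
  pt : ∀ b → ½ * ((ι (pairs (a b)) + ι (pairs (c b) ℕ.+ (c b ℕ.+ c b))) + (ι (pairs (a b) ℕ.+ (a b ℕ.+ a b)) + ι (pairs (c b)))) ≡ (ι (pairs (a b)) + ι (pairs (c b))) + ι s
  pt b = trans (cong₂ (λ x y → ½ * ((ι (pairs (a b)) + x) + (y + ι (pairs (c b))))) (ι-step (c b)) (ι-step (a b)))
    (trans (solve 4 (λ p q a c → con ½ :* ((p :+ (q :+ (c :+ c))) :+ ((p :+ (a :+ a)) :+ q)) := (p :+ q) :+ (a :+ c)) refl (ι (pairs (a b))) (ι (pairs (c b))) (ι (a b)) (ι (c b)))
      (cong (λ z → (ι (pairs (a b)) + ι (pairs (c b))) + z) (trans (sym (ι-+ (a b) (c b))) (cong ι (sym (card-mask b U))))))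
pairs-mask {suc n} (false ∷ U) = trans (cong₂ (λ x y → ½ * (x + y)) (pairs-mask U) (pairs-mask U))
  (solve 1 (λ p → con ½ :* (con ½ :* p :+ con ½ :* p) := con ½ :* p) refl (ι (pairs (card U))))

𝔼s : ∀ ℓ → (Vec (V n) ℓ → ℚ) → ℚ
𝔼s zero φ = φ []
𝔼s {n} (suc ℓ) φ = S (empty n) (λ b → 𝔼s ℓ (λ bs → φ (b ∷ bs)))

𝔼s-mono : ∀ ℓ {φ ψ : Vec (V n) ℓ → ℚ} → (∀ bs → φ bs ≤ ψ bs) → 𝔼s ℓ φ ≤ 𝔼s ℓ ψ
𝔼s-mono zero h = h []
𝔼s-mono {n} (suc ℓ) h = W-mono (modes-NN (empty n)) (λ b _ → 𝔼s-mono ℓ (λ bs → h (b ∷ bs)))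

𝔼s-cong : ∀ ℓ {φ ψ : Vec (V n) ℓ → ℚ} → (∀ bs → φ bs ≡ ψ bs) → 𝔼s ℓ φ ≡ 𝔼s ℓ ψ
𝔼s-cong zero h = h []
𝔼s-cong {n} (suc ℓ) h = W-cong (modes (empty n)) (λ b _ → 𝔼s-cong ℓ (λ bs → h (b ∷ bs)))

𝔼s-+ : ∀ ℓ (φ ψ : Vec (V n) ℓ → ℚ) → 𝔼s ℓ (λ bs → φ bs + ψ bs) ≡ 𝔼s ℓ φ + 𝔼s ℓ ψ
𝔼s-+ zero φ ψ = refl
𝔼s-+ {n} (suc ℓ) φ ψ = trans (W-cong (modes (empty n)) (λ b _ → 𝔼s-+ ℓ (λ bs → φ (b ∷ bs)) (λ bs → ψ (b ∷ bs))))
  (W-+ (modes (empty n)) (λ b → 𝔼s ℓ (λ bs → φ (b ∷ bs))) (λ b → 𝔼s ℓ (λ bs → ψ (b ∷ bs))))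

𝔼s-* : ∀ ℓ c (φ : Vec (V n) ℓ → ℚ) → 𝔼s ℓ (λ bs → c * φ bs) ≡ c * 𝔼s ℓ φ
𝔼s-* zero c φ = refl
𝔼s-* {n} (suc ℓ) c φ = trans (W-cong (modes (empty n)) (λ b _ → 𝔼s-* ℓ c (λ bs → φ (b ∷ bs))))
  (W-* (modes (empty n)) c (λ b → 𝔼s ℓ (λ bs → φ (b ∷ bs))))

𝔼s-const : ∀ ℓ c → 𝔼s {n} ℓ (λ _ → c) ≡ c
𝔼s-const zero c = refl
𝔼s-const {n} (suc ℓ) c = trans (W-cong (modes (empty n)) (λ _ _ → 𝔼s-const ℓ c)) (S-const n c)

W-swap : ∀ {k} (m : Vec Mode n) (μ : Vec Mode k) (φ : V n → V k → ℚ) →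
  W m (λ v → W μ (φ v)) ≡ W μ (λ u → W m (λ v → φ v u))
W-swap [] μ φ = refl
W-swap (fx b ∷ m) μ φ = W-swap m μ (λ v → φ (b ∷ v))
W-swap (sc p ∷ m) μ φ = trans (cong₂ (λ x y → p * (x + y)) (W-swap m μ (λ v → φ (false ∷ v))) (W-swap m μ (λ v → φ (true ∷ v))))
  (W-lin μ p (λ u → W m (λ v → φ (false ∷ v) u)) (λ u → W m (λ v → φ (true ∷ v) u)))

𝔼s-swap : ∀ ℓ (m : Vec Mode n) (φ : V n → Vec (V n) ℓ → ℚ) → W m (λ v → 𝔼s ℓ (φ v)) ≡ 𝔼s ℓ (λ bs → W m (λ v → φ v bs))
𝔼s-swap zero m φ = refl
𝔼s-swap {n} (suc ℓ) m φ = trans (W-swap m (modes (empty n)) (λ v b → 𝔼s ℓ (λ bs → φ v (b ∷ bs))))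
  (W-cong (modes (empty n)) (λ b _ → 𝔼s-swap ℓ m (λ v bs → φ v (b ∷ bs))))

𝔼-collisions : ∀ ℓ (U : V n) → 𝔼s ℓ (λ bs → ι (collisions bs U)) ≡ powℚ ½ ℓ * ι (pairs (card U))
𝔼-collisions zero U = sym (*-identityˡ _)
𝔼-collisions {n} (suc ℓ) U = begin
  S E (λ b → 𝔼s ℓ (λ bs → ι (collisions bs (b ∩ U) ℕ.+ collisions bs (∁ b ∩ U)))) ≡⟨ W-cong (modes E) (λ b _ → pt b) ⟩
  S E (λ b → powℚ ½ ℓ * (ι (pairs (card (b ∩ U))) + ι (pairs (card (∁ b ∩ U))))) ≡⟨ W-* (modes E) (powℚ ½ ℓ) (λ b → ι (pairs (card (b ∩ U))) + ι (pairs (card (∁ b ∩ U)))) ⟩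
  powℚ ½ ℓ * S E (λ b → ι (pairs (card (b ∩ U))) + ι (pairs (card (∁ b ∩ U)))) ≡⟨ cong (powℚ ½ ℓ *_) (pairs-mask U) ⟩
  powℚ ½ ℓ * (½ * ι (pairs (card U))) ≡⟨ solve 3 (λ p h x → p :* (h :* x) := h :* p :* x) refl (powℚ ½ ℓ) ½ (ι (pairs (card U))) ⟩
  ½ * powℚ ½ ℓ * ι (pairs (card U)) ∎
  where
  open ≡-Reasoning
  E = empty n
  pt : ∀ b → 𝔼s ℓ (λ bs → ι (collisions bs (b ∩ U) ℕ.+ collisions bs (∁ b ∩ U))) ≡ powℚ ½ ℓ * (ι (pairs (card (b ∩ U))) + ι (pairs (card (∁ b ∩ U))))
  pt b = trans (𝔼s-cong ℓ (λ bs → ι-+ (collisions bs (b ∩ U)) (collisions bs (∁ b ∩ U))))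
    (trans (𝔼s-+ ℓ (λ bs → ι (collisions bs (b ∩ U))) (λ bs → ι (collisions bs (∁ b ∩ U))))
    (trans (cong₂ _+_ (𝔼-collisions ℓ (b ∩ U)) (𝔼-collisions ℓ (∁ b ∩ U))) (sym (*-distribˡ-+ (powℚ ½ ℓ) _ _))))

pow-½-2 : ∀ ℓ → powℚ ½ ℓ * ι (2 ℕ.^ ℓ) ≡ 1ℚ
pow-½-2 zero = refl
pow-½-2 (suc ℓ) = trans (cong (½ * powℚ ½ ℓ *_) (ι-* 2 (2 ℕ.^ ℓ)))
  (trans (solve 2 (λ p q → con ½ :* p :* (con (ι 2) :* q) := p :* q) refl (powℚ ½ ℓ) (ι (2 ℕ.^ ℓ))) (pow-½-2 ℓ))

-- Markov's inequality over the random masks: each U has few collisions for at least half of them.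
lowDegree : (f : V n → ℚ) → Boolean f → ∀ {L} → 1ℚ ≤ L → ∀ d ℓ → 0 ℕ.< d → d ℕ.≤ 2 ℕ.^ ℓ → (small : V n → Bool) →
  (∀ U → small U ≡ true → nz U ≡ true × card U ℕ.≤ d ×
    (∀ (bs : Vec (V n) ℓ) → collisions bs U ℕ.≤ d ℕ.+ d → treeBound L bs U * (T ½ (full n) f U * T ½ (full n) f U) < 1ℚ)) →
  L * S (full n) (λ U → bval (small U) * (T ½ (full n) f U * T ½ (full n) f U)) ≤ 2ℚ * (lossFactor ℓ * infl (full n) f)
lowDegree {n} f bool {L} 1≤L d ℓ 0<d d≤2^ℓ small small⇒ = begin
  L * S F (λ U → bval (small U) * f̂² U) ≤⟨ *-monoˡ-≤ L 0≤L (W-mono (modes-NN F) (λ U _ → pt U (small U) refl)) ⟩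
  L * S F (λ U → 2ℚ * 𝔼s ℓ (λ bs → bval (bad bs U) * f̂² U)) ≡⟨ cong (L *_) (trans (W-* (modes F) 2ℚ (λ U → 𝔼s ℓ (λ bs → bval (bad bs U) * f̂² U)))
      (cong (2ℚ *_) (𝔼s-swap ℓ (modes F) (λ U bs → bval (bad bs U) * f̂² U)))) ⟩
  L * (2ℚ * 𝔼s ℓ (λ bs → badMass F (treeBound L bs) f)) ≡⟨ solve 2 (λ l e → l :* (con 2ℚ :* e) := con 2ℚ :* (l :* e)) refl L (𝔼s ℓ (λ bs → badMass F (treeBound L bs) f)) ⟩
  2ℚ * (L * 𝔼s ℓ (λ bs → badMass F (treeBound L bs) f)) ≡⟨ cong (2ℚ *_) (𝔼s-* ℓ L (λ bs → badMass F (treeBound L bs) f)) ⟨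
  2ℚ * 𝔼s ℓ (λ bs → L * badMass F (treeBound L bs) f) ≤⟨ *-monoˡ-≤ 2ℚ 0≤2 (𝔼s-mono ℓ (λ bs → badMass-tree f bool 1≤L bs F)) ⟩
  2ℚ * 𝔼s {n} ℓ (λ _ → lossFactor ℓ * infl F f) ≡⟨ cong (2ℚ *_) (𝔼s-const ℓ (lossFactor ℓ * infl F f)) ⟩
  2ℚ * (lossFactor ℓ * infl F f) ∎
  where
  open ≤-Reasoning
  F = full n
  0≤L = ≤-trans 0≤1 1≤L
  f̂² : V n → ℚ
  f̂² U = T ½ F f U * T ½ F f U
  0≤f̂² : ∀ U → 0ℚ ≤ f̂² U
  0≤f̂² U = 0≤x² (T ½ F f U)
  bad : Vec (V n) ℓ → V n → Bool
  bad bs = isBad F (treeBound L bs) f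
  D = ι d
  0<D : 0ℚ < D
  0<D = <-≤-trans 0<1 (ι-mono 0<d)
  pairs≤ : ∀ U → card U ℕ.≤ d → powℚ ½ ℓ * ι (pairs (card U)) ≤ D
  pairs≤ U c≤d = begin
    powℚ ½ ℓ * ι (pairs s) ≤⟨ *-monoˡ-≤ (powℚ ½ ℓ) (0≤pow 0≤½ ℓ) (ι-mono le) ⟩
    powℚ ½ ℓ * ι (2 ℕ.^ ℓ ℕ.* d) ≡⟨ cong (powℚ ½ ℓ *_) (ι-* (2 ℕ.^ ℓ) d) ⟩
    powℚ ½ ℓ * (ι (2 ℕ.^ ℓ) * D) ≡⟨ *-assoc (powℚ ½ ℓ) (ι (2 ℕ.^ ℓ)) D ⟨
    powℚ ½ ℓ * ι (2 ℕ.^ ℓ) * D ≡⟨ trans (cong (_* D) (pow-½-2 ℓ)) (*-identityˡ D) ⟩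
    D ∎
    where
    s = card U
    le : pairs s ℕ.≤ 2 ℕ.^ ℓ ℕ.* d
    le = ℕₚ.≤-trans (subst (pairs s ℕ.≤_) (s+pairs≡s² s) (ℕₚ.m≤n+m (pairs s) s)) (ℕₚ.*-mono-≤ (ℕₚ.≤-trans c≤d d≤2^ℓ) c≤d)
  half : ∀ U → small U ≡ true → 1ℚ ≤ 2ℚ * 𝔼s ℓ (λ bs → bval (bad bs U))
  half U e = *-cancelˡ-≤ D 0<D (begin
    D * 1ℚ ≡⟨ *-identityʳ D ⟩
    D ≤⟨ ≤-by (E - (D + D - C)) (x≤y⇒0≤y-x D+D-C≤E) (solve 3 (λ d c e → e :+ c :- d := d :+ (e :- (d :+ d :- c))) refl D C E) ⟩
    E + C - D ≤⟨ ≤-by (D - C) (x≤y⇒0≤y-x C≤D) (solve 3 (λ d c e → e := e :+ c :- d :+ (d :- c)) refl D C E) ⟩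
    E ≡⟨ solve 2 (λ d p → (d :+ d) :* p := d :* (con 2ℚ :* p)) refl D P ⟩
    D * (2ℚ * P) ∎)
    where
    P = 𝔼s ℓ (λ bs → bval (bad bs U))
    E = (D + D) * P
    C = 𝔼s ℓ (λ bs → ι (collisions bs U))
    C≤D : C ≤ D
    C≤D = subst (_≤ D) (sym (𝔼-collisions ℓ U)) (pairs≤ U (proj₁ (proj₂ (small⇒ U e))))
    -- Either `U` is bad for these masks, or it has more than `2 d` collisions, which pay for the
    -- left side themselves. Taking expectations, with at most `d` collisions on average, leaves
    -- probability at least 1/2 for badness.
    markov : ∀ bs → D + D ≤ (D + D) * bval (bad bs U) + ι (collisions bs U)
    markov bs with collisions bs U ℕₚ.≤? d ℕ.+ d
    ... | yes c≤ = ≤-by (ι (collisions bs U)) (0≤ι (collisions bs U)) (cong (λ z → z + ι (collisions bs U)) (trans (cong (λ b → (D + D) * bval b) isbad) (*-identityʳ (D + D))))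
      where
      isbad : bad bs U ≡ true
      isbad = trans (cong₂ _∧_ (trans (cong nz (full-∩ U)) (proj₁ (small⇒ U e))) refl)
        (cong not (dec-false (1ℚ ≤? treeBound L bs (F ∩ U) * f̂² U)
           (λ le → <-irrefl refl (≤-<-trans le (subst (λ Z → treeBound L bs Z * f̂² U < 1ℚ) (sym (full-∩ U)) (proj₂ (proj₂ (small⇒ U e)) bs c≤))))))
    ... | no c≰ = begin
      D + D ≡⟨ ι-+ d d ⟨
      ι (d ℕ.+ d) ≤⟨ ι-mono (ℕₚ.<⇒≤ (ℕₚ.≰⇒> c≰)) ⟩
      ι (collisions bs U) ≤⟨ ≤-by ((D + D) * bval (bad bs U)) (0≤* (0≤+ (<⇒≤ 0<D) (<⇒≤ 0<D)) (0≤bval (bad bs U))) (+-comm ((D + D) * bval (bad bs U)) (ι (collisions bs U))) ⟩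
      (D + D) * bval (bad bs U) + ι (collisions bs U) ∎
    D+D≤ : D + D ≤ E + C
    D+D≤ = begin
      D + D ≡⟨ 𝔼s-const ℓ (D + D) ⟨
      𝔼s {n} ℓ (λ _ → D + D) ≤⟨ 𝔼s-mono ℓ markov ⟩
      𝔼s ℓ (λ bs → (D + D) * bval (bad bs U) + ι (collisions bs U)) ≡⟨ 𝔼s-+ ℓ (λ bs → (D + D) * bval (bad bs U)) (λ bs → ι (collisions bs U)) ⟩
      𝔼s ℓ (λ bs → (D + D) * bval (bad bs U)) + C ≡⟨ cong (λ z → z + C) (𝔼s-* ℓ (D + D) (λ bs → bval (bad bs U))) ⟩
      E + C ∎
    D+D-C≤E : D + D - C ≤ E
    D+D-C≤E = ≤-by (E + C - (D + D)) (x≤y⇒0≤y-x D+D≤) (solve 3 (λ d c e → e := d :+ d :- c :+ (e :+ c :- (d :+ d))) refl D C E)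
  pt : ∀ U b → small U ≡ b → bval b * f̂² U ≤ 2ℚ * 𝔼s ℓ (λ bs → bval (bad bs U) * f̂² U)
  pt U b e = subst (bval b * f̂² U ≤_) eq (go b e)
    where
    P = 𝔼s ℓ (λ bs → bval (bad bs U))
    0≤P : 0ℚ ≤ P
    0≤P = subst (_≤ P) (𝔼s-const {n} ℓ 0ℚ) (𝔼s-mono ℓ (λ bs → 0≤bval (bad bs U)))
    eq : (2ℚ * P) * f̂² U ≡ 2ℚ * 𝔼s ℓ (λ bs → bval (bad bs U) * f̂² U)
    eq = trans (solve 2 (λ p f → (con 2ℚ :* p) :* f := con 2ℚ :* (f :* p)) refl P (f̂² U))
      (cong (2ℚ *_) (trans (sym (𝔼s-* ℓ (f̂² U) (λ bs → bval (bad bs U)))) (𝔼s-cong ℓ (λ bs → *-comm (f̂² U) (bval (bad bs U))))))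
    go : ∀ b → small U ≡ b → bval b * f̂² U ≤ (2ℚ * P) * f̂² U
    go true e = *-monoʳ-≤ (f̂² U) (0≤f̂² U) (half U e)
    go false e = *-monoʳ-≤ (f̂² U) (0≤f̂² U) (0≤* 0≤2 0≤P)

-- The threshold of the tree in closed form

pow-+ : ∀ a j k → powℚ a (j ℕ.+ k) ≡ powℚ a j * powℚ a k
pow-+ a zero k = sym (*-identityˡ _)
pow-+ a (suc j) k = trans (cong (a *_) (pow-+ a j k)) (sym (*-assoc a (powℚ a j) (powℚ a k)))

pow-dist : ∀ a b k → powℚ (a * b) k ≡ powℚ a k * powℚ b k
pow-dist a b zero = refl
pow-dist a b (suc k) = trans (cong (a * b *_) (pow-dist a b k))
  (solve 4 (λ a b p q → a :* b :* (p :* q) := a :* p :* (b :* q)) refl a b (powℚ a k) (powℚ b k))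

pow-* : ∀ a j k → powℚ (powℚ a j) k ≡ powℚ a (k ℕ.* j)
pow-* a j zero = refl
pow-* a j (suc k) = trans (cong (powℚ a j *_) (pow-* a j k)) (sym (pow-+ a j (k ℕ.* j)))

pow-monoˡ : ∀ {a b} → 0ℚ ≤ a → a ≤ b → ∀ k → powℚ a k ≤ powℚ b k
pow-monoˡ 0≤a a≤b zero = ≤-refl
pow-monoˡ {a} {b} 0≤a a≤b (suc k) = *-mono-≤ 0≤a (0≤pow (≤-trans 0≤a a≤b) k) a≤b (pow-monoˡ 0≤a a≤b k)

36ℚ : ℚ
36ℚ = + 36 / 1

-- A merge multiplies the two thresholds by `L^5 9^|U|`, so after multiplication by `L^5` the
-- threshold is multiplicative up to `9^|U|` per level. A leaf gives `(4 L³)^s 9^(s²)`, and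
-- `s² = s + pairs s` moves one 9 per element into 36.
treeBound-closed : ∀ L (bs : Vec (V n) ℓ) U → treeBound L bs U * (L * (L * L) * (L * L)) ≡
  powℚ (L * (L * L) * (L * L)) (2 ℕ.^ ℓ) * (powℚ 9ℚ (card U ℕ.* ℓ) * (powℚ (36ℚ * (L * (L * L))) (card U) * powℚ 9ℚ (collisions bs U)))
treeBound-closed L [] U = begin
  powℚ (L * (4ℚ * (L * L) * powℚ 9ℚ s)) s * L⁵ ≡⟨ cong (λ z → powℚ z s * L⁵) (solve 2 (λ l p → l :* (con 4ℚ :* (l :* l) :* p) := (con 4ℚ :* (l :* (l :* l))) :* p) refl L (powℚ 9ℚ s)) ⟩
  powℚ (X * powℚ 9ℚ s) s * L⁵ ≡⟨ cong (_* L⁵) (pow-dist X (powℚ 9ℚ s) s) ⟩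
  powℚ X s * powℚ (powℚ 9ℚ s) s * L⁵ ≡⟨ cong (λ z → powℚ X s * z * L⁵) (trans (pow-* 9ℚ s s) (trans (cong (powℚ 9ℚ) (sym (s+pairs≡s² s))) (pow-+ 9ℚ s (pairs s)))) ⟩
  powℚ X s * (powℚ 9ℚ s * powℚ 9ℚ (pairs s)) * L⁵ ≡⟨ solve 4 (λ x p q l → x :* (p :* q) :* l := l :* con 1ℚ :* (con 1ℚ :* ((p :* x) :* q))) refl (powℚ X s) (powℚ 9ℚ s) (powℚ 9ℚ (pairs s)) L⁵ ⟩
  L⁵ * 1ℚ * (1ℚ * ((powℚ 9ℚ s * powℚ X s) * powℚ 9ℚ (pairs s)))
    ≡⟨ cong₂ (λ k z → L⁵ * 1ℚ * (powℚ 9ℚ k * (z * powℚ 9ℚ (pairs s)))) (sym (ℕₚ.*-zeroʳ s)) (trans (sym (pow-dist 9ℚ X s)) (cong (λ z → powℚ z s) (solve 1 (λ l → con 9ℚ :* (con 4ℚ :* l) := con 36ℚ :* l) refl (L * (L * L))))) ⟩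
  L⁵ * 1ℚ * (powℚ 9ℚ (s ℕ.* 0) * (powℚ (36ℚ * (L * (L * L))) s * powℚ 9ℚ (pairs s))) ∎
  where
  open ≡-Reasoning
  s = card U
  L⁵ = L * (L * L) * (L * L)
  X = 4ℚ * (L * (L * L))
treeBound-closed {ℓ = suc ℓ} L (b ∷ bs) U = begin
  L * (powℚ 9ℚ s₂ * (L * L * t₁)) * (powℚ 9ℚ s₁ * (L * L * t₂)) * L⁵
    ≡⟨ solve 5 (λ l p q t u → l :* (q :* (l :* l :* t)) :* (p :* (l :* l :* u)) :* (l :* (l :* l) :* (l :* l)) := (p :* q) :* ((t :* (l :* (l :* l) :* (l :* l))) :* (u :* (l :* (l :* l) :* (l :* l))))) refl L (powℚ 9ℚ s₁) (powℚ 9ℚ s₂) t₁ t₂ ⟩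
  (powℚ 9ℚ s₁ * powℚ 9ℚ s₂) * ((t₁ * L⁵) * (t₂ * L⁵)) ≡⟨ cong ((powℚ 9ℚ s₁ * powℚ 9ℚ s₂) *_) (cong₂ _*_ (treeBound-closed L bs (b ∩ U)) (treeBound-closed L bs (∁ b ∩ U))) ⟩
  (powℚ 9ℚ s₁ * powℚ 9ℚ s₂) * ((M * (powℚ 9ℚ (s₁ ℕ.* ℓ) * (powℚ Y s₁ * powℚ 9ℚ c₁))) * (M * (powℚ 9ℚ (s₂ ℕ.* ℓ) * (powℚ Y s₂ * powℚ 9ℚ c₂))))
    ≡⟨ solve 9 (λ a b m p x c q y d → (a :* b) :* ((m :* (p :* (x :* c))) :* (m :* (q :* (y :* d)))) := (m :* m) :* (((a :* p) :* (b :* q)) :* ((x :* y) :* (c :* d)))) refl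
         (powℚ 9ℚ s₁) (powℚ 9ℚ s₂) M (powℚ 9ℚ (s₁ ℕ.* ℓ)) (powℚ Y s₁) (powℚ 9ℚ c₁) (powℚ 9ℚ (s₂ ℕ.* ℓ)) (powℚ Y s₂) (powℚ 9ℚ c₂) ⟩
  (M * M) * (((powℚ 9ℚ s₁ * powℚ 9ℚ (s₁ ℕ.* ℓ)) * (powℚ 9ℚ s₂ * powℚ 9ℚ (s₂ ℕ.* ℓ))) * ((powℚ Y s₁ * powℚ Y s₂) * (powℚ 9ℚ c₁ * powℚ 9ℚ c₂)))
    ≡⟨ cong₂ _*_ (trans (sym (pow-+ L⁵ (2 ℕ.^ ℓ) (2 ℕ.^ ℓ))) (cong (powℚ L⁵) (cong (2 ℕ.^ ℓ ℕ.+_) (sym (ℕₚ.+-identityʳ (2 ℕ.^ ℓ))))))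
        (cong₂ _*_ (trans (cong₂ _*_ (sym (pow-+ 9ℚ s₁ (s₁ ℕ.* ℓ))) (sym (pow-+ 9ℚ s₂ (s₂ ℕ.* ℓ)))) (trans (sym (pow-+ 9ℚ (s₁ ℕ.+ s₁ ℕ.* ℓ) (s₂ ℕ.+ s₂ ℕ.* ℓ))) (cong (powℚ 9ℚ) exps)))
          (cong₂ _*_ (trans (sym (pow-+ Y s₁ s₂)) (cong (powℚ Y) (sym (card-mask b U)))) (sym (pow-+ 9ℚ c₁ c₂)))) ⟩
  powℚ L⁵ (2 ℕ.^ suc ℓ) * (powℚ 9ℚ (card U ℕ.* suc ℓ) * (powℚ Y (card U) * powℚ 9ℚ (c₁ ℕ.+ c₂))) ∎
  where
  open ≡-Reasoning
  s₁ = card (b ∩ U)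
  s₂ = card (∁ b ∩ U)
  c₁ = collisions bs (b ∩ U)
  c₂ = collisions bs (∁ b ∩ U)
  t₁ = treeBound L bs (b ∩ U)
  t₂ = treeBound L bs (∁ b ∩ U)
  L⁵ = L * (L * L) * (L * L)
  M = powℚ L⁵ (2 ℕ.^ ℓ)
  Y = 36ℚ * (L * (L * L))
  distrib : ∀ x y l → (x ℕ.+ x ℕ.* l) ℕ.+ (y ℕ.+ y ℕ.* l) ≡ (x ℕ.+ y) ℕ.* suc l
  distrib = solve-∀
  exps : (s₁ ℕ.+ s₁ ℕ.* ℓ) ℕ.+ (s₂ ℕ.+ s₂ ℕ.* ℓ) ≡ card U ℕ.* suc ℓ
  exps = trans (distrib s₁ s₂ ℓ) (cong (ℕ._* suc ℓ) (sym (card-mask b U)))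

-- Numerical estimates

pow-2 : ∀ k → powℚ 2ℚ k ≡ ι (2 ℕ.^ k)
pow-2 zero = refl
pow-2 (suc k) = trans (cong (2ℚ *_) (pow-2 k)) (sym (ι-* 2 (2 ℕ.^ k)))

1≤2 : 1ℚ ≤ 2ℚ
1≤2 = *≤* (ℤ.+≤+ (ℕ.s≤s ℕ.z≤n))

ι≤pow-2 : ∀ k → ι k ≤ powℚ 2ℚ k
ι≤pow-2 zero = 0≤1
ι≤pow-2 (suc k) = subst₂ _≤_ (sym (ι-+ 1 k)) (solve 1 (λ p → p :+ p := con 2ℚ :* p) refl (powℚ 2ℚ k))
  (+-mono-≤ (1≤pow 1≤2 k) (ι≤pow-2 k))

-- With `L ≤ u^e` and `2 d ≤ u^k`, the summands come in order from `(L^5)^(2^ℓ)`, `9^(ℓ |U|)`,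
-- `(36 L³)^|U|` and 9 to the number of collisions, each per unit of `d`.
exponent : ℕ → ℕ → ℕ
exponent e k = e ℕ.* 10 ℕ.+ (4 ℕ.* k ℕ.+ ((6 ℕ.+ 3 ℕ.* e) ℕ.+ 8))

treeBound≤ : ∀ {u L} e k d → 2ℚ ≤ u → 1ℚ ≤ L → L ≤ powℚ u e → ι (d ℕ.+ d) ≤ powℚ u k → 2 ℕ.^ ℓ ℕ.≤ d ℕ.+ d →
  (bs : Vec (V n) ℓ) (U : V n) → card U ℕ.≤ d → collisions bs U ℕ.≤ d ℕ.+ d →
  treeBound L bs U ≤ powℚ u (d ℕ.* exponent e k)
treeBound≤ {ℓ = ℓ} {u = u} {L} e k d 2≤u 1≤L L≤ 2d≤ 2^ℓ≤ bs U s≤d c≤ = begin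
  t ≡⟨ *-identityʳ t ⟨
  t * 1ℚ ≤⟨ *-monoˡ-≤ t (≤-trans 0≤1 (1≤treeBound 1≤L bs U)) 1≤L⁵ ⟩
  t * L⁵ ≡⟨ treeBound-closed L bs U ⟩
  powℚ L⁵ (2 ℕ.^ ℓ) * (powℚ 9ℚ (s ℕ.* ℓ) * (powℚ Y s * powℚ 9ℚ c))
    ≤⟨ *-mono-≤ (0≤pow (≤-trans 0≤1 1≤L⁵) (2 ℕ.^ ℓ)) (0≤* (pu k₂) (0≤* (pu k₃) (pu k₄))) b₁
        (*-mono-≤ (0≤pow 0≤9 (s ℕ.* ℓ)) (0≤* (pu k₃) (pu k₄)) b₂ (*-mono-≤ (0≤pow (≤-trans 0≤1 1≤Y) s) (pu k₄) b₃ b₄)) ⟩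
  powℚ u ((d ℕ.+ d) ℕ.* (5 ℕ.* e)) * (powℚ u (d ℕ.* (4 ℕ.* k)) * (powℚ u (d ℕ.* (6 ℕ.+ 3 ℕ.* e)) * powℚ u ((d ℕ.+ d) ℕ.* 4)))
    ≡⟨ cong (λ z → powℚ u ((d ℕ.+ d) ℕ.* (5 ℕ.* e)) * (powℚ u (d ℕ.* (4 ℕ.* k)) * z)) (pow-+ u (d ℕ.* (6 ℕ.+ 3 ℕ.* e)) ((d ℕ.+ d) ℕ.* 4)) ⟨
  powℚ u ((d ℕ.+ d) ℕ.* (5 ℕ.* e)) * (powℚ u (d ℕ.* (4 ℕ.* k)) * powℚ u (d ℕ.* (6 ℕ.+ 3 ℕ.* e) ℕ.+ (d ℕ.+ d) ℕ.* 4))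
    ≡⟨ cong (powℚ u ((d ℕ.+ d) ℕ.* (5 ℕ.* e)) *_) (pow-+ u (d ℕ.* (4 ℕ.* k)) (d ℕ.* (6 ℕ.+ 3 ℕ.* e) ℕ.+ (d ℕ.+ d) ℕ.* 4)) ⟨
  powℚ u ((d ℕ.+ d) ℕ.* (5 ℕ.* e)) * powℚ u (d ℕ.* (4 ℕ.* k) ℕ.+ (d ℕ.* (6 ℕ.+ 3 ℕ.* e) ℕ.+ (d ℕ.+ d) ℕ.* 4))
    ≡⟨ pow-+ u ((d ℕ.+ d) ℕ.* (5 ℕ.* e)) (d ℕ.* (4 ℕ.* k) ℕ.+ (d ℕ.* (6 ℕ.+ 3 ℕ.* e) ℕ.+ (d ℕ.+ d) ℕ.* 4)) ⟨
  powℚ u ((d ℕ.+ d) ℕ.* (5 ℕ.* e) ℕ.+ (d ℕ.* (4 ℕ.* k) ℕ.+ (d ℕ.* (6 ℕ.+ 3 ℕ.* e) ℕ.+ (d ℕ.+ d) ℕ.* 4))) ≡⟨ cong (powℚ u) (exps d e k) ⟩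
  powℚ u (d ℕ.* exponent e k) ∎
  where
  open ≤-Reasoning
  1≤u = ≤-trans 1≤2 2≤u
  0≤u = ≤-trans 0≤1 1≤u
  0≤L = ≤-trans 0≤1 1≤L
  0≤9 = ≤-trans 0≤1 1≤9
  pu = 0≤pow 0≤u
  k₂ = d ℕ.* (4 ℕ.* k)
  k₃ = d ℕ.* (6 ℕ.+ 3 ℕ.* e)
  k₄ = (d ℕ.+ d) ℕ.* 4
  t = treeBound L bs U
  s = card U
  c = collisions bs U
  L⁵ Y : ℚ
  L⁵ = L * (L * L) * (L * L)
  Y = 36ℚ * (L * (L * L))
  1≤L⁵ : 1ℚ ≤ L⁵
  1≤L⁵ = 1≤* (1≤* 1≤L (1≤* 1≤L 1≤L)) (1≤* 1≤L 1≤L)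
  1≤Y : 1ℚ ≤ Y
  1≤Y = 1≤* {36ℚ} (*≤* (ℤ.+≤+ (ℕ.s≤s ℕ.z≤n))) (1≤* 1≤L (1≤* 1≤L 1≤L))
  2^≤u^ : ∀ j → powℚ 2ℚ j ≤ powℚ u j
  2^≤u^ = pow-monoˡ 0≤2 2≤u
  9≤u⁴ : 9ℚ ≤ powℚ u 4
  9≤u⁴ = ≤-trans {9ℚ} {powℚ 2ℚ 4} (does-true (9ℚ ≤? powℚ 2ℚ 4) refl) (2^≤u^ 4)
  L⁵≤ : L⁵ ≤ powℚ u (5 ℕ.* e)
  L⁵≤ = subst₂ _≤_ (solve 1 (λ l → l :* (l :* (l :* (l :* (l :* con 1ℚ)))) := l :* (l :* l) :* (l :* l)) refl L) (pow-* u e 5) (pow-monoˡ 0≤L L≤ 5)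
  Y≤ : Y ≤ powℚ u (6 ℕ.+ 3 ℕ.* e)
  Y≤ = subst (Y ≤_) (sym (pow-+ u 6 (3 ℕ.* e))) (*-mono-≤ {36ℚ} (does-true (0ℚ ≤? 36ℚ) refl) (pu (3 ℕ.* e))
    (≤-trans {36ℚ} {powℚ 2ℚ 6} (does-true (36ℚ ≤? powℚ 2ℚ 6) refl) (2^≤u^ 6))
    (subst₂ _≤_ (solve 1 (λ l → l :* (l :* (l :* con 1ℚ)) := l :* (l :* l)) refl L) (pow-* u e 3) (pow-monoˡ 0≤L L≤ 3)))
  b₁ : powℚ L⁵ (2 ℕ.^ ℓ) ≤ powℚ u ((d ℕ.+ d) ℕ.* (5 ℕ.* e))
  b₁ = ≤-trans (pow-monoʳ 1≤L⁵ 2^ℓ≤) (subst (powℚ L⁵ (d ℕ.+ d) ≤_) (pow-* u (5 ℕ.* e) (d ℕ.+ d)) (pow-monoˡ (≤-trans 0≤1 1≤L⁵) L⁵≤ (d ℕ.+ d)))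
  -- From `9 ≤ 2^4`, `9^ℓ` is at most the fourth power of `2^ℓ ≤ 2 d`; the depth enters only through
  -- a polynomial in `d`.
  9^ℓ≤ : powℚ 9ℚ ℓ ≤ powℚ u (4 ℕ.* k)
  9^ℓ≤ = begin
    powℚ 9ℚ ℓ ≤⟨ pow-monoˡ 0≤9 (does-true (9ℚ ≤? powℚ 2ℚ 4) refl) ℓ ⟩
    powℚ (powℚ 2ℚ 4) ℓ ≡⟨ trans (pow-* 2ℚ 4 ℓ) (trans (cong (powℚ 2ℚ) (ℕₚ.*-comm ℓ 4)) (sym (pow-* 2ℚ ℓ 4))) ⟩
    powℚ (powℚ 2ℚ ℓ) 4 ≤⟨ pow-monoˡ (0≤pow 0≤2 ℓ) (≤-trans (≤-reflexive (pow-2 ℓ)) (≤-trans (ι-mono 2^ℓ≤) 2d≤)) 4 ⟩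
    powℚ (powℚ u k) 4 ≡⟨ pow-* u k 4 ⟩
    powℚ u (4 ℕ.* k) ∎
  b₂ : powℚ 9ℚ (s ℕ.* ℓ) ≤ powℚ u (d ℕ.* (4 ℕ.* k))
  b₂ = ≤-trans (pow-monoʳ 1≤9 (ℕₚ.*-monoˡ-≤ ℓ s≤d)) (subst₂ _≤_ (pow-* 9ℚ ℓ d) (pow-* u (4 ℕ.* k) d) (pow-monoˡ (0≤pow 0≤9 ℓ) 9^ℓ≤ d))
  b₃ : powℚ Y s ≤ powℚ u (d ℕ.* (6 ℕ.+ 3 ℕ.* e))
  b₃ = ≤-trans (pow-monoʳ 1≤Y s≤d) (subst (powℚ Y d ≤_) (pow-* u (6 ℕ.+ 3 ℕ.* e) d) (pow-monoˡ (≤-trans 0≤1 1≤Y) Y≤ d))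
  b₄ : powℚ 9ℚ c ≤ powℚ u ((d ℕ.+ d) ℕ.* 4)
  b₄ = ≤-trans (pow-monoʳ 1≤9 c≤) (subst (powℚ 9ℚ (d ℕ.+ d) ≤_) (pow-* u 4 (d ℕ.+ d)) (pow-monoˡ 0≤9 9≤u⁴ (d ℕ.+ d)))
  exps : ∀ d e k → (d ℕ.+ d) ℕ.* (5 ℕ.* e) ℕ.+ (d ℕ.* (4 ℕ.* k) ℕ.+ (d ℕ.* (6 ℕ.+ 3 ℕ.* e) ℕ.+ (d ℕ.+ d) ℕ.* 4)) ≡ d ℕ.* (e ℕ.* 10 ℕ.+ (4 ℕ.* k ℕ.+ ((6 ℕ.+ 3 ℕ.* e) ℕ.+ 8)))
  exps = solve-∀

pow≤1⇒≤1 : ∀ {y} q → powℚ y (suc q) ≤ 1ℚ → y ≤ 1ℚ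
pow≤1⇒≤1 {y} q h with y ≤? 1ℚ
... | yes y≤1 = y≤1
... | no y≰1 = ≤-trans (subst (_≤ powℚ y (suc q)) (*-identityʳ y) (*-monoˡ-≤ y (≤-trans 0≤1 1≤y) (1≤pow 1≤y q))) h
  where 1≤y = <⇒≤ (≰⇒> y≰1)

ι≤⇒ : ∀ e r → ι e ≤ r → e ℕ.* ↧ₙ r ℕ.≤ ℤ.∣ ↥ r ∣
ι≤⇒ e r@(mkℚ i d _) h with ℚᵘₚ.≤-respˡ-≃ (toℚᵘ-ι e) (toℚᵘ-mono-≤ h)
... | ℚᵘ.*≤* le = ℤₚ.drop‿+≤+ (ℤₚ.≤-trans (ℤₚ.≤-trans (ℤₚ.≤-reflexive (ℤₚ.pos-* e (suc d))) (ℤₚ.≤-trans le (ℤₚ.≤-reflexive (ℤₚ.*-identityʳ i)))) i≤∣i∣)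
  where
  i≤∣i∣ : i ℤ.≤ + ℤ.∣ i ∣
  i≤∣i∣ = go i
    where
    go : ∀ i → i ℤ.≤ + ℤ.∣ i ∣
    go (+ _) = ℤₚ.≤-refl
    go ℤ.-[1+ _ ] = ℤ.-≤+

-- Passes from a rational exponent to a smaller natural one: the claim holds after raising to the
-- power of the denominator of `r`, and the root is taken by `pow≤1⇒≤1`.
BelowPow⇒ : ∀ {a u r} e → 1ℚ ≤ u → ι e ≤ r → BelowPow a u r → ∣ a ∣ * powℚ u e ≤ 1ℚ
BelowPow⇒ {a} {u} {r@(mkℚ _ q _)} e 1≤u e≤r h = pow≤1⇒≤1 q (begin
  powℚ (x * powℚ u e) (suc q) ≡⟨ trans (pow-dist x (powℚ u e) (suc q)) (cong (powℚ x (suc q) *_) (trans (pow-* u e (suc q)) (cong (powℚ u) (ℕₚ.*-comm (suc q) e)))) ⟩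
  powℚ x (suc q) * powℚ u (e ℕ.* suc q) ≤⟨ *-monoˡ-≤ (powℚ x (suc q)) (0≤pow (0≤∣p∣ a) (suc q)) (pow-monoʳ 1≤u (ι≤⇒ e r e≤r)) ⟩
  powℚ x (suc q) * powℚ u p ≤⟨ h ⟩
  1ℚ ∎)
  where
  open ≤-Reasoning
  x = ∣ a ∣
  p = ℤ.∣ ↥ r ∣

archimedes : ∀ x → ∃ λ k → x ≤ ι k
archimedes x@(mkℚ i d _) = ℤ.∣ i ∣ , toℚᵘ-cancel-≤ (ℚᵘₚ.≤-respʳ-≃ (ℚᵘₚ.≃-sym (toℚᵘ-ι ℤ.∣ i ∣)) (ℚᵘ.*≤* le))
  where
  go : ∀ i → i ℤ.* (+ 1) ℤ.≤ + ℤ.∣ i ∣ ℤ.* + suc d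
  go (+ m) = ℤₚ.*-monoˡ-≤-nonNeg (+ m) (ℤ.+≤+ (ℕ.s≤s ℕ.z≤n))
  go ℤ.-[1+ m ] = ℤ.-≤+
  le = go i

ceil : ∀ x → 0ℚ ≤ x → ∃ λ a → x ≤ ι a × ι a ≤ 1ℚ + x
ceil x 0≤x = search (proj₁ (archimedes x)) (proj₂ (archimedes x))
  where
  search : ∀ k → x ≤ ι k → ∃ λ a → x ≤ ι a × ι a ≤ 1ℚ + x
  search zero x≤0 = 0 , x≤0 , 0≤+ 0≤1 0≤x
  search (suc k) x≤ with x ≤? ι k
  ... | yes x≤k = search k x≤k
  ... | no x≰k = suc k , x≤ , subst (_≤ 1ℚ + x) (sym (ι-+ 1 k)) (+-monoʳ-≤ 1ℚ (<⇒≤ (≰⇒> x≰k)))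

power-between : ∀ d → 0 ℕ.< d → ∃ λ ℓ → d ℕ.≤ 2 ℕ.^ ℓ × 2 ℕ.^ ℓ ℕ.≤ d ℕ.+ d
power-between (suc zero) _ = 0 , ℕ.s≤s ℕ.z≤n , ℕ.s≤s ℕ.z≤n
power-between (suc d@(suc _)) _ with power-between d (ℕ.s≤s ℕ.z≤n)
... | ℓ , d≤ , ≤2d with suc d ℕₚ.≤? 2 ℕ.^ ℓ
...   | yes d<  = ℓ , d< , ℕₚ.≤-trans ≤2d (ℕₚ.+-mono-≤ (ℕₚ.n≤1+n d) (ℕₚ.n≤1+n d))
-- The old power fails only if it equals `d`; then the next one is `2 d`.
...   | no d≮ = suc ℓ , subst (suc d ℕ.≤_) (sym dd) (ℕₚ.+-monoˡ-≤ d (ℕ.s≤s ℕ.z≤n)) , subst (ℕ._≤ suc d ℕ.+ suc d) (sym dd) (ℕₚ.+-mono-≤ (ℕₚ.n≤1+n d) (ℕₚ.n≤1+n d))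
  where
  2^ℓ≡d : 2 ℕ.^ ℓ ≡ d
  2^ℓ≡d = ℕₚ.≤-antisym (ℕₚ.≤-pred (ℕₚ.≰⇒> d≮)) d≤
  dd : 2 ℕ.^ suc ℓ ≡ d ℕ.+ d
  dd = trans (cong (2 ℕ.^ ℓ ℕ.+_) (ℕₚ.+-identityʳ (2 ℕ.^ ℓ))) (cong₂ ℕ._+_ 2^ℓ≡d 2^ℓ≡d)

-- Variance, influence and Fourier coefficients

sumℚ-++ : ∀ xs ys → sumℚ (xs ++ ys) ≡ sumℚ xs + sumℚ ys
sumℚ-++ [] ys = sym (+-identityˡ _)
sumℚ-++ (x ∷ xs) ys = trans (cong (λ z → x + z) (sumℚ-++ xs ys)) (sym (+-assoc x (sumℚ xs) (sumℚ ys)))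

sum-allVecs : ∀ n (φ : V n → ℚ) → sumℚ (map φ (allVecs n)) ≡ S (full n) φ
sum-allVecs zero φ = +-identityʳ (φ [])
sum-allVecs (suc n) φ = begin
  sumℚ (map φ (map (false ∷_) A ++ map (true ∷_) A)) ≡⟨ cong sumℚ (map-++ φ (map (false ∷_) A) (map (true ∷_) A)) ⟩
  sumℚ (map φ (map (false ∷_) A) ++ map φ (map (true ∷_) A)) ≡⟨ sumℚ-++ (map φ (map (false ∷_) A)) (map φ (map (true ∷_) A)) ⟩
  sumℚ (map φ (map (false ∷_) A)) + sumℚ (map φ (map (true ∷_) A))
    ≡⟨ cong₂ _+_ (trans (cong sumℚ (sym (map-∘ A))) (sum-allVecs n (φ ⁰))) (trans (cong sumℚ (sym (map-∘ A))) (sum-allVecs n (φ ¹))) ⟩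
  S (full n) (φ ⁰) + S (full n) (φ ¹) ≡⟨ *-identityˡ (S (full n) (φ ⁰) + S (full n) (φ ¹)) ⟨
  1ℚ * (S (full n) (φ ⁰) + S (full n) (φ ¹)) ∎
  where
  open ≡-Reasoning
  A = allVecs n

S-empty : ∀ n (φ : V n → ℚ) → powℚ ½ n * S (full n) φ ≡ S (empty n) φ
S-empty zero φ = *-identityˡ (φ [])
S-empty (suc n) φ = trans
  (solve 3 (λ p x y → con ½ :* p :* (con 1ℚ :* (x :+ y)) := con ½ :* (p :* x :+ p :* y)) refl (powℚ ½ n) (S (full n) (φ ⁰)) (S (full n) (φ ¹)))
  (cong₂ (λ x y → ½ * (x + y)) (S-empty n (φ ⁰)) (S-empty n (φ ¹)))

𝔼≡S : (g : V n → ℚ) → 𝔼 g ≡ S (empty n) g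
𝔼≡S {n} g = trans (cong (powℚ ½ n *_) (sum-allVecs n g)) (S-empty n g)

isEven-suc : ∀ k → isEven (suc k) ≡ not (isEven k)
isEven-suc zero = refl
isEven-suc (suc zero) = refl
isEven-suc (suc (suc k)) = isEven-suc k

χ-flip : (U v : V n) → χ (true ∷ U) (true ∷ v) ≡ - 1ℚ * χ U v
χ-flip U v rewrite isEven-suc (card (U ∩ v)) with isEven (card (U ∩ v))
... | true = refl
... | false = refl

T-full : (g : V n → ℚ) (U : V n) → T ½ (full n) g U ≡ S (empty n) (λ x → g x * χ U x)
T-full g [] = sym (*-identityʳ (g []))
T-full {suc n} g (false ∷ U) = trans (cong₂ (λ x y → ½ * (x + 1ℚ * y)) (T-full (g ⁰) U) (T-full (g ¹) U))
  (solve 2 (λ x y → con ½ :* (x :+ con 1ℚ :* y) := con ½ :* (x :+ y)) refl (S (empty n) (λ x → (g ⁰) x * χ U x)) (S (empty n) (λ x → (g ¹) x * χ U x)))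
T-full {suc n} g (true ∷ U) = cong₂ (λ x y → ½ * (x + y)) (T-full (g ⁰) U)
  (trans (cong (- 1ℚ *_) (T-full (g ¹) U)) (trans (sym (W-* (modes (empty n)) (- 1ℚ) (λ x → (g ¹) x * χ U x)))
    (W-cong (modes (empty n)) (λ x _ → trans (solve 3 (λ m g c → m :* (g :* c) := g :* (m :* c)) refl (- 1ℚ) ((g ¹) x) (χ U x))
      (cong ((g ¹) x *_) (sym (χ-flip U x)))))))

T-full-empty : (g : V n → ℚ) → T ½ (full n) g (empty n) ≡ S (empty n) g
T-full-empty {zero} g = refl
T-full-empty {suc n} g = cong₂ (λ x y → ½ * (x + y)) (T-full-empty (g ⁰)) (trans (*-identityˡ _) (T-full-empty (g ¹)))

S-isZero : (φ : V n → ℚ) → S (full n) (λ U → bval (not (nz U)) * φ U) ≡ φ (empty n)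
S-isZero {zero} φ = *-identityˡ (φ [])
S-isZero {suc n} φ = trans (cong₂ (λ x y → 1ℚ * (x + y)) (S-isZero (φ ⁰))
    (trans (W-cong (modes (full n)) (λ v _ → *-zeroˡ ((φ ¹) v))) (W-0 (modes (full n)))))
  (solve 1 (λ x → con 1ℚ :* (x :+ con 0ℚ) := x) refl (φ (empty (suc n))))

point≤S : (φ : V n → ℚ) (x : V n) → (∀ v → 0ℚ ≤ φ v) → powℚ ½ n * φ x ≤ S (empty n) φ
point≤S φ [] h = ≤-reflexive (*-identityˡ (φ []))
point≤S {suc n} φ (false ∷ x) h = ≤-trans (≤-reflexive (*-assoc ½ (powℚ ½ n) (φ (false ∷ x))))
  (*-monoˡ-≤ ½ 0≤½ (≤-trans (point≤S (φ ⁰) x (h ∘ (false ∷_)))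
    (≤-by (S (empty n) (φ ¹)) (W-0≤ (modes-NN (empty n)) (λ v _ → h _)) refl)))
point≤S {suc n} φ (true ∷ x) h = ≤-trans (≤-reflexive (*-assoc ½ (powℚ ½ n) (φ (true ∷ x))))
  (*-monoˡ-≤ ½ 0≤½ (≤-trans (point≤S (φ ¹) x (h ∘ (true ∷_)))
    (≤-by (S (empty n) (φ ⁰)) (W-0≤ (modes-NN (empty n)) (λ v _ → h _)) (+-comm (S (empty n) (φ ⁰)) (S (empty n) (φ ¹))))))

0<pow : ∀ {a} → 0ℚ < a → ∀ k → 0ℚ < powℚ a k
0<pow 0<a zero = 0<1
0<pow 0<a (suc k) = 0<* 0<a (0<pow 0<a k)

divℚ-* : ∀ p q → q ≢ 0ℚ → divℚ p q * q ≡ p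
divℚ-* p q q≢0 with q ≟ 0ℚ
... | yes q≡0 = ⊥-elim (q≢0 q≡0)
... | no q≢0′ = trans (*-assoc p (1/ q) q) (trans (cong (p *_) (*-inverseˡ q)) (*-identityʳ p))
  where instance _ = ≢-nonZero q≢0′

module _ (f : V n → Bool) where

  private
    F : V n → ℚ
    F = fval f

  mean : ℚ
  mean = S (empty n) F

  fhat≡ : ∀ U → fhat f U ≡ T ½ (full n) F U
  fhat≡ U = trans (𝔼≡S (λ x → F x * χ U x)) (sym (T-full F U))

  f̂² : V n → ℚ
  f̂² U = T ½ (full n) F U * T ½ (full n) F U

  0≤f̂² : ∀ U → 0ℚ ≤ f̂² U
  0≤f̂² U = 0≤x² (T ½ (full n) F U)

  var≡mean : var f ≡ mean - mean * mean
  var≡mean = cong₂ _-_ (trans (𝔼≡S (λ x → F x * F x)) (W-cong (modes (empty n)) (λ x _ → bval-idem (f x))))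
    (cong (λ z → z * z) (𝔼≡S F))

  var≡∑ : var f ≡ S (full n) (λ U → bval (nz U) * f̂² U)
  var≡∑ = begin
    var f ≡⟨ cong₂ _-_ (𝔼≡S (λ x → F x * F x)) (cong (λ z → z * z) (𝔼≡S F)) ⟩
    S (empty n) (λ x → F x * F x) - mean * mean ≡⟨ cong (λ z → z - mean * mean) total ⟨
    S (full n) f̂² - mean * mean ≡⟨ cong (λ z → z - mean * mean) (trans (W-cong (modes (full n)) (λ U _ → decompose U)) (W-+ (modes (full n)) (λ U → bval (not (nz U)) * f̂² U) (λ U → bval (nz U) * f̂² U))) ⟩
    (S (full n) (λ U → bval (not (nz U)) * f̂² U) + R) - mean * mean ≡⟨ cong (λ z → (z + R) - mean * mean) (trans (S-isZero f̂²) (cong (λ z → z * z) (T-full-empty F))) ⟩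
    (mean * mean + R) - mean * mean ≡⟨ solve 2 (λ m r → (m :+ r) :- m := r) refl (mean * mean) R ⟩
    R ∎
    where
    open ≡-Reasoning
    R = S (full n) (λ U → bval (nz U) * f̂² U)
    total : S (full n) f̂² ≡ S (empty n) (λ x → F x * F x)
    total = trans (W-cong (modes (full n)) (λ U _ → sym (*-identityˡ (f̂² U)))) (trans (S-parseval (Split-empty (full n)) (λ _ → 1ℚ) F)
      (W-cong (modes (empty n)) (λ x _ → *-identityˡ (F x * F x))))
    decompose : ∀ U → f̂² U ≡ bval (not (nz U)) * f̂² U + bval (nz U) * f̂² U
    decompose U with nz U
    ... | true = solve 1 (λ x → x := con 0ℚ :* x :+ con 1ℚ :* x) refl (f̂² U)
    ... | false = solve 1 (λ x → x := con 1ℚ :* x :+ con 0ℚ :* x) refl (f̂² U)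

  Inf≡ : Inf f ≡ infl (full n) F
  Inf≡ = trans (sum-allVecs n (λ U → (+ card U / 1) * (fhat f U * fhat f U)))
    (W-cong (modes (full n)) (λ U _ → cong₂ (λ k x → ι k * (x * x)) (cong card (sym (full-∩ U))) (fhat≡ U)))

  -- Poincaré's inequality: nonempty frequencies have at least one element.
  var≤Inf : var f ≤ Inf f
  var≤Inf = subst₂ _≤_ (sym var≡∑) (sym Inf≡) (W-mono (modes-NN (full n)) (λ U _ →
    *-monoʳ-≤ (f̂² U) (0≤f̂² U) (subst (λ Z → bval (nz U) ≤ ι (card Z)) (sym (full-∩ U)) (nz≤card U))))

  F-Boolean : Boolean F
  F-Boolean x with f x
  ... | true = inj₂ refl
  ... | false = inj₁ refl

  0≤F : ∀ x → 0ℚ ≤ F x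
  0≤F x = 0≤bval (f x)

  0≤mean : 0ℚ ≤ mean
  0≤mean = W-0≤ (modes-NN (empty n)) (λ x _ → 0≤F x)

  0<mean : ∀ x → f x ≡ true → 0ℚ < mean
  0<mean x e = <-≤-trans (0<pow (*<* (ℤ.+<+ (ℕ.s≤s ℕ.z≤n))) n)
    (subst (_≤ mean) (trans (cong (λ b → powℚ ½ n * bval b) e) (*-identityʳ (powℚ ½ n))) (point≤S F x 0≤F))

  mean<1 : ∀ x → f x ≡ false → 0ℚ < 1ℚ - mean
  mean<1 x e = <-≤-trans (0<pow (*<* (ℤ.+<+ (ℕ.s≤s ℕ.z≤n))) n)
    (subst₂ _≤_ (trans (cong (λ b → powℚ ½ n * bval (not b)) e) (*-identityʳ (powℚ ½ n))) compl
      (point≤S (λ x → bval (not (f x))) x (λ x → 0≤bval (not (f x)))))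
    where
    pt : ∀ x → bval (not (f x)) ≡ 1ℚ + - 1ℚ * F x
    pt x with f x
    ... | true = refl
    ... | false = refl
    compl : S (empty n) (λ x → bval (not (f x))) ≡ 1ℚ - mean
    compl = trans (W-cong (modes (empty n)) (λ x _ → pt x)) (trans (W-+ (modes (empty n)) (λ _ → 1ℚ) (λ x → - 1ℚ * F x))
      (cong₂ _+_ (S-1 n) (trans (W-* (modes (empty n)) (- 1ℚ) F) (solve 1 (λ m → con (- 1ℚ) :* m := :- m) refl mean))))

  -- The variance is `p (1 - p)`, and a single point with value 1 or 0 keeps `p` or `1 - p` away
  -- from 0.
  0<var : NonConstant f → 0ℚ < var f
  0<var (x , y , fx≢fy) = subst (0ℚ <_) (trans (solve 1 (λ m → m :* (con 1ℚ :- m) := m :- m :* m) refl mean) (sym var≡mean))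
    (0<* (proj₁ both) (proj₂ both))
    where
    both : 0ℚ < mean × 0ℚ < 1ℚ - mean
    both with f x in ex | f y in ey
    ... | true  | true  = ⊥-elim (fx≢fy refl)
    ... | true  | false = 0<mean x ex , mean<1 y ey
    ... | false | true  = 0<mean y ey , mean<1 x ex
    ... | false | false = ⊥-elim (fx≢fy refl)

  Ĩ*var : NonConstant f → Ĩ f * var f ≡ Inf f
  Ĩ*var nc = divℚ-* (Inf f) (var f) (λ e → <-irrefl (sym e) (0<var nc))

  1≤Ĩ : NonConstant f → 1ℚ ≤ Ĩ f
  1≤Ĩ nc = *-cancelˡ-≤ (var f) (0<var nc) (subst₂ _≤_ (sym (*-identityʳ (var f))) (sym (trans (*-comm (var f) (Ĩ f)) (Ĩ*var nc))) var≤Inf)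

-- Choice of parameters

-- For u = 1 + Ĩ ≥ 2 and d = N ⌈Ĩ⌉ one has L = 32 d² ≤ u ^ size N and 2 d ≤ u ^ (N + 2), so that all the
-- thresholds that matter are at most u ^ (d · degree N).
size degree rate : ℕ → ℕ
size N = suc N ℕ.+ (suc N ℕ.+ 5)
degree N = exponent (size N) (suc (suc N))
rate N = N ℕ.* suc (degree N)

N<degree : ∀ N → suc N ℕ.≤ degree N
N<degree N = ℕₚ.≤-trans (ℕₚ.m≤m+n (suc N) (suc N ℕ.+ 5)) (ℕₚ.≤-trans (ℕₚ.m≤m*n (size N) 10) (ℕₚ.m≤m+n (size N ℕ.* 10) _))

1≤ι⇒0< : ∀ {a} → 1ℚ ≤ ι a → 0 ℕ.< a
1≤ι⇒0< {zero} 1≤0 = ⊥-elim (<-irrefl refl (<-≤-trans 0<1 1≤0))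
1≤ι⇒0< {suc _} _ = ℕ.s≤s ℕ.z≤n

module Assembly (N : ℕ) (0<N : 0 ℕ.< N) (f : V n → Bool) (nc : NonConstant f)
  (a : ℕ) (I≤a : Ĩ f ≤ ι a) (a≤u : ι a ≤ 1ℚ + Ĩ f)
  (ℓ : ℕ) (d≤2^ℓ : N ℕ.* a ℕ.≤ 2 ℕ.^ ℓ) (2^ℓ≤2d : 2 ℕ.^ ℓ ℕ.≤ N ℕ.* a ℕ.+ N ℕ.* a) where

  private
    D I u v : ℚ
    D = ι (2 ℕ.* rate N)
    I = Ĩ f
    u = 1ℚ + I
    v = var f

    1≤I : 1ℚ ≤ I
    1≤I = 1≤Ĩ f nc

    2≤u : 2ℚ ≤ u
    2≤u = +-monoʳ-≤ 1ℚ 1≤I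

    1≤u = ≤-trans 1≤2 2≤u
    0≤u = ≤-trans 0≤1 1≤u

    0≤v = <⇒≤ (0<var f nc)

    0<a : 0 ℕ.< a
    0<a = 1≤ι⇒0< (≤-trans 1≤I I≤a)

    d e : ℕ
    d = N ℕ.* a
    -- Thresholds are at most `u^(d * degree N)`; the `suc` supplies a spare factor `u ≥ 2`, which
    -- makes the inequality in `tiny` strict.
    e = d ℕ.* suc (degree N)

    0<d : 0 ℕ.< d
    0<d = ℕₚ.*-mono-≤ 0<N 0<a

    L : ℚ
    -- The error in `lowDegree` is at most `2 * 8 * 2^ℓ ≤ 32 d` times the influence; the second `d`
    -- brings the weight down to `Inf f / d`.
    L = ι (32 ℕ.* (d ℕ.* d))

    L≡ : L ≡ ι 32 * (ι d * ι d)
    L≡ = trans (ι-* 32 (d ℕ.* d)) (cong (ι 32 *_) (ι-* d d))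

    1≤L : 1ℚ ≤ L
    1≤L = ι-mono (ℕₚ.*-mono-≤ {1} {32} {1} (ℕ.s≤s ℕ.z≤n) (ℕₚ.*-mono-≤ 0<d 0<d))

    0<ιd : 0ℚ < ι d
    0<ιd = <-≤-trans 0<1 (ι-mono 0<d)

    N≤ : ι N ≤ powℚ u N
    N≤ = ≤-trans (ι≤pow-2 N) (pow-monoˡ 0≤2 2≤u N)

    d≤ : ι d ≤ powℚ u (suc N)
    d≤ = subst (_≤ powℚ u (suc N)) (trans (*-comm (ι a) (ι N)) (sym (ι-* N a))) (*-mono-≤ (0≤ι a) (0≤pow 0≤u N) a≤u N≤)

    d+d≤ : ι (d ℕ.+ d) ≤ powℚ u (suc (suc N))
    d+d≤ = subst (_≤ powℚ u (suc (suc N))) (trans (solve 1 (λ d → con 2ℚ :* d := d :+ d) refl (ι d)) (sym (ι-+ d d)))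
      (*-mono-≤ 0≤2 (0≤pow 0≤u (suc N)) 2≤u d≤)

    L≤ : L ≤ powℚ u (size N)
    L≤ = subst₂ _≤_ (trans (solve 1 (λ d → d :* (d :* con (ι 32)) := con (ι 32) :* (d :* d)) refl (ι d)) (sym L≡))
      (sym (trans (pow-+ u (suc N) (suc N ℕ.+ 5)) (cong (powℚ u (suc N) *_) (pow-+ u (suc N) 5))))
      (*-mono-≤ (0≤ι d) (0≤* (0≤pow 0≤u (suc N)) (0≤pow 0≤u 5)) d≤
        (*-mono-≤ (0≤ι d) (0≤pow 0≤u 5) d≤ (≤-trans {ι 32} {powℚ 2ℚ 5} ≤-refl (pow-monoˡ 0≤2 2≤u 5))))

    e≤DI : ι e ≤ D * I
    e≤DI = begin
      ι e ≡⟨ cong ι (comm N a (suc (degree N))) ⟩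
      ι (rate N ℕ.* a) ≡⟨ ι-* (rate N) a ⟩
      -- The factor 2 in `D` comes from rounding: `a ≤ 1 + Ĩ ≤ 2 Ĩ`.
      ι (rate N) * ι a ≤⟨ *-monoˡ-≤ (ι (rate N)) (0≤ι (rate N)) (≤-trans a≤u (+-monoˡ-≤ I 1≤I)) ⟩
      ι (rate N) * (I + I) ≡⟨ solve 2 (λ r i → r :* (i :+ i) := con 2ℚ :* r :* i) refl (ι (rate N)) I ⟩
      2ℚ * ι (rate N) * I ≡⟨ cong (_* I) (ι-* 2 (rate N)) ⟨
      D * I ∎
      where
      open ≤-Reasoning
      comm : ∀ N a q → (N ℕ.* a) ℕ.* q ≡ (N ℕ.* q) ℕ.* a
      comm = solve-∀

    x : V n → ℚ
    x U = T ½ (full n) (fval f) U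

    below : V n → Bool
    below U = belowPow? (fhat f U) u (D * I)

    below⇒ : ∀ U → below U ≡ true → ∣ x U ∣ * powℚ u e ≤ 1ℚ
    below⇒ U b = subst (λ y → ∣ y ∣ * powℚ u e ≤ 1ℚ) (fhat≡ f U)
      (BelowPow⇒ {fhat f U} {u} {D * I} e 1≤u e≤DI (does-true (powℚ ∣ fhat f U ∣ (↧ₙ (D * I)) * powℚ u ℤ.∣ ↥ (D * I) ∣ ≤? 1ℚ) b))

    ∣x∣² : ∀ y → ∣ y ∣ * ∣ y ∣ ≡ y * y
    ∣x∣² y = trans (sym (∣p*q∣≡∣p∣*∣q∣ y y)) (0≤p⇒∣p∣≡p (0≤x² y))

    large small : V n → Bool
    large U = does (suc d ℕₚ.≤? card U)
    small U = nz U ∧ (below U ∧ not (large U))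

    tiny : ∀ U → below U ≡ true → card U ℕ.≤ d → ∀ (bs : Vec (V n) ℓ) → collisions bs U ℕ.≤ d ℕ.+ d →
      treeBound L bs U * f̂² f U < 1ℚ
    tiny U b c≤d bs coll≤ = ≤-<-trans {_} {½} (*-cancelˡ-≤ 2ℚ (*<* (ℤ.+<+ (ℕ.s≤s ℕ.z≤n))) (begin
      2ℚ * (treeBound L bs U * y²) ≤⟨ *-mono-≤ 0≤2 (0≤* (0≤pow 0≤u M) 0≤y²) 2≤u
          (*-monoʳ-≤ y² 0≤y² (treeBound≤ (size N) (suc (suc N)) d 2≤u 1≤L L≤ d+d≤ 2^ℓ≤2d bs U c≤d coll≤)) ⟩
      u * (powℚ u M * y²) ≡⟨ *-assoc u (powℚ u M) y² ⟨
      powℚ u (suc M) * y² ≤⟨ *-monoʳ-≤ y² 0≤y² (pow-monoʳ 1≤u (ℕₚ.≤-trans M<e (ℕₚ.m≤m+n e e))) ⟩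
      powℚ u (e ℕ.+ e) * y² ≡⟨ trans (cong₂ _*_ (pow-+ u e e) (sym (∣x∣² (x U)))) (solve 2 (λ p y → (p :* p) :* (y :* y) := (y :* p) :* (y :* p)) refl (powℚ u e) (∣ x U ∣)) ⟩
      z * z ≤⟨ *-mono-≤ 0≤z 0≤1 (below⇒ U b) (below⇒ U b) ⟩
      1ℚ ≡⟨⟩
      2ℚ * ½ ∎)) (*<* (ℤ.+<+ (ℕ.s≤s (ℕ.s≤s ℕ.z≤n))))
      where
      open ≤-Reasoning
      y² = f̂² f U
      0≤y² = 0≤f̂² f U
      z : ℚ
      z = (∣ x U ∣) * powℚ u e
      0≤z : 0ℚ ≤ z
      0≤z = 0≤* (0≤∣p∣ (x U)) (0≤pow 0≤u e)
      M = d ℕ.* degree N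
      M<e : suc M ℕ.≤ e
      M<e = subst (suc M ℕ.≤_) (sym (ℕₚ.*-suc d (degree N))) (ℕₚ.+-monoˡ-≤ M 0<d)

    small⇒ : ∀ U → small U ≡ true → nz U ≡ true × card U ℕ.≤ d ×
      (∀ (bs : Vec (V n) ℓ) → collisions bs U ℕ.≤ d ℕ.+ d → treeBound L bs U * f̂² f U < 1ℚ)
    small⇒ U s = proj₁ (∧-true {nz U} s) , c≤d , tiny U (proj₁ bl) c≤d
      where
      bl = ∧-true {below U} (proj₂ (∧-true {nz U} s))
      c≤d : card U ℕ.≤ d
      c≤d = ℕₚ.≤-pred (ℕₚ.≰⇒> (does-false (suc d ℕₚ.≤? card U) (not-inj (proj₂ bl))))

    Inf≤ : Inf f ≤ ι a * v
    Inf≤ = subst (_≤ ι a * v) (Ĩ*var f nc) (*-monoʳ-≤ v 0≤v I≤a)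

    -- Converts weight at most `Inf f / d` into weight at most `v / N`, by `Inf f ≤ a v` and
    -- `d = N a`.
    d*⇒N* : ∀ {s} → ι d * s ≤ Inf f → ι N * s ≤ v
    d*⇒N* {s} h = *-cancelˡ-≤ (ι a) (<-≤-trans 0<1 (ι-mono 0<a)) (subst (_≤ ι a * v)
      (trans (cong (_* s) (trans (ι-* N a) (*-comm (ι N) (ι a)))) (*-assoc (ι a) (ι N) s)) (≤-trans h Inf≤))

    F∑ : (V n → Bool) → ℚ
    F∑ p = S (full n) (λ U → bval (p U) * f̂² f U)

    small≤ : ι N * F∑ small ≤ v
    small≤ = d*⇒N* (*-cancelˡ-≤ (ι 32 * ι d) (0<* {ι 32} (*<* (ℤ.+<+ (ℕ.s≤s ℕ.z≤n))) 0<ιd) (begin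
      (ι 32 * ι d) * (ι d * F∑ small) ≡⟨ trans (solve 3 (λ c d s → (c :* d) :* (d :* s) := (c :* (d :* d)) :* s) refl (ι 32) (ι d) (F∑ small)) (cong (_* F∑ small) (sym L≡)) ⟩
      L * F∑ small ≤⟨ lowDegree (fval f) (F-Boolean f) 1≤L d ℓ 0<d d≤2^ℓ small small⇒ ⟩
      2ℚ * (lossFactor ℓ * infl (full n) (fval f)) ≡⟨ cong (λ z → 2ℚ * (lossFactor ℓ * z)) (Inf≡ f) ⟨
      2ℚ * (lossFactor ℓ * Inf f) ≤⟨ *-monoˡ-≤ 2ℚ 0≤2 (*-monoʳ-≤ (Inf f) 0≤Inf loss≤) ⟩
      2ℚ * ((+ 8 / 1) * (ι d + ι d) * Inf f) ≡⟨ solve 2 (λ d i → con 2ℚ :* (con (+ 8 / 1) :* (d :+ d) :* i) := (con (ι 32) :* d) :* i) refl (ι d) (Inf f) ⟩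
      (ι 32 * ι d) * Inf f ∎))
      where
      open ≤-Reasoning
      0≤Inf = ≤-trans 0≤v (var≤Inf f)
      loss≤ : lossFactor ℓ ≤ (+ 8 / 1) * (ι d + ι d)
      loss≤ = begin
        lossFactor ℓ ≤⟨ ≤-by 4ℚ 0≤4 refl ⟩
        lossFactor ℓ + 4ℚ ≡⟨ trans (lossFactor+4 ℓ) (cong ((+ 8 / 1) *_) (pow-2 ℓ)) ⟩
        (+ 8 / 1) * ι (2 ℕ.^ ℓ) ≤⟨ *-monoˡ-≤ (+ 8 / 1) (*≤* (ℤ.+≤+ ℕ.z≤n)) (subst (ι (2 ℕ.^ ℓ) ≤_) (ι-+ d d) (ι-mono 2^ℓ≤2d)) ⟩
        (+ 8 / 1) * (ι d + ι d) ∎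

    large≤ : ι N * F∑ large ≤ v
    large≤ = d*⇒N* (begin
      ι d * F∑ large ≡⟨ W-* (modes (full n)) (ι d) (λ U → bval (large U) * f̂² f U) ⟨
      S (full n) (λ U → ι d * (bval (large U) * f̂² f U)) ≤⟨ W-mono (modes-NN (full n)) (λ U _ → pt U (large U) refl) ⟩
      infl (full n) (fval f) ≡⟨ Inf≡ f ⟨
      Inf f ∎)
      where
      open ≤-Reasoning
      pt : ∀ U b → large U ≡ b → ι d * (bval b * f̂² f U) ≤ ι (card (full n ∩ U)) * f̂² f U
      pt U false _ = ≤-trans (≤-reflexive (solve 2 (λ d y → d :* (con 0ℚ :* y) := con 0ℚ) refl (ι d) (f̂² f U))) (0≤* (0≤ι (card (full n ∩ U))) (0≤f̂² f U))
      pt U true e′ = ≤-trans (≤-reflexive (cong (ι d *_) (*-identityˡ (f̂² f U))))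
        (*-monoʳ-≤ (f̂² f U) (0≤f̂² f U) (ι-mono (subst (λ Z → d ℕ.≤ card Z) (sym (full-∩ U)) (ℕₚ.<⇒≤ (does-true (suc d ℕₚ.≤? card U) e′)))))

    p : ℚ
    p = mean f

    -- The empty coefficient is the mean `p`, which the variance does not see directly. If it lies
    -- below the threshold, then `(1 + N) p ≤ 1`, and `p - p² - N p² = p (1 - (1 + N) p)` is
    -- nonnegative.
    empty≤ : ι N * (bval (below (empty n)) * f̂² f (empty n)) ≤ v
    empty≤ = go (below (empty n)) refl
      where
      go : ∀ b → below (empty n) ≡ b → ι N * (bval b * f̂² f (empty n)) ≤ v
      go false _ = subst (_≤ v) (solve 2 (λ n y → con 0ℚ := n :* (con 0ℚ :* y)) refl (ι N) (f̂² f (empty n))) 0≤v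
      go true b = subst₂ _≤_ (cong (λ z → ι N * z) (trans (cong (λ z → z * z) (sym (T-full-empty (fval f)))) (sym (*-identityˡ (f̂² f (empty n)))))) (sym (var≡mean f))
        (≤-by (p * (1ℚ - (1ℚ + ι N) * p)) (0≤* (0≤mean f) (x≤y⇒0≤y-x [1+N]p≤1))
          (solve 2 (λ n p → p :- p :* p := n :* (p :* p) :+ p :* (con 1ℚ :- (con 1ℚ :+ n) :* p)) refl (ι N) p))
        where
        open ≤-Reasoning
        suc-N≤e : suc N ℕ.≤ e
        suc-N≤e = ℕₚ.≤-trans (N<degree N) (ℕₚ.≤-trans (ℕₚ.n≤1+n (degree N)) (subst (suc (degree N) ℕ.≤_) (ℕₚ.*-comm (suc (degree N)) d) (ℕₚ.≤-trans (ℕₚ.≤-reflexive (sym (ℕₚ.*-identityʳ (suc (degree N))))) (ℕₚ.*-monoʳ-≤ (suc (degree N)) 0<d))))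
        [1+N]p≤1 : (1ℚ + ι N) * p ≤ 1ℚ
        [1+N]p≤1 = begin
          (1ℚ + ι N) * p ≡⟨ cong (_* p) (ι-+ 1 N) ⟨
          ι (suc N) * p ≤⟨ *-monoʳ-≤ p (0≤mean f) (≤-trans (ι≤pow-2 (suc N)) (≤-trans (pow-monoˡ 0≤2 2≤u (suc N)) (pow-monoʳ 1≤u suc-N≤e))) ⟩
          powℚ u e * p ≡⟨ trans (*-comm (powℚ u e) p) (cong (_* powℚ u e) (sym (trans (cong ∣_∣ (T-full-empty (fval f))) (0≤p⇒∣p∣≡p (0≤mean f))))) ⟩
          (∣ x (empty n) ∣) * powℚ u e ≤⟨ below⇒ (empty n) b ⟩
          1ℚ ∎

    split : ∀ U → (if below U then fhat f U * fhat f U else 0ℚ) ≤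
      (bval (small U) * f̂² f U + bval (large U) * f̂² f U) + bval (not (nz U)) * (bval (below U) * f̂² f U)
    split U = subst (λ t → (if below U then t else 0ℚ) ≤ R) (sym (cong (λ t → t * t) (fhat≡ f U))) (go (below U) (nz U) (large U))
      where
      R = (bval (small U) * f̂² f U + bval (large U) * f̂² f U) + bval (not (nz U)) * (bval (below U) * f̂² f U)
      y = f̂² f U
      0≤y = 0≤f̂² f U
      go : ∀ b z l → (if b then y else 0ℚ) ≤ (bval (z ∧ (b ∧ not l)) * y + bval l * y) + bval (not z) * (bval b * y)
      go false z l = 0≤+ (0≤+ (0≤* (0≤bval (z ∧ false)) 0≤y) (0≤* (0≤bval l) 0≤y)) (0≤* (0≤bval (not z)) (0≤* (0≤bval false) 0≤y))
      go true true true = ≤-reflexive (solve 1 (λ y → y := (con 0ℚ :* y :+ con 1ℚ :* y) :+ con 0ℚ :* (con 1ℚ :* y)) refl y)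
      go true true false = ≤-reflexive (solve 1 (λ y → y := (con 1ℚ :* y :+ con 0ℚ :* y) :+ con 0ℚ :* (con 1ℚ :* y)) refl y)
      go true false l = ≤-by (bval l * y) (0≤* (0≤bval l) 0≤y) (solve 2 (λ y l → (con 0ℚ :* y :+ l) :+ con 1ℚ :* (con 1ℚ :* y) := y :+ l) refl y (bval l * y))

  smallMass-bound : ι N * smallMass (ι (2 ℕ.* rate N)) f ≤ (v + v) + v
  smallMass-bound = begin
    ι N * smallMass D f ≡⟨ cong (ι N *_) (sum-allVecs n (λ U → if below U then fhat f U * fhat f U else 0ℚ)) ⟩
    ι N * S (full n) (λ U → if below U then fhat f U * fhat f U else 0ℚ) ≤⟨ *-monoˡ-≤ (ι N) (0≤ι N) (W-mono (modes-NN (full n)) (λ U _ → split U)) ⟩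
    ι N * S (full n) (λ U → (bval (small U) * f̂² f U + bval (large U) * f̂² f U) + bval (not (nz U)) * (bval (below U) * f̂² f U))
      ≡⟨ cong (ι N *_) (trans (W-+ (modes (full n)) (λ U → bval (small U) * f̂² f U + bval (large U) * f̂² f U) (λ U → bval (not (nz U)) * (bval (below U) * f̂² f U)))
           (cong₂ _+_ (W-+ (modes (full n)) (λ U → bval (small U) * f̂² f U) (λ U → bval (large U) * f̂² f U)) (S-isZero (λ U → bval (below U) * f̂² f U)))) ⟩
    ι N * ((F∑ small + F∑ large) + z) ≡⟨ solve 4 (λ n a b c → n :* ((a :+ b) :+ c) := (n :* a :+ n :* b) :+ n :* c) refl (ι N) (F∑ small) (F∑ large) z ⟩
    (ι N * F∑ small + ι N * F∑ large) + ι N * z ≤⟨ +-mono-≤ (+-mono-≤ small≤ large≤) empty≤ ⟩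
    (v + v) + v ∎
    where
    open ≤-Reasoning
    z = bval (below (empty n)) * f̂² f (empty n)

smallMass≤3var : ∀ N → 0 ℕ.< N → (f : V n → Bool) → NonConstant f →
  ι N * smallMass (ι (2 ℕ.* rate N)) f ≤ 3ℚ * var f
smallMass≤3var N 0<N f nc = choose (ceil (Ĩ f) (≤-trans 0≤1 (1≤Ĩ f nc)))
  where
  Goal = ι N * smallMass (ι (2 ℕ.* rate N)) f ≤ 3ℚ * var f
  choose : (∃ λ a → Ĩ f ≤ ι a × ι a ≤ 1ℚ + Ĩ f) → Goal
  choose (a , I≤a , a≤u) = finish (power-between (N ℕ.* a) (ℕₚ.*-mono-≤ 0<N (1≤ι⇒0< (≤-trans (1≤Ĩ f nc) I≤a))))
    where
    finish : (∃ λ ℓ → N ℕ.* a ℕ.≤ 2 ℕ.^ ℓ × 2 ℕ.^ ℓ ℕ.≤ N ℕ.* a ℕ.+ N ℕ.* a) → Goal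
    finish (ℓ , d≤2^ℓ , 2^ℓ≤2d) = ≤-trans (Assembly.smallMass-bound N 0<N f nc a I≤a a≤u ℓ d≤2^ℓ 2^ℓ≤2d)
      (≤-reflexive (solve 1 (λ v → (v :+ v) :+ v := con 3ℚ :* v) refl (var f)))

0<2rate : ∀ N → 0 ℕ.< N → 0ℚ < ι (2 ℕ.* rate N)
0<2rate N 0<N = <-≤-trans 0<1 (ι-mono (ℕₚ.*-mono-≤ {1} {2} {1} {rate N} (ℕ.s≤s ℕ.z≤n) (ℕₚ.*-mono-≤ {1} {N} {1} {suc (degree N)} 0<N (ℕ.s≤s ℕ.z≤n))))

theorem1p2 : (η : ℚ) → 0ℚ < η →
    ∃ λ (D : ℚ) → 0ℚ < D ×
    ((n : ℕ) (f : Vec Bool n → Bool) → NonConstant f →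
    smallMass D f ≤ η * var f)
theorem1p2 η 0<η = choose (reciprocal 0<η)
  where
  Goal = ∃ λ (D : ℚ) → 0ℚ < D × ((n : ℕ) (f : Vec Bool n → Bool) → NonConstant f → smallMass D f ≤ η * var f)
  finish : ∀ N → 0 ℕ.< N → 3ℚ ≤ η * ι N → Goal
  finish N 0<N 3≤ηN = ι (2 ℕ.* rate N) , 0<2rate N 0<N , λ n f nc → *-cancelˡ-≤ (ι N) (<-≤-trans 0<1 (ι-mono 0<N)) (begin
    ι N * smallMass (ι (2 ℕ.* rate N)) f ≤⟨ smallMass≤3var N 0<N f nc ⟩
    3ℚ * var f ≤⟨ *-monoʳ-≤ (var f) (<⇒≤ (0<var f nc)) 3≤ηN ⟩
    (η * ι N) * var f ≡⟨ solve 3 (λ e n v → (e :* n) :* v := n :* (e :* v)) refl η (ι N) (var f) ⟩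
    ι N * (η * var f) ∎)
    where open ≤-Reasoning
  choose : (∃ λ ζ → 0ℚ ≤ ζ × η * ζ ≡ 1ℚ) → Goal
  choose (ζ , _ , ηζ≡1) = pick (archimedes (3ℚ * ζ))
    where
    open ≤-Reasoning
    pick : (∃ λ k → 3ℚ * ζ ≤ ι k) → Goal
    -- Low, large and empty frequencies contribute at most `var f / N` each, so `N ≥ 3/η` suffices;
    -- the successor ensures `0 < N`. The rate depends on `N` alone, hence neither on `n` nor on
    -- `f`.
    pick (k , 3ζ≤k) = finish (suc k) (ℕ.s≤s ℕ.z≤n) (begin
      3ℚ * 1ℚ ≡⟨ cong (3ℚ *_) ηζ≡1 ⟨
      3ℚ * (η * ζ) ≡⟨ solve 2 (λ e z → con 3ℚ :* (e :* z) := e :* (con 3ℚ :* z)) refl η ζ ⟩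
      η * (3ℚ * ζ) ≤⟨ *-monoˡ-≤ η (<⇒≤ 0<η) (≤-trans 3ζ≤k (ι-mono (ℕₚ.n≤1+n k))) ⟩
      η * ι (suc k) ∎)
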